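{- There is a polynomial-time algorithm that, given a finite undirected graph $G$, computes the number of homogeneous pairs in $G$.
   Context: Graphs are simple (no loops). A homogeneous pair in a graph $G=(V,E)$ is a partition of $V$ into (pairwise disjoint, labelled, with $W_1$ or $W_2$ possibly empty) sets $U$, $W_1$ and $W_2$ such that: $|U|\geq 2$; $|W_1|\geq 2$ or $|W_2|\geq 2$ (or both); for every vertex $v\in U$, $v$ is either adjacent to every vertex in $W_1$ or to none of them; and for every vertex $v\in U$, $v$ is either adjacent to every vertex in $W_2$ or to none of them. Homogeneous pairs are counted as ordered triples $(U,W_1,W_2)$. -}

module Defs where

open import Data.Bool using (Bool; true; false; T)
import Data.Bool.Properties as Bool
open import Data.Fin using (Fin; zero)
open import Data.Fin.Properties using (all?)
open import Data.Fin.Subset using (Subset; inside; outside; _∈_; _∪_; _∩_; ∣_∣; ⊤; ⊥)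
open import Data.Fin.Subset.Properties using (_∈?_)
open import Data.List using (List; []; _∷_; length; map; filter; cartesianProduct; _++_)
open import Data.Nat using (ℕ; zero; suc; _+_; _*_; _^_; _≤_; _≤?_)
open import Data.Nat.Binary using (ℕᵇ; zero; 2[1+_]; 1+[2_]; fromℕ)
open import Data.Product using (Σ; ∃; _×_; _,_)
open import Data.Sum using (_⊎_)
open import Data.Vec as Vec using (Vec; lookup; _[_]≔_; replicate; tabulate)
open import Data.Vec.Properties using (≡-dec)
open import Relation.Binary.PropositionalEquality using (_≡_; _≢_)
open import Relation.Nullary using (¬_; Dec; ¬?; _×-dec_; _⊎-dec_; _→-dec_; map′)
open import Relation.Nullary.Decidable using (T?)

------------------------------------------------------------------------
-- Graphs and homogeneous pairs

record Graph (n : ℕ) : Set where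
  field
    adj     : Fin n → Fin n → Bool
    sym     : ∀ u v → adj u v ≡ adj v u
    irrefl  : ∀ v → adj v v ≡ false

  Adj : Fin n → Fin n → Set
  Adj u v = T (adj u v)

FiniteGraph : Set
FiniteGraph = ∃ Graph

module _ {n : ℕ} (G : Graph n) where
  open Graph G

  AllOrNone : Fin n → Subset n → Set
  AllOrNone v W = (∀ w → w ∈ W → Adj v w) ⊎ (∀ w → w ∈ W → ¬ Adj v w)

  allOrNone? : ∀ v W → Dec (AllOrNone v W)
  allOrNone? v W =
          all? (λ w → (w ∈? W) →-dec T? (adj v w))
    ⊎-dec all? (λ w → (w ∈? W) →-dec ¬? (T? (adj v w)))

  record IsHomogeneousPair (U W₁ W₂ : Subset n) : Set where
    field
      U∩W₁≡⊥      : U ∩ W₁ ≡ ⊥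
      U∩W₂≡⊥      : U ∩ W₂ ≡ ⊥
      W₁∩W₂≡⊥     : W₁ ∩ W₂ ≡ ⊥
      U∪W₁∪W₂≡⊤   : U ∪ W₁ ∪ W₂ ≡ ⊤
      2≤∣U∣        : 2 ≤ ∣ U ∣
      2≤∣W₁∣⊎2≤∣W₂∣ : 2 ≤ ∣ W₁ ∣ ⊎ 2 ≤ ∣ W₂ ∣
      homogeneous₁ : ∀ v → v ∈ U → AllOrNone v W₁
      homogeneous₂ : ∀ v → v ∈ U → AllOrNone v W₂

  isHomogeneousPair? : ∀ U W₁ W₂ → Dec (IsHomogeneousPair U W₁ W₂)
  isHomogeneousPair? U W₁ W₂ = map′
    (λ (a , b , c , d , e , f , g , h) → record
      { U∩W₁≡⊥ = a ; U∩W₂≡⊥ = b ; W₁∩W₂≡⊥ = c ; U∪W₁∪W₂≡⊤ = d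
      ; 2≤∣U∣ = e ; 2≤∣W₁∣⊎2≤∣W₂∣ = f ; homogeneous₁ = g ; homogeneous₂ = h })
    (λ p → let open IsHomogeneousPair p in
      U∩W₁≡⊥ , U∩W₂≡⊥ , W₁∩W₂≡⊥ , U∪W₁∪W₂≡⊤ ,
      2≤∣U∣ , 2≤∣W₁∣⊎2≤∣W₂∣ , homogeneous₁ , homogeneous₂)
    (      (U ∩ W₁) ≟ ⊥
     ×-dec (U ∩ W₂) ≟ ⊥
     ×-dec (W₁ ∩ W₂) ≟ ⊥
     ×-dec (U ∪ W₁ ∪ W₂) ≟ ⊤
     ×-dec 2 ≤? ∣ U ∣
     ×-dec (2 ≤? ∣ W₁ ∣ ⊎-dec 2 ≤? ∣ W₂ ∣)
     ×-dec all? (λ v → (v ∈? U) →-dec allOrNone? v W₁)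
     ×-dec all? (λ v → (v ∈? U) →-dec allOrNone? v W₂))
    where
    infix 4 _≟_
    _≟_ : (p q : Subset n) → Dec (p ≡ q)
    _≟_ = ≡-dec Bool._≟_

-- Every subset of Fin n occurs exactly once.
subsets : ∀ n → List (Subset n)
subsets zero    = Vec.[] ∷ []
subsets (suc n) = map (outside Vec.∷_) (subsets n) ++ map (inside Vec.∷_) (subsets n)

homogeneousPairs : ∀ {n} → Graph n → List (Subset n × Subset n × Subset n)
homogeneousPairs {n} G =
  filter (λ (U , W₁ , W₂) → isHomogeneousPair? G U W₁ W₂)
    (cartesianProduct (subsets n) (cartesianProduct (subsets n) (subsets n)))

numHomogeneousPairs : FiniteGraph → ℕ
numHomogeneousPairs (_ , G) = length (homogeneousPairs G)

------------------------------------------------------------------------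
-- Model of computation: imperative WHILE programs whose finitely many
-- variables hold binary trees (Jones, "Computability and Complexity").

data Tree : Set where
  nil  : Tree
  cons : Tree → Tree → Tree

size : Tree → ℕ
size nil        = 1
size (cons s t) = suc (size s + size t)

head tail : Tree → Tree
head nil        = nil
head (cons s t) = s
tail nil        = nil
tail (cons s t) = t

infix  8 _≔_
infixr 7 _⨾_

data Expr (k : ℕ) : Set where
  var     : Fin k → Expr k
  nil     : Expr k
  cons    : Expr k → Expr k → Expr k
  hd tl   : Expr k → Expr k

data Cmd (k : ℕ) : Set where
  skip           : Cmd k
  _≔_            : Fin k → Expr k → Cmd k
  _⨾_            : Cmd k → Cmd k → Cmd k
  if_then_else_  : Expr k → Cmd k → Cmd k → Cmd k
  while_loop_    : Expr k → Cmd k → Cmd k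

Store : ℕ → Set
Store k = Vec Tree k

eval : ∀ {k} → Expr k → Store k → Tree
eval (var x)    σ = lookup σ x
eval nil        σ = nil
eval (cons d e) σ = cons (eval d σ) (eval e σ)
eval (hd e)     σ = head (eval e σ)
eval (tl e)     σ = tail (eval e σ)

-- Reading a variable is charged the size of the tree it holds, i.e. trees are
-- copied rather than shared.  Hence no tree larger than the elapsed time plus
-- the initial store can be built, and running time agrees with
-- Turing-machine time up to a polynomial.
cost : ∀ {k} → Expr k → Store k → ℕ
cost (var x)    σ = size (lookup σ x)
cost nil        σ = 1
cost (cons d e) σ = suc (cost d σ + cost e σ)
cost (hd e)     σ = suc (cost e σ)
cost (tl e)     σ = suc (cost e σ)

-- ⟨ c , σ ⟩⇓ σ′ [ t ]: run from the store σ, the command c halts in the store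
-- σ′ after time t.  In tests, nil is false and every other tree is true.
infix 4 ⟨_,_⟩⇓_[_]

data ⟨_,_⟩⇓_[_] {k : ℕ} : Cmd k → Store k → Store k → ℕ → Set where

  skip : ∀ {σ} → ⟨ skip , σ ⟩⇓ σ [ 1 ]

  assign : ∀ {σ x e} → ⟨ x ≔ e , σ ⟩⇓ σ [ x ]≔ eval e σ [ suc (cost e σ) ]

  seq : ∀ {σ σ′ σ″ c d s t} →
    ⟨ c , σ ⟩⇓ σ′ [ s ] → ⟨ d , σ′ ⟩⇓ σ″ [ t ] →
    ⟨ c ⨾ d , σ ⟩⇓ σ″ [ s + t ]

  if-true : ∀ {σ σ′ e c d t} → eval e σ ≢ nil →
    ⟨ c , σ ⟩⇓ σ′ [ t ] →
    ⟨ if e then c else d , σ ⟩⇓ σ′ [ suc (cost e σ + t) ]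

  if-false : ∀ {σ σ′ e c d t} → eval e σ ≡ nil →
    ⟨ d , σ ⟩⇓ σ′ [ t ] →
    ⟨ if e then c else d , σ ⟩⇓ σ′ [ suc (cost e σ + t) ]

  while-true : ∀ {σ σ′ σ″ e c s t} → eval e σ ≢ nil →
    ⟨ c , σ ⟩⇓ σ′ [ s ] → ⟨ while e loop c , σ′ ⟩⇓ σ″ [ t ] →
    ⟨ while e loop c , σ ⟩⇓ σ″ [ suc (cost e σ + (s + t)) ]

  while-false : ∀ {σ e c} → eval e σ ≡ nil →
    ⟨ while e loop c , σ ⟩⇓ σ [ suc (cost e σ) ]

-- The input is placed in variable zero, all other variables starting as nil;
-- the output is read off from variable zero.
Program : Set
Program = ∃ λ k → Cmd (suc k)

_on_outputs_within_ : Program → Tree → Tree → ℕ → Set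
(k , c) on d outputs r within b =
  ∃ λ σ → ∃ λ t →
    ⟨ c , d Vec.∷ replicate k nil ⟩⇓ σ [ t ] × lookup σ zero ≡ r × t ≤ b

PolyTimeComputable : {A B : Set} → (A → Tree) → (B → Tree) → (A → B) → Set
PolyTimeComputable encA encB f =
  Σ Program λ p → ∃ λ a → ∃ λ m → ∀ x →
    p on encA x outputs encB (f x) within (a * size (encA x) ^ m + a)

------------------------------------------------------------------------
-- Encodings of inputs and outputs as trees

encodeBool : Bool → Tree
encodeBool false = nil
encodeBool true  = cons nil nil

encodeVec : ∀ {A : Set} {n} → (A → Tree) → Vec A n → Tree
encodeVec enc Vec.[]       = nil
encodeVec enc (x Vec.∷ xs) = cons (enc x) (encodeVec enc xs)

-- The adjacency matrix, as a list of rows.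
encodeGraph : FiniteGraph → Tree
encodeGraph (_ , G) =
  encodeVec (encodeVec encodeBool) (tabulate λ u → tabulate λ v → Graph.adj G u v)

-- Binary numerals with digits 1 and 2, least significant digit first:
-- 1+[2 x ] has last digit 1 and 2[1+ x ] has last digit 2.
encodeℕᵇ : ℕᵇ → Tree
encodeℕᵇ zero     = nil
encodeℕᵇ 1+[2 x ] = cons (encodeBool false) (encodeℕᵇ x)
encodeℕᵇ 2[1+ x ] = cons (encodeBool true)  (encodeℕᵇ x)

encodeℕ : ℕ → Tree
encodeℕ n = encodeℕᵇ (fromℕ n)

{-# OPTIONS --safe #-}
-- Write W = W₁ ∪ W₂, so that U is the complement of W.  If W is a module, every split of W into W₁ and W₂
-- is homogeneous.  Otherwise the first vertex u outside W with neighbours and non-neighbours in W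
-- determines the split: its parts are W ∩ N(u) and W ∖ N(u).  So it remains to count the modules,
-- weighted by 2^∣W∣, and the sets W that are homogeneous for the outside both on N(u) and off N(u).
--
-- Fix an element a of W in N(u) and an element b of W off N(u).  These sets W are then those closed under a relation:
-- w forces v unless v sees w as it sees a (or b).  For two vertices v and w whether one, or else neither
-- or both, forces the other depends only on their adjacency to u, a and b, which gives eight classes.
-- Rank the vertices by the number of vertices they force directly or indirectly.  Guess, for each class, the
-- element of W of greatest rank and the element outside W of least rank, and propagate.  Among the
-- vertices left undetermined forcing is symmetric: if v forced w but not conversely, the two guesses in the
-- class of v would be comparable to w, and so w would lie strictly between them in rank, against the
-- choice of the guesses.  So the undetermined vertices fall into components, which are in or out of W
-- independently, and the count is a product; the number of guesses is polynomial.
--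
-- Programs are composed by combinators that carry a running time and an output size bound.

module Submission where

import Data.Bool as Bool using (T)
open import Data.Bool renaming (if_then_else_ to if_yes_no_) using (Bool; true; false; _∧_; _∨_; not; _xor_)
import Data.Bool.Properties as Bool
open import Data.Empty using (⊥; ⊥-elim)
open import Data.Fin using (Fin; zero; suc; toℕ)
import Data.Fin.Properties as Fin
open import Data.Fin.Subset as Subset using (Subset; ∣_∣)
open import Data.List as List using (List; []; _∷_; _++_; allFin; cartesianProduct; concatMap; filter; foldl; foldr; length; map; reverse)
open import Data.List.Membership.Propositional using () renaming (_∈_ to _∈ˡ_)
open import Data.List.Membership.Propositional.Properties using (∈-cartesianProduct⁺)
import Data.List.Properties as List
open import Data.List.Relation.Unary.All as All using (All; []; _∷_)
import Data.List.Relation.Unary.All.Properties as All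
import Data.List.Relation.Unary.Any as Any
open import Data.Nat using (ℕ; zero; suc; _+_; _*_; _^_; _≤_; _<_; _<ᵇ_; z≤n; s≤s; >-nonZero)
open import Data.Nat.Binary using (ℕᵇ; zero; 2[1+_]; 1+[2_]; fromℕ) renaming (toℕ to toℕᵇ)
open import Data.Nat.Binary.Properties using (fromℕ-toℕ; toℕ-fromℕ)
open import Data.Nat.Properties
open import Data.Nat.Solver using (module +-*-Solver)
open import Data.Product using (Σ; ∃; _×_; _,_; proj₁; proj₂)
open import Data.Sum as Sum using (_⊎_; inj₁; inj₂; [_,_])
open import Data.Unit using (tt) renaming (⊤ to Unit)
open import Data.Vec as Vec using ([]; _∷_; lookup)
import Data.Vec.Properties as Vec
open import Function using (_∘_; id; flip)
open import Relation.Binary using (tri<; tri≈; tri>)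
open import Relation.Binary.PropositionalEquality hiding ([_])
open import Relation.Nullary using (¬_; Dec; yes; no; ¬?; _×-dec_; _⊎-dec_; _→-dec_; map′; contradiction)

open import Defs

-- Polynomial bounds

-- Of binary arithmetic only addition is programmed. This suffices because every factor in the
-- product over components is a power of two, or one more than such a power, and is applied by
-- repeated doubling and a single addition. The counts must be exact without any division, so no set
-- W may be met twice. Each existence condition on W (two elements inside, two outside, a third
-- element, a neighbour and a non-neighbour of u, the guesses) therefore becomes a sum over the
-- first witness in a strict order, and being first is again a condition that puts certain vertices
-- inside or outside W. The eight classes come from the symmetry of the graph: comparing `forces`
-- from v to w with `forces` from w to v, the two adjacency entries cancel, and what remains
-- involves only `N`, `s` and `t` at v and w. A guess has n + 1 outcomes, so the sixteen guesses
-- produce (n + 1)^16 cubes. Sets W with two elements are treated apart: three elements always leave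
-- two on one side of a split, whereas two elements allow only the splits with an empty side.

data Poly : Set where
  con         : ℕ → Poly
  arg         : Poly
  _⊕_ _⊗_ _⊚_ : Poly → Poly → Poly

infixl 6 _⊕_
infixl 7 _⊗_
infixr 8 _⊚_

⟦_⟧ : Poly → ℕ → ℕ
⟦ con k ⟧ n = k
⟦ arg ⟧ n   = n
⟦ p ⊕ q ⟧ n = ⟦ p ⟧ n + ⟦ q ⟧ n
⟦ p ⊗ q ⟧ n = ⟦ p ⟧ n * ⟦ q ⟧ n
⟦ p ⊚ q ⟧ n = ⟦ p ⟧ (⟦ q ⟧ n)

-- Bounds are a syntax and not arbitrary functions so that monotonicity is automatic. It is what
-- allows the time bound of a program to be applied to a mere upper bound on the size of its input.
⟦⟧-mono : ∀ p {m n} → m ≤ n → ⟦ p ⟧ m ≤ ⟦ p ⟧ n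
⟦⟧-mono (con k) m≤n = ≤-refl
⟦⟧-mono arg     m≤n = m≤n
⟦⟧-mono (p ⊕ q) m≤n = +-mono-≤ (⟦⟧-mono p m≤n) (⟦⟧-mono q m≤n)
⟦⟧-mono (p ⊗ q) m≤n = *-mono-≤ (⟦⟧-mono p m≤n) (⟦⟧-mono q m≤n)
⟦⟧-mono (p ⊚ q) m≤n = ⟦⟧-mono p (⟦⟧-mono q m≤n)

1≤suc^ : ∀ n k → 1 ≤ suc n ^ k
1≤suc^ n k = m^n>0 (suc n) k

^-distribʳ-* : ∀ k m n → (m * n) ^ k ≡ m ^ k * n ^ k
^-distribʳ-* zero    m n = refl
^-distribʳ-* (suc k) m n = trans (cong (m * n *_) (^-distribʳ-* k m n))
  (solve 4 (λ m n x y → (m :* n) :* (x :* y) := (m :* x) :* (n :* y)) refl m n (m ^ k) (n ^ k))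
  where open +-*-Solver using (solve; _:*_; _:=_)

-- Composition is what forces the shape c (1 + n)ᵏ.
poly-bound : ∀ p → ∃ λ c → ∃ λ k → ∀ n → ⟦ p ⟧ n ≤ c * suc n ^ k
poly-bound (con c) = c , 0 , λ n → ≤-reflexive (sym (*-identityʳ c))
poly-bound arg     = 1 , 1 , λ n → ≤-trans (n≤1+n n)
  (≤-reflexive (sym (trans (*-identityˡ (suc n ^ 1)) (^-identityʳ (suc n)))))
poly-bound (p ⊕ q) with poly-bound p | poly-bound q
... | c , k , p≤ | d , l , q≤ = c + d , k + l , λ n → begin
  ⟦ p ⟧ n + ⟦ q ⟧ n                         ≤⟨ +-mono-≤ (p≤ n) (q≤ n) ⟩
  c * suc n ^ k + d * suc n ^ l             ≤⟨ +-mono-≤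
    (*-monoʳ-≤ c (^-monoʳ-≤ (suc n) (m≤m+n k l))) (*-monoʳ-≤ d (^-monoʳ-≤ (suc n) (m≤n+m l k))) ⟩
  c * suc n ^ (k + l) + d * suc n ^ (k + l) ≡⟨ *-distribʳ-+ (suc n ^ (k + l)) c d ⟨
  (c + d) * suc n ^ (k + l)                 ∎
  where open ≤-Reasoning
poly-bound (p ⊗ q) with poly-bound p | poly-bound q
... | c , k , p≤ | d , l , q≤ = c * d , k + l , λ n → begin
  ⟦ p ⟧ n * ⟦ q ⟧ n                 ≤⟨ *-mono-≤ (p≤ n) (q≤ n) ⟩
  (c * suc n ^ k) * (d * suc n ^ l) ≡⟨ solve 4 (λ c x d y → (c :* x) :* (d :* y) := (c :* d) :* (x :* y)) refl
                                         c (suc n ^ k) d (suc n ^ l) ⟩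
  (c * d) * (suc n ^ k * suc n ^ l) ≡⟨ cong ((c * d) *_) (^-distribˡ-+-* (suc n) k l) ⟨
  (c * d) * suc n ^ (k + l)         ∎
  where open ≤-Reasoning; open +-*-Solver using (solve; _:*_; _:=_)
poly-bound (p ⊚ q) with poly-bound p | poly-bound q
... | c , k , p≤ | d , l , q≤ = c * suc d ^ k , l * k , λ n → begin
  ⟦ p ⟧ (⟦ q ⟧ n)                   ≤⟨ p≤ _ ⟩
  c * suc (⟦ q ⟧ n) ^ k             ≤⟨ *-monoʳ-≤ c (^-monoˡ-≤ k (+-mono-≤ (1≤suc^ n l) (q≤ n))) ⟩
  c * (suc d * suc n ^ l) ^ k       ≡⟨ cong (c *_) (^-distribʳ-* k (suc d) (suc n ^ l)) ⟩
  c * (suc d ^ k * (suc n ^ l) ^ k) ≡⟨ cong (λ z → c * (suc d ^ k * z)) (^-*-assoc (suc n) l k) ⟩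
  c * (suc d ^ k * suc n ^ (l * k)) ≡⟨ *-assoc c (suc d ^ k) _ ⟨
  c * suc d ^ k * suc n ^ (l * k)   ∎
  where open ≤-Reasoning

-- Timed execution of programs with one variable

1≤size : ∀ t → 1 ≤ size t
1≤size nil        = ≤-refl
1≤size (cons _ _) = s≤s z≤n

size-head : ∀ t → size (head t) ≤ size t
size-head nil        = ≤-refl
size-head (cons s t) = ≤-trans (m≤m+n (size s) (size t)) (n≤1+n _)

size-tail : ∀ t → size (tail t) ≤ size t
size-tail nil        = ≤-refl
size-tail (cons s t) = ≤-trans (m≤n+m (size t) (size s)) (n≤1+n _)

isCons : Tree → Bool
isCons nil        = false
isCons (cons _ _) = true

Run : Cmd 1 → Tree → Tree → ℕ → Set
Run c s s′ b = ∃ λ t → ⟨ c , s ∷ [] ⟩⇓ s′ ∷ [] [ t ] × t ≤ b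

nodes : Expr 1 → ℕ
nodes (var x)    = 1
nodes nil        = 1
nodes (cons d e) = suc (nodes d + nodes e)
nodes (hd e)     = suc (nodes e)
nodes (tl e)     = suc (nodes e)

cost≤ : ∀ e t → cost e (t ∷ []) ≤ nodes e * size t
cost≤ (var zero) t = ≤-reflexive (sym (*-identityˡ (size t)))
cost≤ nil        t = ≤-trans (1≤size t) (≤-reflexive (sym (*-identityˡ (size t))))
cost≤ (cons d e) t = +-mono-≤ (1≤size t)
  (≤-trans (+-mono-≤ (cost≤ d t) (cost≤ e t)) (≤-reflexive (sym (*-distribʳ-+ (size t) (nodes d) (nodes e)))))
cost≤ (hd e)     t = +-mono-≤ (1≤size t) (cost≤ e t)
cost≤ (tl e)     t = +-mono-≤ (1≤size t) (cost≤ e t)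

-- Sizes are measured against a parameter `S` of the instance and not against the current store, so
-- that all stages of a composite program share one measure.
record Bounded {Z : Set} (S : Z → ℕ) (t : Z → Tree) : Set where
  constructor _,_
  field
    sizePoly : Poly
    size≤    : ∀ z → size (t z) ≤ ⟦ sizePoly ⟧ (S z)

record Timed {Z : Set} (S : Z → ℕ) (c : Cmd 1) (s s′ : Z → Tree) : Set where
  constructor _,_
  field
    timePoly : Poly
    run      : ∀ z → Run c (s z) (s′ z) (⟦ timePoly ⟧ (S z))

open Bounded
open Timed

module _ {Z : Set} {S : Z → ℕ} where

  cons-bounded : ∀ {s t} → Bounded S s → Bounded S t → Bounded S (λ z → cons (s z) (t z))
  cons-bounded (p , s≤) (q , t≤) = con 1 ⊕ (p ⊕ q) , λ z → s≤s (+-mono-≤ (s≤ z) (t≤ z))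

  const-bounded : ∀ t → Bounded S (λ _ → t)
  const-bounded t = con (size t) , λ _ → ≤-refl

  smaller-bounded : ∀ {t} → (∀ z → size (t z) ≤ S z) → Bounded S t
  smaller-bounded t≤ = arg , t≤

  assign-timed : ∀ {e s s′} → Bounded S s → (∀ z → eval e (s z ∷ []) ≡ s′ z) → Timed S (zero ≔ e) s s′
  assign-timed {e} {s} (p , s≤) eq = con 1 ⊕ (con (nodes e) ⊗ p) , λ z →
    suc (cost e (s z ∷ [])) ,
    subst (λ t → ⟨ zero ≔ e , s z ∷ [] ⟩⇓ t ∷ [] [ suc (cost e (s z ∷ [])) ]) (eq z) assign ,
    s≤s (≤-trans (cost≤ e (s z)) (*-monoʳ-≤ (nodes e) (s≤ z)))

  infixr 5 _⨟_
  _⨟_ : ∀ {c d s s′ s″} → Timed S c s s′ → Timed S d s′ s″ → Timed S (c ⨾ d) s s″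
  (p , f) ⨟ (q , g) = p ⊕ q , λ z →
    let t , r , t≤ = f z ; t′ , r′ , t′≤ = g z in t + t′ , seq r r′ , +-mono-≤ t≤ t′≤

  bounded-≗ : ∀ {s t} → (∀ z → s z ≡ t z) → Bounded S s → Bounded S t
  bounded-≗ eq (p , s≤) = p , λ z → subst (λ u → size u ≤ ⟦ p ⟧ (S z)) (eq z) (s≤ z)

-- The rest r of the store is left untouched, so that programs can be run on a part of the data.
record Computes {X : Set} (env out : X → Tree) : Set where
  field
    code    : Cmd 1
    timed   : Timed {X × Tree} (λ (x , r) → size (cons (env x) r)) code
                (λ (x , r) → cons (env x) r) (λ (x , r) → cons (out x) r)
    bounded : Bounded (λ x → size (env x)) out

open Computes

module _ {X : Set} {env out : X → Tree} (f : Computes env out) {Z : Set} {S : Z → ℕ} (h : Z → X) where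

  call-timed : ∀ {r : Z → Tree} → Bounded S (λ z → cons (env (h z)) (r z)) →
    Timed S (code f) (λ z → cons (env (h z)) (r z)) (λ z → cons (out (h z)) (r z))
  call-timed {r} (p , ≤p) = timePoly (timed f) ⊚ p , λ z →
    let t , ran , t≤ = run (timed f) (h z , r z) in
    t , ran , ≤-trans t≤ (⟦⟧-mono (timePoly (timed f)) (≤p z))

  call-bounded : Bounded S (env ∘ h) → Bounded S (out ∘ h)
  call-bounded (p , ≤p) = sizePoly (bounded f) ⊚ p , λ z →
    ≤-trans (size≤ (bounded f) (h z)) (⟦⟧-mono (sizePoly (bounded f)) (≤p z))

module _ {X : Set} {env : X → Tree} where

  private
    Sz : X × Tree → ℕ
    Sz (x , r) = size (cons (env x) r)

    store-bounded : Bounded Sz (λ (x , r) → cons (env x) r)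
    store-bounded = smaller-bounded λ _ → ≤-refl

    env-bounded : Bounded Sz (λ (x , r) → env x)
    env-bounded = smaller-bounded λ (x , r) → size-head (cons (env x) r)

    rest-bounded : Bounded Sz (λ (x , r) → r)
    rest-bounded = smaller-bounded λ (x , r) → size-tail (cons (env x) r)

  private
    V = var {1} zero

  expr-computes : ∀ {out} e → (∀ x r → eval e (cons (env x) r ∷ []) ≡ out x) →
    Bounded (λ x → size (env x)) out → Computes env out
  expr-computes e eq bnd = record
    { code    = zero ≔ cons e (tl V)
    ; timed   = assign-timed store-bounded λ (x , r) → cong (λ t → cons t r) (eq x r)
    ; bounded = bnd }

  constE : ∀ t → Computes env (λ _ → t)
  constE t = expr-computes (quoteT t) (λ x r → quote-eval t _) (const-bounded t)
    where
    quoteT : Tree → Expr 1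
    quoteT nil        = nil
    quoteT (cons s t) = cons (quoteT s) (quoteT t)
    quote-eval : ∀ t σ → eval (quoteT t) σ ≡ t
    quote-eval nil        σ = refl
    quote-eval (cons s t) σ = cong₂ cons (quote-eval s σ) (quote-eval t σ)

  idE : Computes env env
  idE = expr-computes (hd V) (λ _ _ → refl) (smaller-bounded λ _ → ≤-refl)

  infixl 9 _⟫_
  _⟫_ : ∀ {mid out} → Computes env mid → Computes mid out → Computes env out
  f ⟫ g = record
    { code    = code f ⨾ code g
    ; timed   = call-timed f proj₁ store-bounded
           ⨟ call-timed g proj₁ (cons-bounded (call-bounded f proj₁ env-bounded) rest-bounded)
    ; bounded = call-bounded g id (bounded f) }

  consE : ∀ {s t} → Computes env s → Computes env t → Computes env (λ x → cons (s x) (t x))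
  consE f g = record
    -- `f` consumes the environment, so a copy for `g` is first put into the part of the store that
    -- `f` leaves alone.
    { code    = (zero ≔ cons (hd V) V)
              ⨾ code f
              ⨾ (zero ≔ cons (hd (tl V)) (cons (hd V) (tl (tl V))))
              ⨾ code g
              ⨾ (zero ≔ cons (cons (hd (tl V)) (hd V)) (tl (tl V)))
    ; timed   = assign-timed store-bounded (λ _ → refl)
           ⨟ call-timed f proj₁ (cons-bounded env-bounded store-bounded)
           ⨟ assign-timed (cons-bounded f-bounded store-bounded) (λ _ → refl)
           ⨟ call-timed g proj₁ (cons-bounded env-bounded (cons-bounded f-bounded rest-bounded))
           ⨟ assign-timed (cons-bounded g-bounded (cons-bounded f-bounded rest-bounded)) (λ _ → refl)
    ; bounded = cons-bounded (bounded f) (bounded g) }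
    where
    f-bounded = call-bounded f proj₁ env-bounded
    g-bounded = call-bounded g proj₁ env-bounded

  headE : ∀ {t} → Computes env t → Computes env (head ∘ t)
  headE f = f ⟫ expr-head
    where
    expr-head : ∀ {t : X → Tree} → Computes t (head ∘ t)
    expr-head {t} = record
      { code    = zero ≔ cons (hd (hd V)) (tl V)
      ; timed   = assign-timed (smaller-bounded λ _ → ≤-refl) λ _ → refl
      ; bounded = smaller-bounded λ x → size-head (t x) }

  tailE : ∀ {t} → Computes env t → Computes env (tail ∘ t)
  tailE f = f ⟫ expr-tail
    where
    expr-tail : ∀ {t : X → Tree} → Computes t (tail ∘ t)
    expr-tail {t} = record
      { code    = zero ≔ cons (tl (hd V)) (tl V)
      ; timed   = assign-timed (smaller-bounded λ _ → ≤-refl) λ _ → refl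
      ; bounded = smaller-bounded λ x → size-tail (t x) }

  ≗E : ∀ {s t} → (∀ x → s x ≡ t x) → Computes env s → Computes env t
  ≗E {s} {t} eq f = record
    { code    = code f
    ; timed   = timePoly (timed f) , λ (x , r) →
        subst (λ u → Run (code f) (cons (env x) r) (cons u r) (⟦ timePoly (timed f) ⟧ (Sz (x , r)))) (eq x)
          (run (timed f) (x , r))
    ; bounded = bounded-≗ eq (bounded f) }

  ifE : ∀ {b s t} → Computes env b → Computes env s → Computes env t →
    Computes env (λ x → if isCons (b x) yes s x no t x)
  ifE {b} {s} {t} cond f g = record
    { code    = (zero ≔ cons (hd V) V) ⨾ code cond ⨾
        if hd V then ((zero ≔ tl V) ⨾ code f) else ((zero ≔ tl V) ⨾ code g)
    ; timed   = assign-timed store-bounded (λ _ → refl)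
           ⨟ call-timed cond proj₁ (cons-bounded env-bounded store-bounded)
           ⨟ branch-timed
    ; bounded = sizePoly (bounded f) ⊕ sizePoly (bounded g) , out≤ }
    where
    out : X → Tree
    out x = if isCons (b x) yes s x no t x
    out≤ : ∀ x → size (out x) ≤ ⟦ sizePoly (bounded f) ⊕ sizePoly (bounded g) ⟧ (size (env x))
    out≤ x with b x
    ... | nil      = ≤-trans (size≤ (bounded g) x) (m≤n+m _ _)
    ... | cons _ _ = ≤-trans (size≤ (bounded f) x) (m≤m+n _ _)
    b-bounded : Bounded Sz (λ (x , r) → cons (b x) (cons (env x) r))
    b-bounded = cons-bounded (call-bounded cond proj₁ env-bounded) store-bounded
    then-timed = assign-timed {e = tl V} b-bounded (λ _ → refl) ⨟ call-timed f proj₁ store-bounded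
    else-timed = assign-timed {e = tl V} b-bounded (λ _ → refl) ⨟ call-timed g proj₁ store-bounded
    branch = if hd V then ((zero ≔ tl V) ⨾ code f) else ((zero ≔ tl V) ⨾ code g)
    branch-poly = (con 1 ⊕ (con 2 ⊗ sizePoly b-bounded)) ⊕ (timePoly then-timed ⊕ timePoly else-timed)
    test≤ : ∀ z → suc (cost (hd V) (cons (b (proj₁ z)) (cons (env (proj₁ z)) (proj₂ z)) ∷ []))
      ≤ ⟦ con 1 ⊕ (con 2 ⊗ sizePoly b-bounded) ⟧ (Sz z)
    test≤ z = s≤s (≤-trans (cost≤ (hd V) (cons (b (proj₁ z)) (cons (env (proj₁ z)) (proj₂ z)))) (*-monoʳ-≤ 2 (size≤ b-bounded z)))
    -- The tested tree is called `u` in the final store only, so that the case distinction does not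
    -- disturb the initial store.
    branch-run : ∀ z {u} → u ≡ b (proj₁ z) →
      Run branch (cons (b (proj₁ z)) (cons (env (proj₁ z)) (proj₂ z)))
                 (cons (if isCons u yes s (proj₁ z) no t (proj₁ z)) (proj₂ z)) (⟦ branch-poly ⟧ (Sz z))
    branch-run z {nil} eq = let n , ran , n≤ = run else-timed z in
      _ , if-false (sym eq) ran , +-mono-≤ (test≤ z) (≤-trans n≤ (m≤n+m _ (⟦ timePoly then-timed ⟧ (Sz z))))
    branch-run z {cons _ _} eq = let n , ran , n≤ = run then-timed z in
      _ , if-true (cons≢nil eq) ran , +-mono-≤ (test≤ z) (≤-trans n≤ (m≤m+n _ (⟦ timePoly else-timed ⟧ (Sz z))))
      where
      cons≢nil : ∀ {u v w : Tree} → cons u v ≡ w → w ≢ nil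
      cons≢nil refl ()
    branch-timed : Timed Sz branch (λ (x , r) → cons (b x) (cons (env x) r)) (λ (x , r) → cons (out x) r)
    branch-timed = branch-poly , λ z → branch-run z refl

module _ {X : Set} where

  -- Environments are nested pairs with the latest binding in front; `v0` and `wk` are de Bruijn
  -- variables for them.
  v0 : ∀ {a e : X → Tree} → Computes (λ x → cons (a x) (e x)) a
  v0 = headE idE

  rest : ∀ {a e : X → Tree} → Computes (λ x → cons (a x) (e x)) e
  rest = tailE idE

  wk : ∀ {a e o : X → Tree} → Computes e o → Computes (λ x → cons (a x) (e x)) o
  wk f = rest ⟫ f

-- The code stays the same; only the index set of the instances changes. This drops or regroups data
-- that a larger context carries along.
reindex : ∀ {X Y} {env out : X → Tree} (h : Y → X) → Computes env out → Computes (env ∘ h) (out ∘ h)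
reindex h f = record
  { code = code f
  ; timed = timePoly (timed f) , λ (y , r) → run (timed f) (h y , r)
  ; bounded = sizePoly (bounded f) , λ y → size≤ (bounded f) (h y) }

-- Lists and loops

-- The encodings are opaque so that they count as injective when implicit arguments are inferred.
opaque

  encList : {A : Set} → (A → Tree) → List A → Tree
  encList enc []       = nil
  encList enc (a ∷ as) = cons (enc a) (encList enc as)

opaque
  unfolding encList

  -- Membership is expressed by a decomposition of the list because this is the form in which loops
  -- describe the point that they have reached.
  size-encList : ∀ {A : Set} {enc : A → Tree} {k} (as : List A) → (∀ {a l₁ l₂} → l₁ ++ a ∷ l₂ ≡ as → size (enc a) ≤ k) →
    size (encList enc as) ≤ 1 + length as * suc k
  size-encList []       ≤k = ≤-refl
  size-encList {k = k} (a ∷ as) ≤k = s≤s (≤-trans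
    (+-mono-≤ (≤k {l₁ = []} refl) (size-encList as λ {a′} {l₁} eq → ≤k {l₁ = a ∷ l₁} (cong (a ∷_) eq)))
    (≤-reflexive (+-suc k _)))

  length≤size : ∀ {A : Set} {enc : A → Tree} (as : List A) → length as ≤ size (encList enc as)
  length≤size []       = z≤n
  length≤size {enc = enc} (a ∷ as) = s≤s (≤-trans (length≤size as) (m≤n+m _ (size (enc a))))

  size-suffix : ∀ {A : Set} {enc : A → Tree} (l₁ {l₂} : List A) → size (encList enc l₂) ≤ size (encList enc (l₁ ++ l₂))
  size-suffix []       = ≤-refl
  size-suffix {enc = enc} (a ∷ l₁) = ≤-trans (size-suffix l₁) (≤-trans (m≤n+m _ (size (enc a))) (n≤1+n _))

  size-element : ∀ {A : Set} {enc : A → Tree} (l₁ {l₂} : List A) {a} → size (enc a) ≤ size (encList enc (l₁ ++ a ∷ l₂))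
  size-element {enc = enc} l₁ {l₂} {a} = ≤-trans (size-head (encList enc (a ∷ l₂))) (size-suffix l₁)

module _ {X : Set} {env : X → Tree} {A S : X → Set} {encA : ∀ x → A x → Tree} {L : ∀ x → List (A x)}
  (encS : ∀ x → S x → Tree) (s₀ : ∀ x → S x) (f : ∀ x → S x → A x → S x)
  (list : Computes env (λ x → encList (encA x) (L x)))
  (init : Computes env (λ x → encS x (s₀ x)))
  (step : Computes {Σ X λ x → A x × S x}
            (λ (x , a , s) → cons (encA x a) (cons (encS x s) (env x))) (λ (x , a , s) → encS x (f x s a)))
  (states : Bounded {Σ X λ x → Σ (List (A x)) λ l₁ → Σ (List (A x)) λ l₂ → l₁ ++ l₂ ≡ L x} (λ (x , _) → size (env x))
              (λ (x , l₁ , _) → encS x (foldl (f x) (s₀ x) l₁)))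
  where

  private
    V = var {1} zero

    -- A point of the loop: `r` is the untouched rest of the store, `l₁` has been processed and `l₂`
    -- is still to come.
    Z : Set
    Z = Σ X λ x → Tree × Σ (List (A x)) λ l₁ → Σ (List (A x)) λ l₂ → l₁ ++ l₂ ≡ L x

    Sz : ∀ {P : X → Set} → Σ X (λ x → Tree × P x) → ℕ
    Sz (x , r , _) = size (cons (env x) r)

    Z′ : Set
    Z′ = Σ X λ x → Tree × Σ (List (A x)) λ l₁ → Σ (A x) λ a → Σ (List (A x)) λ l₂ → l₁ ++ a ∷ l₂ ≡ L x

  opaque
    unfolding encList

    private
      list-bounded : Bounded {Z} Sz (λ (x , r , l₁ , l₂ , _) → encList (encA x) l₂)
      list-bounded = sizePoly (bounded list) , λ (x , r , l₁ , l₂ , eq) →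
        ≤-trans (size-suffix l₁)
          (≤-trans (≤-reflexive (cong (size ∘ encList (encA x)) eq))
          (≤-trans (size≤ (bounded list) x) (⟦⟧-mono (sizePoly (bounded list)) (size-head (cons (env x) r)))))

      state-bounded : Bounded {Z} Sz (λ (x , r , l₁ , _) → encS x (foldl (f x) (s₀ x) l₁))
      state-bounded = sizePoly states , λ (x , r , p) →
        ≤-trans (size≤ states (x , p)) (⟦⟧-mono (sizePoly states) (size-head (cons (env x) r)))

      env-bounded : Bounded {Z} Sz (λ (x , r , _) → env x)
      env-bounded = smaller-bounded λ (x , r , _) → size-head (cons (env x) r)

      store : ∀ {x} → Tree → List (A x) → List (A x) → Tree
      store {x} r l₁ l₂ = cons (cons (encList (encA x) l₂) (cons (encS x (foldl (f x) (s₀ x) l₁)) (env x))) r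

      store-bounded : Bounded {Z} Sz (λ (x , r , l₁ , l₂ , _) → store r l₁ l₂)
      store-bounded = cons-bounded (cons-bounded list-bounded (cons-bounded state-bounded env-bounded)) rest-bounded
        where
        rest-bounded : Bounded {Z} Sz (λ (x , r , _) → r)
        rest-bounded = smaller-bounded λ (x , r , _) → size-tail (cons (env x) r)

      body : Cmd 1
      body = (zero ≔ cons (cons (hd (hd (hd V))) (tl (hd V)))
                       (cons (tl (hd (hd V))) (cons (tl (tl (hd V))) (tl V))))
           ⨾ code step
           ⨾ (zero ≔ cons (cons (hd (tl V)) (cons (hd V) (hd (tl (tl V))))) (tl (tl (tl V))))

      ∷ʳ-step : ∀ {x} (l₁ : List (A x)) {a l₂} → (l₁ List.∷ʳ a) ++ l₂ ≡ l₁ ++ a ∷ l₂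
      ∷ʳ-step l₁ = List.++-assoc l₁ _ _

      body-timed : Timed {Z′} Sz body
        (λ (x , r , l₁ , a , l₂ , _) → store r l₁ (a ∷ l₂)) (λ (x , r , l₁ , a , l₂ , _) → store r (l₁ List.∷ʳ a) l₂)
      body-timed =
             assign-timed (at store-bounded here (λ _ → refl)) (λ _ → refl)
        ⨟ call-timed step (λ (x , r , l₁ , a , _) → x , a , foldl (f x) (s₀ x) l₁)
               (cons-bounded (cons-bounded a-bounded (cons-bounded (at state-bounded here (λ _ → refl)) (at env-bounded here (λ _ → refl))))
                 rest-bounded)
        ⨟ assign-timed (cons-bounded (bounded-≗ (λ (x , r , l₁ , _) → cong (encS x) (List.foldl-∷ʳ (f x) (s₀ x) _ l₁))
                                          (at state-bounded there (λ _ → refl))) rest-bounded)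
               (λ (x , r , l₁ , a , l₂ , _) → cong (λ s → cons (cons (encList (encA x) l₂) (cons (encS x s) (env x))) r)
                 (sym (List.foldl-∷ʳ (f x) (s₀ x) a l₁)))
        where
        here there : Z′ → Z
        here  (x , r , l₁ , a , l₂ , eq) = x , r , l₁ , a ∷ l₂ , eq
        there (x , r , l₁ , a , l₂ , eq) = x , r , l₁ List.∷ʳ a , l₂ , trans (∷ʳ-step l₁) eq
        at : ∀ {t : Z → Tree} → Bounded {Z} Sz t → (h : Z′ → Z) →
          (∀ z → Sz {λ x → Σ (List (A x)) λ l₁ → Σ (List (A x)) λ l₂ → l₁ ++ l₂ ≡ L x} (h z) ≡ Sz z) →
          Bounded {Z′} Sz (t ∘ h)
        at (p , ≤p) h eq = p , λ z → ≤-trans (≤p (h z)) (≤-reflexive (cong ⟦ p ⟧ (eq z)))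
        a-bounded : Bounded {Z′} Sz (λ (x , r , l₁ , a , _) → encA x a)
        a-bounded = let p , ≤p = list-bounded in p , λ z@(x , r , l₁ , a , l₂ , _) →
          ≤-trans (size-head (encList (encA x) (a ∷ l₂))) (≤p (here z))
        rest-bounded : Bounded {Z′} Sz (λ (x , r , l₁ , a , l₂ , _) → cons (encList (encA x) l₂) (cons (env x) r))
        rest-bounded = cons-bounded
          (let p , ≤p = list-bounded in p , λ z@(x , r , l₁ , a , l₂ , _) →
            ≤-trans (size-tail (encList (encA x) (a ∷ l₂))) (≤p (here z))) (smaller-bounded λ _ → ≤-refl)

      K : X → Tree → ℕ
      K x r = suc (3 * ⟦ sizePoly store-bounded ⟧ (size (cons (env x) r))) + ⟦ timePoly body-timed ⟧ (size (cons (env x) r))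

      loop : Cmd 1
      loop = while hd (hd V) loop body

      test≤ : ∀ ((x , r , l₁ , l₂ , _) : Z) →
        suc (cost (hd (hd V)) (store r l₁ l₂ ∷ [])) ≤ suc (3 * ⟦ sizePoly store-bounded ⟧ (size (cons (env x) r)))
      test≤ z@(_ , r , l₁ , l₂ , _) = s≤s (≤-trans (cost≤ (hd (hd V)) (store r l₁ l₂)) (*-monoʳ-≤ 3 (size≤ store-bounded z)))

      -- One `K` pays for each remaining entry, and one more for the final failing test.
      loop-run : ∀ x r l₁ l₂ → l₁ ++ l₂ ≡ L x →
        Run loop (store r l₁ l₂) (store r (L x) []) (suc (length l₂) * K x r)
      loop-run x r l₁ [] eq rewrite sym (trans (sym (List.++-identityʳ l₁)) eq) =
        _ , while-false refl , ≤-trans (test≤ (x , r , l₁ , [] , eq)) (≤-trans (m≤m+n _ _) (m≤m+n _ 0))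
      loop-run x r l₁ (a ∷ l₂) eq =
        let t , ran , t≤ = run body-timed (x , r , l₁ , a , l₂ , eq)
            t′ , ran′ , t′≤ = loop-run x r (l₁ List.∷ʳ a) l₂ (trans (∷ʳ-step l₁) eq)
        in _ , while-true (λ ()) ran ran′ ,
           ≤-trans (≤-reflexive (sym (+-assoc (suc (cost (hd (hd V)) (store r l₁ (a ∷ l₂) ∷ []))) t t′)))
             (+-mono-≤ (+-mono-≤ (test≤ (x , r , l₁ , a ∷ l₂ , eq)) t≤) t′≤)

      start : X → Tree
      start x = cons (encList (encA x) (L x)) (cons (encS x (s₀ x)) (env x))

      env≤start : ∀ x → size (env x) ≤ size (start x)
      env≤start x = ≤-trans (size-tail (cons (encS x (s₀ x)) (env x))) (size-tail (start x))

      loop-computes : Computes start (λ x → encS x (foldl (f x) (s₀ x) (L x)))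
      loop-computes = record
        { code    = loop ⨾ (zero ≔ cons (hd (tl (hd V))) (tl V))
        ; timed   = loop-timed
                ⨟ assign-timed (weaken store-bounded (λ (x , r) → x , r , L x , [] , List.++-identityʳ (L x)) (λ _ → refl)) (λ _ → refl)
        ; bounded = sizePoly states , λ x → ≤-trans (size≤ states (x , L x , [] , List.++-identityʳ (L x)))
                                           (⟦⟧-mono (sizePoly states) (env≤start x)) }
        where
        S′ : X × Tree → ℕ
        S′ (x , r) = size (cons (start x) r)
        S≤S′ : ∀ x r → size (cons (env x) r) ≤ S′ (x , r)
        S≤S′ x r = s≤s (+-monoˡ-≤ (size r) (env≤start x))
        weaken : ∀ {t : Z → Tree} → Bounded {Z} Sz t → (h : ∀ ((x , r) : X × Tree) → Σ X λ x → Tree × Σ (List (A x)) λ l₁ → Σ (List (A x)) λ l₂ → l₁ ++ l₂ ≡ L x) →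
          (∀ z → Sz {λ x → Σ (List (A x)) λ l₁ → Σ (List (A x)) λ l₂ → l₁ ++ l₂ ≡ L x} (h z) ≡ size (cons (env (proj₁ z)) (proj₂ z))) →
          Bounded {X × Tree} S′ (t ∘ h)
        weaken (p , ≤p) h eq = p , λ z → ≤-trans (≤p (h z))
          (⟦⟧-mono p (≤-trans (≤-reflexive (eq z)) (S≤S′ (proj₁ z) (proj₂ z))))
        kp : Poly
        kp = (con 1 ⊕ con 3 ⊗ sizePoly store-bounded) ⊕ timePoly body-timed
        loop-timed : Timed {X × Tree} S′ loop (λ (x , r) → cons (start x) r) (λ (x , r) → store r (L x) [])
        loop-timed = (con 1 ⊕ arg) ⊗ kp , λ (x , r) →
          let t , ran , t≤ = loop-run x r [] (L x) refl in
          t , ran , ≤-trans t≤ (*-mono-≤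
            (s≤s (≤-trans (length≤size (L x)) (≤-trans (size-head (start x)) (size-head (cons (start x) r)))))
            (⟦⟧-mono kp (S≤S′ x r)))

    -- A polynomial bound on a single step would still allow exponential growth of the state. For
    -- this reason `states` bounds the states after all prefixes of the list, in terms of the
    -- initial environment.
    foldlE : Computes env (λ x → encS x (foldl (f x) (s₀ x) (L x)))
    foldlE = consE list (consE init idE) ⟫ loop-computes

opaque
  unfolding encList

  size-prefix : ∀ {A : Set} {enc : A → Tree} (l₁ : List A) {l₂} → size (encList enc l₁) ≤ size (encList enc (l₁ ++ l₂))
  size-prefix [] {l₂} = 1≤size _
  size-prefix {enc = enc} (a ∷ l₁) = s≤s (+-monoʳ-≤ (size (enc a)) (size-prefix l₁))

  size-++ : ∀ {A : Set} {enc : A → Tree} (l₁ {l₂} : List A) →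
    size (encList enc (l₁ ++ l₂)) ≤ size (encList enc l₁) + size (encList enc l₂)
  size-++ []       = n≤1+n _
  size-++ {enc = enc} (a ∷ l₁) = s≤s (≤-trans (+-monoʳ-≤ (size (enc a)) (size-++ l₁))
    (≤-reflexive (sym (+-assoc (size (enc a)) _ _))))

  size-reverseAcc : ∀ {A : Set} {enc : A → Tree} (l : List A) {acc} →
    size (encList enc (foldl (flip _∷_) acc l)) ≤ size (encList enc acc) + size (encList enc l)
  size-reverseAcc []          = m≤m+n _ _
  size-reverseAcc {enc = enc} (a ∷ l) {acc} = ≤-trans (size-reverseAcc l) (≤-reflexive
    (trans (cong (λ k → suc (k + size (encList enc l))) (+-comm (size (enc a)) (size (encList enc acc))))
    (trans (cong suc (+-assoc (size (encList enc acc)) (size (enc a)) _))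
           (sym (+-suc (size (encList enc acc)) _)))))

  size-reverse : ∀ {A : Set} {enc : A → Tree} (l : List A) → size (encList enc (reverse l)) ≤ suc (size (encList enc l))
  size-reverse l = size-reverseAcc l

  size-[] : ∀ {A : Set} {enc : A → Tree} → size (encList enc []) ≡ 1
  size-[] = refl

  size-∷ : ∀ {A : Set} {enc : A → Tree} a as → size (encList enc (a ∷ as)) ≡ suc (size (enc a) + size (encList enc as))
  size-∷ a as = refl

module _ {X : Set} {env : X → Tree} {A : X → Set} {encA : ∀ x → A x → Tree} where

  opaque
    unfolding encList

    []E : Computes env (λ x → encList (encA x) [])
    []E = constE nil

    ∷E : ∀ {a : ∀ x → A x} {as : ∀ x → List (A x)} → Computes env (λ x → encA x (a x)) → Computes env (λ x → encList (encA x) (as x)) →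
      Computes env (λ x → encList (encA x) (a x ∷ as x))
    ∷E = consE

module _ {X : Set} {env : X → Tree} {A : X → Set} {encA : ∀ x → A x → Tree} {L : ∀ x → List (A x)}
  (list : Computes env (λ x → encList (encA x) (L x))) where

  listPoly : Poly
  listPoly = sizePoly (bounded list)
    where open Bounded

  list≤ : ∀ x → size (encList (encA x) (L x)) ≤ ⟦ listPoly ⟧ (size (env x))
  list≤ = Bounded.size≤ (bounded list)

  suffix≤ : ∀ x l₁ {l₂} → l₁ ++ l₂ ≡ L x → size (encList (encA x) l₂) ≤ ⟦ listPoly ⟧ (size (env x))
  suffix≤ x l₁ eq = ≤-trans (size-suffix l₁)
    (≤-trans (≤-reflexive (cong (size ∘ encList (encA x)) eq)) (list≤ x))

  reverseE : Computes env (λ x → encList (encA x) (reverse (L x)))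
  reverseE = foldlE (λ x → encList (encA x)) (λ _ → []) (λ x → flip _∷_) list []E (∷E v0 (wk v0))
    (con 1 ⊕ listPoly , λ (x , l₁ , l₂ , eq) → ≤-trans (size-reverse l₁) (s≤s
      (≤-trans (size-prefix l₁) (≤-trans (≤-reflexive (cong (size ∘ encList (encA x)) eq)) (list≤ x)))))

module _ {X : Set} {env : X → Tree} {A S : X → Set} {encA : ∀ x → A x → Tree} {L : ∀ x → List (A x)}
  (encS : ∀ x → S x → Tree) (s₀ : ∀ x → S x) (f : ∀ x → A x → S x → S x)
  (list : Computes env (λ x → encList (encA x) (L x)))
  (init : Computes env (λ x → encS x (s₀ x)))
  (step : Computes {Σ X λ x → A x × S x}
            (λ (x , a , s) → cons (encA x a) (cons (encS x s) (env x))) (λ (x , a , s) → encS x (f x a s)))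
  (p : Poly)
  (states : ∀ x l₁ l₂ → l₁ ++ l₂ ≡ L x → size (encS x (foldr (f x) (s₀ x) l₂)) ≤ ⟦ p ⟧ (size (env x)))
  where

  -- The loop takes entries from the front, so the list is reversed beforehand. Prefixes of the
  -- reversed list are suffixes of the original one, which is why `states` speaks of suffixes.
  foldrE : Computes env (λ x → encS x (foldr (f x) (s₀ x) (L x)))
  foldrE = ≗E (λ x → cong (encS x) (List.reverse-foldl (flip (f x)) (s₀ x) (L x)))
    (foldlE encS s₀ (λ x → flip (f x)) (reverseE list) init step
      (p , λ (x , l₁ , l₂ , eq) → subst (λ s → size (encS x s) ≤ ⟦ p ⟧ (size (env x)))
        (List.reverse-foldr (f x) (s₀ x) l₁)
        (states x (reverse l₂) (reverse l₁)
          (trans (sym (List.reverse-++ l₁ l₂)) (trans (cong reverse eq) (List.reverse-involutive (L x)))))))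

module _ {X : Set} {env : X → Tree} {A : X → Set} {encA : ∀ x → A x → Tree} {L : ∀ x → List (A x)} where

  module _ (list : Computes env (λ x → encList (encA x) (L x))) where

    -- The body sees the environment extended by one entry, and an entry is no larger than the whole
    -- list; hence the polynomial of the body is taken at the sum of both sizes.
    elementPoly : {C : Σ X A → Tree} → Computes {Σ X A} (λ (x , a) → cons (encA x a) (env x)) C → Poly
    elementPoly body = Bounded.sizePoly (bounded body) ⊚ (con 1 ⊕ (listPoly list ⊕ arg))

    element≤ : {C : Σ X A → Tree} (body : Computes {Σ X A} (λ (x , a) → cons (encA x a) (env x)) C) →
      ∀ x l₁ {a l₂} → l₁ ++ a ∷ l₂ ≡ L x → size (C (x , a)) ≤ ⟦ elementPoly body ⟧ (size (env x))
    element≤ body x l₁ {a} eq = ≤-trans (Bounded.size≤ (bounded body) (x , a))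
      (⟦⟧-mono (Bounded.sizePoly (bounded body)) (s≤s (+-monoˡ-≤ (size (env x))
        (≤-trans (size-element l₁) (≤-trans (≤-reflexive (cong (size ∘ encList (encA x)) eq)) (list≤ list x))))))

    suffixLength≤ : ∀ x l₁ {l₂} → l₁ ++ l₂ ≡ L x → length l₂ ≤ ⟦ listPoly list ⟧ (size (env x))
    suffixLength≤ x l₁ {l₂} eq = ≤-trans (length≤size l₂) (suffix≤ list x l₁ eq)

module _ {X : Set} {env : X → Tree} {A B : X → Set} {encA : ∀ x → A x → Tree} {encB : ∀ x → B x → Tree}
  {L : ∀ x → List (A x)} where

  private
    skip₂ : {C : Σ X A → Tree} →
      Computes {Σ X A} (λ (x , a) → cons (encA x a) (env x)) C → {S : X → Set} {encS : ∀ x → S x → Tree} →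
      Computes {Σ X λ x → A x × S x} (λ (x , a , s) → cons (encA x a) (cons (encS x s) (env x))) (λ (x , a , s) → C (x , a))
    skip₂ f = consE v0 (wk rest) ⟫ reindex (λ (x , a , s) → x , a) f

  mapE : (f : ∀ x → A x → B x) → Computes env (λ x → encList (encA x) (L x)) →
    Computes {Σ X A} (λ (x , a) → cons (encA x a) (env x)) (λ (x , a) → encB x (f x a)) →
    Computes env (λ x → encList (encB x) (map (f x) (L x)))
  mapE f list body = ≗E (λ x → cong (encList (encB x)) (sym (List.map-is-foldr (L x))))
    (foldrE (λ x → encList (encB x)) (λ _ → []) (λ x a bs → f x a ∷ bs) list []E (∷E (skip₂ body) (wk v0))
      (con 1 ⊕ listPoly list ⊗ (con 1 ⊕ elementPoly list body))
      λ x l₁ l₂ eq → subst (λ bs → size (encList (encB x) bs) ≤ _) (List.map-is-foldr l₂)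
        (≤-trans (mapped≤ x l₂ λ {a} {l₃} eq′ →
                    element≤ list body x (l₁ ++ l₃) (trans (List.++-assoc l₁ l₃ _) (trans (cong (l₁ ++_) eq′) eq)))
          (s≤s (*-monoˡ-≤ _ (suffixLength≤ list x l₁ eq)))))
    where
    mapped≤ : ∀ x l {k} → (∀ {a l₁ l₂} → l₁ ++ a ∷ l₂ ≡ l → size (encB x (f x a)) ≤ k) →
      size (encList (encB x) (map (f x) l)) ≤ 1 + length l * suc k
    mapped≤ x []      ≤k = ≤-reflexive size-[]
    mapped≤ x (a ∷ l) ≤k = ≤-trans (≤-reflexive (size-∷ (f x a) _)) (s≤s (≤-trans
      (+-mono-≤ (≤k {l₁ = []} refl) (mapped≤ x l λ {a′} {l₁} eq → ≤k {l₁ = a ∷ l₁} (cong (a ∷_) eq)))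
      (≤-reflexive (+-suc _ _))))

module _ {X : Set} {env : X → Tree} {A : X → Set} {encA : ∀ x → A x → Tree} where

  appendE : ∀ {l₁ l₂ : ∀ x → List (A x)} → Computes env (λ x → encList (encA x) (l₁ x)) → Computes env (λ x → encList (encA x) (l₂ x)) →
    Computes env (λ x → encList (encA x) (l₁ x ++ l₂ x))
  appendE {l₁} {l₂} f g = ≗E (λ x → cong (encList (encA x)) (sym (List.++-is-foldr (l₁ x) (l₂ x))))
    (foldrE (λ x → encList (encA x)) l₂ (λ x → _∷_) f g (∷E v0 (wk v0)) (listPoly f ⊕ listPoly g)
      λ x l₃ l₄ eq → subst (λ l → size (encList (encA x) l) ≤ _) (List.++-is-foldr l₄ (l₂ x))
        (≤-trans (size-++ l₄) (+-mono-≤ (suffix≤ f x l₃ eq) (list≤ g x))))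

module _ {X : Set} {env : X → Tree} {A B : X → Set} {encA : ∀ x → A x → Tree} {encB : ∀ x → B x → Tree}
  {L : ∀ x → List (A x)} where

  concatMapE : (f : ∀ x → A x → List (B x)) → Computes env (λ x → encList (encA x) (L x)) →
    Computes {Σ X A} (λ (x , a) → cons (encA x a) (env x)) (λ (x , a) → encList (encB x) (f x a)) →
    Computes env (λ x → encList (encB x) (concatMap (f x) (L x)))
  concatMapE f list body = ≗E (λ x → cong (encList (encB x)) (concatMap-foldr (f x) (L x)))
    (foldrE (λ x → encList (encB x)) (λ _ → []) (λ x a bs → f x a ++ bs) list []E
      (appendE (consE v0 (wk rest) ⟫ reindex (λ (x , a , s) → x , a) body) (wk v0))
      (con 1 ⊕ listPoly list ⊗ elementPoly list body)
      λ x l₁ l₂ eq → ≤-trans (concat≤ x l₂ λ {a} {l₃} eq′ →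
                    element≤ list body x (l₁ ++ l₃) (trans (List.++-assoc l₁ l₃ _) (trans (cong (l₁ ++_) eq′) eq)))
          (s≤s (*-monoˡ-≤ _ (suffixLength≤ list x l₁ eq))))
    where
    concatMap-foldr : ∀ {A B : Set} (f : A → List B) l → foldr (λ a bs → f a ++ bs) [] l ≡ concatMap f l
    concatMap-foldr f []      = refl
    concatMap-foldr f (a ∷ l) = cong (f a ++_) (concatMap-foldr f l)
    concat≤ : ∀ x l {k} → (∀ {a l₁ l₂} → l₁ ++ a ∷ l₂ ≡ l → size (encList (encB x) (f x a)) ≤ k) →
      size (encList (encB x) (foldr (λ a bs → f x a ++ bs) [] l)) ≤ 1 + length l * k
    concat≤ x []      ≤k = ≤-reflexive size-[]
    concat≤ x (a ∷ l) {k} ≤k = ≤-trans (size-++ (f x a)) (≤-trans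
      (+-mono-≤ (≤k {l₁ = []} refl) (concat≤ x l λ {a′} {l₁} eq → ≤k {l₁ = a ∷ l₁} (cong (a ∷_) eq)))
      (≤-reflexive (+-suc k _)))

-- Booleans

opaque

  encBool : Bool → Tree
  encBool = encodeBool

opaque
  unfolding encBool

  isCons-encBool : ∀ b → isCons (encBool b) ≡ b
  isCons-encBool false = refl
  isCons-encBool true  = refl

  size-encBool : ∀ b → size (encBool b) ≤ 3
  size-encBool false = s≤s z≤n
  size-encBool true  = ≤-refl

module _ {X : Set} {env : X → Tree} where

  opaque
    unfolding encBool

    boolE : ∀ b → Computes env (λ _ → encBool b)
    boolE b = constE (encodeBool b)

  ifBoolE : ∀ {b : X → Bool} {S : X → Set} {enc : ∀ x → S x → Tree} {s t : ∀ x → S x} →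
    Computes env (encBool ∘ b) → Computes env (λ x → enc x (s x)) → Computes env (λ x → enc x (t x)) →
    Computes env (λ x → enc x (if b x yes s x no t x))
  ifBoolE {b} {S} {enc} {s} {t} c f g = ≗E eq (ifE c f g)
    where
    eq : ∀ x → (if isCons (encBool (b x)) yes enc x (s x) no enc x (t x)) ≡ enc x (if b x yes s x no t x)
    eq x rewrite isCons-encBool (b x) with b x
    ... | false = refl
    ... | true  = refl

  nonNilE : ∀ {t : X → Tree} → Computes env t → Computes env (λ x → encBool (isCons (t x)))
  nonNilE {t} f = ≗E eq (ifE f (boolE true) (boolE false))
    where
    eq : ∀ x → (if isCons (t x) yes encBool true no encBool false) ≡ encBool (isCons (t x))
    eq x with isCons (t x)
    ... | false = refl
    ... | true  = refl

  module _ {b : X → Bool} (f : Computes env (encBool ∘ b)) where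

    notE : Computes env (λ x → encBool (not (b x)))
    notE = ≗E (λ x → cong encBool (eq (b x))) (ifBoolE {enc = λ _ → encBool} f (boolE false) (boolE true))
      where
      eq : ∀ b → (if b yes false no true) ≡ not b
      eq false = refl
      eq true  = refl

    andE : ∀ {c : X → Bool} → Computes env (encBool ∘ c) → Computes env (λ x → encBool (b x ∧ c x))
    andE g = ≗E (λ x → cong encBool (eq (b x))) (ifBoolE {enc = λ _ → encBool} f g (boolE false))
      where
      eq : ∀ b {c} → (if b yes c no false) ≡ b ∧ c
      eq false = refl
      eq true  = refl

    orE : ∀ {c : X → Bool} → Computes env (encBool ∘ c) → Computes env (λ x → encBool (b x ∨ c x))
    orE g = ≗E (λ x → cong encBool (eq (b x))) (ifBoolE {enc = λ _ → encBool} f (boolE true) g)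
      where
      eq : ∀ b {c} → (if b yes true no c) ≡ b ∨ c
      eq false = refl
      eq true  = refl

-- Unary numbers

opaque

  encUnary : ℕ → Tree
  encUnary zero    = nil
  encUnary (suc k) = cons nil (encUnary k)

iterate : ∀ {A : Set} → (A → A) → ℕ → A → A
iterate f zero    a = a
iterate f (suc k) a = iterate f k (f a)

opaque
  unfolding encUnary encList

  -- This makes a unary number a list that a loop can run along, that is, a loop counter.
  encUnary-list : ∀ k → encList (λ _ → nil) (List.replicate k tt) ≡ encUnary k
  encUnary-list zero    = refl
  encUnary-list (suc k) = cong (cons nil) (encUnary-list k)

  size-encUnary : ∀ k → size (encUnary k) ≤ 1 + k * 2
  size-encUnary zero    = ≤-refl
  size-encUnary (suc k) = s≤s (s≤s (size-encUnary k))

  -- Removing `i` constructors from the numeral of `j` leaves something over precisely when `i` is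
  -- smaller, so comparison reduces to dropping and a test for `nil`.
  isCons-drop : ∀ i j → isCons (iterate tail i (encUnary j)) ≡ (i <ᵇ j)
  isCons-drop zero    zero    = refl
  isCons-drop zero    (suc j) = refl
  isCons-drop (suc i) zero    = trans (cong isCons (iterate-nil i)) refl
    where
    iterate-nil : ∀ i → iterate tail i nil ≡ nil
    iterate-nil zero    = refl
    iterate-nil (suc i) = iterate-nil i
  isCons-drop (suc i) (suc j) = isCons-drop i j

module _ {X : Set} {env : X → Tree} where

  opaque
    unfolding encUnary

    zeroE : Computes env (λ _ → encUnary 0)
    zeroE = constE nil

    sucE : ∀ {k : X → ℕ} → Computes env (encUnary ∘ k) → Computes env (λ x → encUnary (suc (k x)))
    sucE = consE (constE nil)

  dropE : ∀ {k : X → ℕ} {t : X → Tree} → Computes env (encUnary ∘ k) → Computes env t →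
    Computes env (λ x → iterate tail (k x) (t x))
  dropE {k} {t} f g = ≗E (λ x → iterated (k x))
    (foldlE {encA = λ _ _ → nil} {L = λ x → List.replicate (k x) tt} (λ _ t → t) t (λ x t _ → tail t)
      (≗E (λ x → sym (encUnary-list (k x))) f) g (tailE (wk v0))
      (Bounded.sizePoly (bounded g) , λ (x , l₁ , _) → ≤-trans (dropped≤ l₁) (Bounded.size≤ (bounded g) x)))
    where
    iterated : ∀ k {t} → foldl (λ t _ → tail t) t (List.replicate k tt) ≡ iterate tail k t
    iterated zero    = refl
    iterated (suc k) = iterated k
    dropped≤ : ∀ {t} (l : List Unit) → size (foldl (λ t _ → tail t) t l) ≤ size t
    dropped≤ []          = ≤-refl
    dropped≤ {t} (_ ∷ l) = ≤-trans (dropped≤ l) (size-tail t)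

  <E : ∀ {i j : X → ℕ} → Computes env (encUnary ∘ i) → Computes env (encUnary ∘ j) →
    Computes env (λ x → encBool (i x <ᵇ j x))
  <E {i} {j} f g = ≗E (λ x → cong encBool (isCons-drop (i x) (j x))) (nonNilE (dropE f g))

-- Vertices and functions on them

encFin : ∀ {n} → Fin n → Tree
encFin v = encUnary (toℕ v)

vertices : ℕ → Tree
vertices n = encList encFin (allFin n)

encTable : ∀ {n} {B : Set} → (B → Tree) → (Fin n → B) → Tree
encTable enc p = encList enc (List.tabulate p)

encSet : ∀ {n} → (Fin n → Bool) → Tree
encSet = encTable encBool

encMatrix : ∀ {n} → (Fin n → Fin n → Bool) → Tree
encMatrix = encTable encSet

size-encTable : ∀ {n} {B : Set} {enc : B → Tree} {p : Fin n → B} {k} → (∀ v → size (enc (p v)) ≤ k) →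
  size (encTable enc p) ≤ 1 + n * suc k
size-encTable {zero}      ≤k = ≤-reflexive size-[]
size-encTable {suc n} {p = p} {k} ≤k = ≤-trans (≤-reflexive (size-∷ (p zero) _)) (s≤s (≤-trans (+-mono-≤ (≤k zero) (size-encTable (≤k ∘ suc))) (≤-reflexive (+-suc k _))))

size-encSet : ∀ {n} (p : Fin n → Bool) → size (encSet p) ≤ 1 + n * 4
size-encSet p = size-encTable (λ v → size-encBool (p v))

size-encMatrix : ∀ {n} (T : Fin n → Fin n → Bool) → size (encMatrix T) ≤ 1 + n * (2 + n * 4)
size-encMatrix T = size-encTable (λ v → size-encSet (T v))

foldFin : ∀ {n} {S : Set} → (Fin n → S → S) → S → S
foldFin {zero}  f s = s
foldFin {suc n} f s = f zero (foldFin (f ∘ suc) s)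

foldr-allFin : ∀ {n} {S : Set} (f : Fin n → S → S) s → foldr f s (allFin n) ≡ foldFin f s
foldr-allFin {zero}  f s = refl
foldr-allFin {suc n} f s = cong (f zero) (begin
  foldr f s (List.tabulate suc)          ≡⟨ cong (foldr f s) (List.map-tabulate id suc) ⟨
  foldr f s (map suc (allFin n))    ≡⟨ List.foldr-map f suc s (allFin n) ⟩
  foldr (f ∘ suc) s (allFin n)      ≡⟨ foldr-allFin (f ∘ suc) s ⟩
  foldFin (f ∘ suc) s               ∎)
  where open ≡-Reasoning

opaque
  unfolding encList

  head-drop : ∀ {n} {B : Set} (enc : B → Tree) (p : Fin n → B) v → head (iterate tail (toℕ v) (encTable enc p)) ≡ enc (p v)
  head-drop enc p zero    = refl
  head-drop enc p (suc v) = head-drop enc (p ∘ suc) v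

any all : ∀ {n} → (Fin n → Bool) → Bool
any p = foldFin (λ v b → p v ∨ b) false
all p = foldFin (λ v b → p v ∧ b) true

count : ∀ {n} → (Fin n → Bool) → ℕ
count p = foldFin (λ v k → if p v yes suc k no k) 0

infix 7 _<F_ _≡F_
-- Equality is derived from comparison, since that is the test on unary numbers for which there is a
-- program.
_<F_ _≡F_ : ∀ {n} → Fin n → Fin n → Bool
v <F w = toℕ v <ᵇ toℕ w
v ≡F w = not (v <F w) ∧ not (w <F v)

module _ {X : Set} {env : X → Tree} {n : X → ℕ} where

  <FE : ∀ {v w : ∀ x → Fin (n x)} → Computes env (λ x → encFin (v x)) → Computes env (λ x → encFin (w x)) →
    Computes env (λ x → encBool (v x <F w x))
  <FE = <E

  ≡FE : ∀ {v w : ∀ x → Fin (n x)} → Computes env (λ x → encFin (v x)) → Computes env (λ x → encFin (w x)) →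
    Computes env (λ x → encBool (v x ≡F w x))
  ≡FE {v} {w} f g = andE (notE (<FE {v} {w} f g)) (notE (<FE {w} {v} g f))

  lookupE : ∀ {B : X → Set} {enc : ∀ x → B x → Tree} {p : ∀ x → Fin (n x) → B x} {v : ∀ x → Fin (n x)} →
    Computes env (λ x → encTable (enc x) (p x)) → Computes env (λ x → encFin (v x)) → Computes env (λ x → enc x (p x (v x)))
  lookupE {enc = enc} {p} {v} f g = ≗E (λ x → head-drop (enc x) (p x) (v x)) (headE (dropE g f))

  module _ (vs : Computes env (λ x → vertices (n x))) where

    verticesPoly : Poly
    verticesPoly = listPoly {encA = λ _ → encFin} vs

    n≤ : ∀ x → n x ≤ ⟦ verticesPoly ⟧ (size (env x))
    n≤ x = ≤-trans (≤-reflexive (sym (List.length-tabulate {n = n x} id)))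
      (≤-trans (length≤size (allFin (n x))) (list≤ {encA = λ _ → encFin} vs x))

    tableE : ∀ {B : X → Set} {enc : ∀ x → B x → Tree} {p : ∀ x → Fin (n x) → B x} →
      Computes {Σ X (Fin ∘ n)} (λ (x , v) → cons (encFin v) (env x)) (λ (x , v) → enc x (p x v)) →
      Computes env (λ x → encTable (enc x) (p x))
    tableE {enc = enc} {p} body = ≗E (λ x → cong (encList (enc x)) (List.map-tabulate id (p x)))
      (mapE {encA = λ _ → encFin} p vs body)

    foldFinE : ∀ {S : X → Set} (encS : ∀ x → S x → Tree) (s₀ : ∀ x → S x) (f : ∀ x → Fin (n x) → S x → S x) →
      Computes env (λ x → encS x (s₀ x)) →
      Computes {Σ X λ x → Fin (n x) × S x}
        (λ (x , v , s) → cons (encFin v) (cons (encS x s) (env x))) (λ (x , v , s) → encS x (f x v s)) →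
      (p : Poly) →
      (∀ x l₁ l₂ → l₁ ++ l₂ ≡ allFin (n x) → size (encS x (foldr (f x) (s₀ x) l₂)) ≤ ⟦ p ⟧ (size (env x))) →
      Computes env (λ x → encS x (foldFin (f x) (s₀ x)))
    foldFinE encS s₀ f init step p states = ≗E (λ x → cong (encS x) (foldr-allFin (f x) (s₀ x)))
      (foldrE {encA = λ _ → encFin} encS s₀ f vs init step p states)

    module _ {p : ∀ x → Fin (n x) → Bool}
      (body : Computes {Σ X (Fin ∘ n)} (λ (x , v) → cons (encFin v) (env x)) (λ (x , v) → encBool (p x v))) where

      private
        body′ : ∀ {S : X → Set} {encS : ∀ x → S x → Tree} → Computes {Σ X λ x → Fin (n x) × S x}
          (λ (x , v , s) → cons (encFin v) (cons (encS x s) (env x))) (λ (x , v , s) → encBool (p x v))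
        body′ = consE v0 (wk rest) ⟫ reindex (λ (x , v , s) → x , v) body

      anyE : Computes env (λ x → encBool (any (p x)))
      anyE = foldFinE (λ _ → encBool) (λ _ → false) (λ x v b → p x v ∨ b) (boolE false) (orE body′ (wk v0)) (con 3) λ _ _ _ _ → size-encBool _

      allE : Computes env (λ x → encBool (all (p x)))
      allE = foldFinE (λ _ → encBool) (λ _ → true) (λ x v b → p x v ∧ b) (boolE true) (andE body′ (wk v0)) (con 3) λ _ _ _ _ → size-encBool _

      countE : Computes env (λ x → encUnary (count (p x)))
      countE = foldFinE (λ _ → encUnary) (λ _ → 0) (λ x v k → if p x v yes suc k no k) zeroE
        (ifBoolE {enc = λ _ → encUnary} body′ (sucE (wk v0)) (wk v0))
        (con 1 ⊕ verticesPoly ⊗ con 2)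
        λ x l₁ l₂ eq → ≤-trans (size-encUnary _) (s≤s (*-monoˡ-≤ 2
          (≤-trans (counted≤ l₂) (suffixLength≤ {encA = λ _ → encFin} {L = λ x → allFin (n x)} vs x l₁ eq))))
        where
        counted≤ : ∀ {x} l → foldr (λ v k → if p x v yes suc k no k) 0 l ≤ length l
        counted≤ [] = z≤n
        counted≤ {x} (v ∷ l) with p x v
        ... | false = ≤-trans (counted≤ l) (n≤1+n _)
        ... | true  = s≤s (counted≤ l)

-- Bijective binary numbers

digit : Bool → ℕ
digit false = 1
digit true  = 2

val : List Bool → ℕ
val []      = 0
val (d ∷ l) = digit d + 2 * val l

digits : ℕᵇ → List Bool
digits zero     = []
digits 1+[2 x ] = false ∷ digits x
digits 2[1+ x ] = true ∷ digits x

undigits : List Bool → ℕᵇ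
undigits []          = zero
undigits (false ∷ l) = 1+[2 undigits l ]
undigits (true ∷ l)  = 2[1+ undigits l ]

toℕ-undigits : ∀ l → toℕᵇ (undigits l) ≡ val l
toℕ-undigits []          = refl
toℕ-undigits (false ∷ l) = cong (λ k → suc (2 * k)) (toℕ-undigits l)
toℕ-undigits (true ∷ l)  = trans (cong (λ k → 2 * suc k) (toℕ-undigits l)) (*-suc 2 (val l))

undigits-digits : ∀ b → undigits (digits b) ≡ b
undigits-digits zero     = refl
undigits-digits 1+[2 x ] = cong 1+[2_] (undigits-digits x)
undigits-digits 2[1+ x ] = cong 2[1+_] (undigits-digits x)

val-digits : ∀ m → val (digits (fromℕ m)) ≡ m
val-digits m = trans (sym (toℕ-undigits (digits (fromℕ m))))
  (trans (cong toℕᵇ (undigits-digits (fromℕ m))) (toℕ-fromℕ m))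

encDigits : List Bool → Tree
encDigits = encList encBool

opaque
  unfolding encList encBool

  encDigits-undigits : ∀ l → encDigits l ≡ encodeℕᵇ (undigits l)
  encDigits-undigits []          = refl
  encDigits-undigits (false ∷ l) = cong (cons nil) (encDigits-undigits l)
  encDigits-undigits (true ∷ l)  = cong (cons (cons nil nil)) (encDigits-undigits l)

opaque

  encNat : ℕ → Tree
  encNat = encodeℕ

opaque
  unfolding encNat

  encNat-encodeℕ : ∀ m → encNat m ≡ encodeℕ m
  encNat-encodeℕ m = refl

  -- In bijective base two every number has just one numeral, so any list of digits with the right
  -- value is already its encoding and results of additions need no normalisation.
  encDigits-encNat : ∀ l → encDigits l ≡ encNat (val l)
  encDigits-encNat l = trans (encDigits-undigits l)
    (cong encodeℕᵇ (trans (sym (fromℕ-toℕ (undigits l))) (cong fromℕ (toℕ-undigits l))))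

encNat-digits : ∀ m → encNat m ≡ encDigits (digits (fromℕ m))
encNat-digits m = trans (cong encNat (sym (val-digits m))) (sym (encDigits-encNat (digits (fromℕ m))))

2^length≤ : ∀ l → 2 ^ length l ≤ suc (val l)
2^length≤ []      = ≤-refl
2^length≤ (d ∷ l) = ≤-trans (*-monoʳ-≤ 2 (2^length≤ l))
  (≤-trans (≤-reflexive (*-suc 2 (val l))) (s≤s (+-monoˡ-≤ (2 * val l) (1≤digit d))))
  where
  1≤digit : ∀ d → 1 ≤ digit d
  1≤digit false = ≤-refl
  1≤digit true  = s≤s z≤n

val<2^ : ∀ l → 2 + val l ≤ 2 ^ suc (length l)
val<2^ []      = ≤-refl
val<2^ (d ∷ l) = ≤-trans (+-monoʳ-≤ 2 (+-monoˡ-≤ (2 * val l) (digit≤2 d)))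
  (≤-trans (≤-reflexive (solve 1 (λ v → con 2 :+ (con 2 :+ con 2 :* v) := con 2 :* (con 2 :+ v)) refl (val l)))
    (*-monoʳ-≤ 2 (val<2^ l)))
  where
  open +-*-Solver using (solve; _:*_; _:=_; con; _:+_)
  digit≤2 : ∀ d → digit d ≤ 2
  digit≤2 false = s≤s z≤n
  digit≤2 true  = ≤-refl

size-digits : ∀ l → size (encDigits l) ≤ 1 + length l * 4
size-digits l = size-encList l λ _ → size-encBool _

-- Together with `encNat-size` this translates between sizes of numerals and exponents of two, so
-- that growth under sums and doublings can be followed on exponents alone.
size-encNat : ∀ {m} k → m ≤ 2 ^ k → size (encNat m) ≤ 1 + suc k * 4
size-encNat {m} k m≤ = subst (λ t → size t ≤ 1 + suc k * 4) (sym (encNat-digits m))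
  (≤-trans (size-digits l) (s≤s (*-monoˡ-≤ 4 length≤)))
  where
  l = digits (fromℕ m)
  length≤ : length l ≤ suc k
  length≤ = ≮⇒≥ λ k< → <⇒≱ (^-monoʳ-< 2 (s≤s (s≤s z≤n)) k<) (begin
    2 ^ length l     ≤⟨ 2^length≤ l ⟩
    suc (val l)      ≡⟨ cong suc (val-digits m) ⟩
    suc m            ≤⟨ +-mono-≤ (m^n>0 2 k) m≤ ⟩
    2 ^ k + 2 ^ k    ≡⟨ cong (2 ^ k +_) (+-identityʳ _) ⟨
    2 ^ suc k        ∎)
    where open ≤-Reasoning

encNat-size : ∀ m → m ≤ 2 ^ size (encNat m)
encNat-size m = begin
  m                     ≡⟨ val-digits m ⟨
  val l                 ≤⟨ m≤n+m (val l) 2 ⟩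
  2 + val l             ≤⟨ val<2^ l ⟩
  2 ^ suc (length l)    ≤⟨ ^-monoʳ-≤ 2 (length<size l) ⟩
  2 ^ size (encDigits l) ≡⟨ cong (λ t → 2 ^ size t) (encNat-digits m) ⟨
  2 ^ size (encNat m)   ∎
  where
  open ≤-Reasoning
  l = digits (fromℕ m)
  length<size : ∀ l → suc (length l) ≤ size (encDigits l)
  length<size []      = ≤-reflexive (sym size-[])
  length<size (d ∷ l) = ≤-trans (s≤s (≤-trans (length<size l) (m≤n+m _ (size (encBool d))))) (≤-reflexive (sym (size-∷ d l)))

-- Addition: the state holds the remaining digits of both summands, the carry, and the digits of the
-- sum found so far, the most significant one first.

State : Set
State = List Bool × List Bool × ℕ × List Bool

tl′ : List Bool → List Bool
tl′ []      = []
tl′ (_ ∷ l) = l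

addDigit : List Bool → ℕ → ℕ
addDigit []          k = k
addDigit (false ∷ _) k = suc k
addDigit (true ∷ _)  k = suc (suc k)

-- A column sum between 1 and 6 is a digit 1 or 2 plus twice the carry, so the carry can be as large
-- as 2, and two digits with such a carry make at most 6 again. A column sum of 0 emits no digit.
carry : ℕ → ℕ
carry t = if t <ᵇ 3 yes 0 no if t <ᵇ 5 yes 1 no 2

is2∨4∨6 : ℕ → Bool
is2∨4∨6 t = (not (t <ᵇ 2) ∧ (t <ᵇ 3)) ∨ ((not (t <ᵇ 4) ∧ (t <ᵇ 5)) ∨ not (t <ᵇ 6))

emit : ℕ → List Bool → List Bool
emit t o = if t <ᵇ 1 yes o no (is2∨4∨6 t ∷ o)

addStep : State → State
addStep (xs , ys , c , o) = let t = addDigit xs (addDigit ys c) in tl′ xs , tl′ ys , carry t , emit t o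

-- The value of a number with higher part `r` whose remaining digits are those of `o`, most
-- significant first.
unreverse : List Bool → ℕ → ℕ
unreverse []      r = r
unreverse (d ∷ o) r = unreverse o (digit d + 2 * r)

value : State → ℕ
value (xs , ys , c , o) = unreverse o (val xs + val ys + c)

carry≤2 : ∀ t → carry t ≤ 2
carry≤2 t with t <ᵇ 3 | t <ᵇ 5
... | true  | _     = z≤n
... | false | true  = s≤s z≤n
... | false | false = ≤-refl

-- There is no digit 0: a column sum of 0 writes nothing and loses its position. This is harmless
-- only if nothing is left above it, whence the condition on `r`.
emit-value : ∀ t o r → t ≤ 6 → (t ≡ 0 → r ≡ 0) → unreverse (emit t o) (r + carry t) ≡ unreverse o (t + 2 * r)
emit-value 0 o r _ r≡0 rewrite r≡0 refl = refl
emit-value 1 o r _ _ = cong (λ k → unreverse o (1 + 2 * k)) (+-identityʳ r)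
emit-value 2 o r _ _ = cong (λ k → unreverse o (2 + 2 * k)) (+-identityʳ r)
emit-value 3 o r _ _ = cong (λ k → unreverse o (1 + k)) (trans (cong (2 *_) (+-comm r 1)) (*-distribˡ-+ 2 1 r))
emit-value 4 o r _ _ = cong (λ k → unreverse o (2 + k)) (trans (cong (2 *_) (+-comm r 1)) (*-distribˡ-+ 2 1 r))
emit-value 5 o r _ _ = cong (λ k → unreverse o (1 + k)) (trans (cong (2 *_) (+-comm r 2)) (*-distribˡ-+ 2 2 r))
emit-value 6 o r _ _ = cong (λ k → unreverse o (2 + k)) (trans (cong (2 *_) (+-comm r 2)) (*-distribˡ-+ 2 2 r))
emit-value (suc (suc (suc (suc (suc (suc (suc _))))))) o r (s≤s (s≤s (s≤s (s≤s (s≤s (s≤s ())))))) _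

addDigit-val : ∀ xs k → val xs + k ≡ addDigit xs k + 2 * val (tl′ xs)
addDigit-val []           k = sym (+-identityʳ k)
addDigit-val (false ∷ xs) k = cong suc (+-comm (2 * val xs) k)
addDigit-val (true ∷ xs)  k = cong (2 +_) (+-comm (2 * val xs) k)

addDigit≤ : ∀ xs k → addDigit xs k ≤ 2 + k
addDigit≤ []          k = m≤n+m k 2
addDigit≤ (false ∷ _) k = n≤1+n _
addDigit≤ (true ∷ _)  k = ≤-refl

addDigit≡0 : ∀ xs k → addDigit xs k ≡ 0 → k ≡ 0 × val (tl′ xs) ≡ 0
addDigit≡0 [] k eq = eq , refl
addDigit≡0 (false ∷ _) k ()
addDigit≡0 (true ∷ _)  k ()

addStep-value : ∀ xs ys c o → c ≤ 2 → value (addStep (xs , ys , c , o)) ≡ value (xs , ys , c , o)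
addStep-value xs ys c o c≤2 = trans
  (emit-value t o (val (tl′ xs) + val (tl′ ys)) (≤-trans (addDigit≤ xs _) (+-monoʳ-≤ 2 (≤-trans (addDigit≤ ys c) (+-monoʳ-≤ 2 c≤2))))
    -- Digits are nonzero, so a column sum of 0 means that both summands are exhausted.
    (λ t≡0 → let t′≡0 , x≡0 = addDigit≡0 xs _ t≡0 ; _ , y≡0 = addDigit≡0 ys c t′≡0 in cong₂ _+_ x≡0 y≡0))
  (cong (unreverse o) (sym total))
  where
  open ≡-Reasoning
  open +-*-Solver using (solve; _:*_; _:=_; con; _:+_)
  t = addDigit xs (addDigit ys c)
  total : val xs + val ys + c ≡ t + 2 * (val (tl′ xs) + val (tl′ ys))
  total = begin
    val xs + val ys + c                                     ≡⟨ +-assoc (val xs) (val ys) c ⟩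
    val xs + (val ys + c)                                   ≡⟨ cong (val xs +_) (addDigit-val ys c) ⟩
    val xs + (addDigit ys c + 2 * val (tl′ ys))             ≡⟨ +-assoc (val xs) _ _ ⟨
    val xs + addDigit ys c + 2 * val (tl′ ys)               ≡⟨ cong (_+ 2 * val (tl′ ys)) (addDigit-val xs _) ⟩
    t + 2 * val (tl′ xs) + 2 * val (tl′ ys)                 ≡⟨ solve 3 (λ t x y → t :+ con 2 :* x :+ con 2 :* y := t :+ con 2 :* (x :+ y)) refl t (val (tl′ xs)) (val (tl′ ys)) ⟩
    t + 2 * (val (tl′ xs) + val (tl′ ys))                   ∎

runAdd : {A : Set} → State → List A → State
runAdd = foldl (λ s _ → addStep s)

sumDigits : State → List Bool
sumDigits (_ , _ , _ , o) = reverse o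

val-reverseAcc : ∀ o acc → val (foldl (flip _∷_) acc o) ≡ unreverse o (val acc)
val-reverseAcc []      acc = refl
val-reverseAcc (d ∷ o) acc = val-reverseAcc o (d ∷ acc)

length-tl′ : ∀ {k} l → length l ≤ suc k → length (tl′ l) ≤ k
length-tl′ []      _       = z≤n
length-tl′ (_ ∷ l) (s≤s p) = p

-- The clock is strictly longer than both summands because one surplus step has to write the last
-- carry; being at most 2, this carry is a single digit or nothing and leaves no further carry.
runAdd-val : ∀ {A : Set} (clock : List A) xs ys c o → c ≤ 2 → length xs < length clock → length ys < length clock →
  val (sumDigits (runAdd (xs , ys , c , o) clock)) ≡ value (xs , ys , c , o)
runAdd-val (_ ∷ []) [] [] c o c≤2 _ _ = trans (val-reverseAcc (emit c o) []) (last c c≤2)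
  where
  last : ∀ c → c ≤ 2 → unreverse (emit c o) 0 ≡ unreverse o c
  last 0 _ = refl
  last 1 _ = refl
  last 2 _ = refl
  last (suc (suc (suc _))) (s≤s (s≤s ()))
runAdd-val (_ ∷ []) (_ ∷ _) ys c o _ (s≤s ()) _
runAdd-val (_ ∷ []) [] (_ ∷ _) c o _ _ (s≤s ())
runAdd-val (_ ∷ clock@(_ ∷ _)) xs ys c o c≤2 (s≤s x<) (s≤s y<) = trans
  (runAdd-val clock (tl′ xs) (tl′ ys) _ _ (carry≤2 (addDigit xs (addDigit ys c))) (s≤s (length-tl′ xs x<)) (s≤s (length-tl′ ys y<)))
  (addStep-value xs ys c o c≤2)

encState : State → Tree
encState (xs , ys , c , o) = cons (encDigits xs) (cons (encDigits ys) (cons (encUnary c) (encDigits o)))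

statePoly : ℕ → ℕ → ℕ → ℕ
statePoly a b l = suc ((1 + a * 4) + suc ((1 + b * 4) + suc (5 + (1 + l * 4))))

size-runAdd : ∀ {A : Set} (l : List A) xs ys c o → c ≤ 2 →
  size (encState (runAdd (xs , ys , c , o) l)) ≤ statePoly (length xs) (length ys) (length l + length o)
size-runAdd [] xs ys c o c≤2 = s≤s (+-mono-≤ (size-digits xs) (s≤s (+-mono-≤ (size-digits ys)
  (s≤s (+-mono-≤ (≤-trans (size-encUnary c) (s≤s (*-monoˡ-≤ 2 c≤2))) (size-digits o))))))
size-runAdd (_ ∷ l) xs ys c o c≤2 = ≤-trans
  (size-runAdd l (tl′ xs) (tl′ ys) _ _ (carry≤2 (addDigit xs (addDigit ys c))))
  (s≤s (+-mono-≤ (s≤s (*-monoˡ-≤ 4 (tl≤ xs))) (s≤s (+-mono-≤ (s≤s (*-monoˡ-≤ 4 (tl≤ ys))) (s≤s (+-monoʳ-≤ 5 (s≤s (*-monoˡ-≤ 4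
    (≤-trans (+-monoʳ-≤ (length l) (emit≤ (addDigit xs (addDigit ys c)))) (≤-reflexive (+-suc (length l) (length o))))))))))))
  where
  tl≤ : ∀ l → length (tl′ l) ≤ length l
  tl≤ []      = z≤n
  tl≤ (_ ∷ l) = n≤1+n _
  emit≤ : ∀ t → length (emit t o) ≤ suc (length o)
  emit≤ t with t <ᵇ 1
  ... | true  = n≤1+n _
  ... | false = ≤-refl

module _ {X : Set} {env : X → Tree} where

  opaque
    unfolding encList encBool encUnary

    tl′E : ∀ {l : X → List Bool} → Computes env (encDigits ∘ l) → Computes env (λ x → encDigits (tl′ (l x)))
    tl′E {l} f = ≗E (λ x → eq (l x)) (tailE f)
      where
      eq : ∀ l → tail (encDigits l) ≡ encDigits (tl′ l)
      eq []      = refl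
      eq (_ ∷ _) = refl

    addDigitE : ∀ {l : X → List Bool} {k : X → ℕ} → Computes env (encDigits ∘ l) → Computes env (encUnary ∘ k) →
      Computes env (λ x → encUnary (addDigit (l x) (k x)))
    addDigitE {l} {k} f g = ≗E (λ x → eq (l x))
      (ifE f (ifE (headE f) (consE (constE nil) (consE (constE nil) g)) (consE (constE nil) g)) g)
      where
      eq : ∀ {k} l → (if isCons (encDigits l) yes (if isCons (head (encDigits l)) yes cons nil (cons nil (encUnary k)) no cons nil (encUnary k)) no encUnary k)
        ≡ encUnary (addDigit l k)
      eq []          = refl
      eq (false ∷ _) = refl
      eq (true ∷ _)  = refl

    unaryE : ∀ k → Computes env (λ _ → encUnary k)
    unaryE k = constE (encUnary k)

  module _ {t : X → ℕ} (f : Computes env (encUnary ∘ t)) where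

    carryE : Computes env (λ x → encUnary (carry (t x)))
    carryE = ifBoolE {enc = λ _ → encUnary} (<E f (unaryE 3)) (unaryE 0)
      (ifBoolE {enc = λ _ → encUnary} (<E f (unaryE 5)) (unaryE 1) (unaryE 2))

    emitE : ∀ {o : X → List Bool} → Computes env (encDigits ∘ o) → Computes env (λ x → encDigits (emit (t x) (o x)))
    emitE g = ifBoolE {enc = λ _ → encDigits} (<E f (unaryE 1)) g
      (∷E {encA = λ _ → encBool} (orE (andE (notE (<E f (unaryE 2))) (<E f (unaryE 3)))
        (orE (andE (notE (<E f (unaryE 4))) (<E f (unaryE 5))) (notE (<E f (unaryE 6))))) g)

  addStepE : ∀ {s : X → State} → Computes env (encState ∘ s) → Computes env (λ x → encState (addStep (s x)))
  addStepE {s} f = consE (tl′E xs) (consE (tl′E ys) (consE (carryE total) (emitE total (tailE (tailE (tailE f))))))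
    where
    xs = headE f
    ys = headE (tailE f)
    total = addDigitE xs (addDigitE ys (headE (tailE (tailE f))))

module _ {X : Set} {env : X → Tree} where

  addE : ∀ {f g : X → ℕ} → Computes env (encNat ∘ f) → Computes env (encNat ∘ g) → Computes env (λ x → encNat (f x + g x))
  addE {f} {g} F G = ≗E (λ x → trans (encDigits-encNat (result x)) (cong encNat (result-val x)))
    (reverseE {encA = λ _ → encBool} (tailE (tailE (tailE
      (foldlE (λ _ → encState) (λ x → xs x , ys x , 0 , []) (λ _ s _ → addStep s)
        (appendE {encA = λ _ → encBool} xsE (∷E {encA = λ _ → encBool} (boolE true) ysE))
        (consE xsE (consE ysE (consE zeroE []E)))
        (addStepE (wk v0))
        (p , λ (x , l₁ , l₂ , eq) → ≤-trans (size-runAdd l₁ (xs x) (ys x) 0 [] z≤n)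
          (s≤s (+-mono-≤ (s≤s (*-monoˡ-≤ 4 (xs≤ x))) (s≤s (+-mono-≤ (s≤s (*-monoˡ-≤ 4 (ys≤ x))) (s≤s (+-monoʳ-≤ 5 (s≤s
            (*-monoˡ-≤ 4 (≤-trans (≤-reflexive (+-identityʳ (length l₁))) (clock≤ x l₁ l₂ eq))))))))))))))))
    where
    xs ys : X → List Bool
    xs x = digits (fromℕ (f x))
    ys x = digits (fromℕ (g x))
    xsE : Computes env (encDigits ∘ xs)
    xsE = ≗E (λ x → encNat-digits (f x)) F
    ysE : Computes env (encDigits ∘ ys)
    ysE = ≗E (λ x → encNat-digits (g x)) G
    -- Only its length matters: with the extra entry in the middle it exceeds the lengths of both
    -- summands.
    clock : X → List Bool
    clock x = xs x ++ true ∷ ys x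
    px py p : Poly
    px = listPoly {encA = λ _ → encBool} xsE
    py = listPoly {encA = λ _ → encBool} ysE
    p = con 1 ⊕ ((con 1 ⊕ px ⊗ con 4) ⊕ (con 1 ⊕ ((con 1 ⊕ py ⊗ con 4) ⊕ (con 1 ⊕ (con 5 ⊕ (con 1 ⊕ (px ⊕ (con 1 ⊕ py)) ⊗ con 4))))))
    xs≤ : ∀ x → length (xs x) ≤ ⟦ px ⟧ (size (env x))
    xs≤ x = ≤-trans (length≤size (xs x)) (list≤ {encA = λ _ → encBool} xsE x)
    ys≤ : ∀ x → length (ys x) ≤ ⟦ py ⟧ (size (env x))
    ys≤ x = ≤-trans (length≤size (ys x)) (list≤ {encA = λ _ → encBool} ysE x)
    clock≤ : ∀ x l₁ l₂ → l₁ ++ l₂ ≡ clock x → length l₁ ≤ ⟦ px ⊕ (con 1 ⊕ py) ⟧ (size (env x))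
    clock≤ x l₁ l₂ eq = ≤-trans (List.length-++-≤ˡ l₁) (≤-trans (≤-reflexive (trans (cong length eq) (List.length-++ (xs x))))
      (+-mono-≤ (xs≤ x) (s≤s (ys≤ x))))
    result : X → List Bool
    result x = sumDigits (runAdd (xs x , ys x , 0 , []) (clock x))
    result-val : ∀ x → val (result x) ≡ f x + g x
    result-val x = trans (runAdd-val (clock x) (xs x) (ys x) 0 [] z≤n
        (≤-trans (s≤s (m≤m+n _ _)) (≤-reflexive (trans (sym (+-suc _ _)) (sym (List.length-++ (xs x))))))
        (≤-trans (m≤n+m _ (length (xs x))) (≤-reflexive (sym (List.length-++ (xs x))))))
      (trans (+-identityʳ _) (cong₂ _+_ (val-digits (f x)) (val-digits (g x))))

  opaque
    unfolding encNat

    natE : ∀ m → Computes env (λ _ → encNat m)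
    natE m = constE (encNat m)

-- Sums of binary numbers

sumFin : ∀ {n} → (Fin n → ℕ) → ℕ
sumFin f = foldFin (λ v s → f v + s) 0

sumOver : {A : Set} → (A → ℕ) → List A → ℕ
sumOver f = foldr (λ a s → f a + s) 0

-- Each further summand at most doubles the bound. This is crude, but the exponent stays linear in
-- the length, which is enough for polynomial size.
sumOver≤ : ∀ {A : Set} (f : A → ℕ) l {k} → (∀ {a l₁ l₂} → l₁ ++ a ∷ l₂ ≡ l → f a ≤ 2 ^ k) → sumOver f l ≤ 2 ^ (length l + k)
sumOver≤ f []      ≤k = z≤n
sumOver≤ f (a ∷ l) {k} ≤k = ≤-trans
  (+-mono-≤ (≤-trans (≤k {l₁ = []} refl) (^-monoʳ-≤ 2 (m≤n+m k (length l)))) (sumOver≤ f l λ {a′} {l₁} eq → ≤k {l₁ = a ∷ l₁} (cong (a ∷_) eq)))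
  (≤-reflexive (cong (2 ^ (length l + k) +_) (sym (+-identityʳ _))))

module _ {X : Set} {env : X → Tree} {A : X → Set} {encA : ∀ x → A x → Tree} {L : ∀ x → List (A x)} where

  sumOverE : (f : ∀ x → A x → ℕ) → Computes env (λ x → encList (encA x) (L x)) →
    Computes {Σ X A} (λ (x , a) → cons (encA x a) (env x)) (λ (x , a) → encNat (f x a)) →
    Computes env (λ x → encNat (sumOver (f x) (L x)))
  sumOverE f list body = foldrE (λ _ → encNat) (λ _ → 0) (λ x a s → f x a + s) list (natE 0)
    (addE (consE v0 (wk rest) ⟫ reindex (λ (x , a , s) → x , a) body) (wk v0))
    (con 1 ⊕ (con 1 ⊕ (listPoly list ⊕ elementPoly list body)) ⊗ con 4)
    λ x l₁ l₂ eq → ≤-trans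
      (size-encNat (length l₂ + ⟦ elementPoly list body ⟧ (size (env x))) (sumOver≤ (f x) l₂ {⟦ elementPoly list body ⟧ (size (env x))} λ {a} {l₃} eq′ → ≤-trans (encNat-size (f x a)) (^-monoʳ-≤ 2
        (element≤ list body x (l₁ ++ l₃) (trans (List.++-assoc l₁ l₃ _) (trans (cong (l₁ ++_) eq′) eq))))))
      (s≤s (*-monoˡ-≤ 4 (s≤s (+-monoˡ-≤ _ (suffixLength≤ list x l₁ eq)))))

module _ {X : Set} {env : X → Tree} {n : X → ℕ} (vs : Computes env (λ x → vertices (n x))) where

  sumFinE : {f : ∀ x → Fin (n x) → ℕ} →
    Computes {Σ X (Fin ∘ n)} (λ (x , v) → cons (encFin v) (env x)) (λ (x , v) → encNat (f x v)) →
    Computes env (λ x → encNat (sumFin (f x)))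
  sumFinE {f} body = ≗E (λ x → cong encNat (foldr-allFin (λ v s → f x v + s) 0))
    (sumOverE {encA = λ _ → encFin} f vs body)

-- The cube c consists of the sets W containing every v with c true v and no v with c false v.
Cube : ℕ → Set
Cube n = Bool → Fin n → Bool

Relation : ℕ → Set
Relation n = Fin n → Fin n → Bool

whole : ∀ {n} → Cube n
whole _ _ = false

-- Restricts c to the sets W such that x is the first element of P that lies in W (d = true) or outside
-- W (d = false), first in the order given by before.  The result is contradictory if x is not in P.
refine : ∀ {n} → Bool → (Fin n → Bool) → Relation n → Cube n → Fin n → Cube n
refine d P before c x e y =
  c e y ∨ (if e xor d yes ((y ≡F x ∧ not (P y)) ∨ (P y ∧ before y x)) no y ≡F x)

-- The case that `refine` leaves over: all of `P` lies on the side opposite to `d`, so there is no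
-- first element.
exclude : ∀ {n} → Bool → (Fin n → Bool) → Cube n → Cube n
exclude d P c e y = c e y ∨ ((e xor d) ∧ P y)

-- For a strict total order these cubes partition the sets in `c`, so counts over them simply add
-- up. Candidates not in `P` contribute empty cubes.
guess : ∀ {n} → Bool → (Fin n → Bool) → Relation n → Cube n → List (Cube n)
guess d P before c = exclude d P c ∷ map (refine d P before c) (allFin _)

-- Warshall's algorithm, started from the reflexive closure.
closure : ∀ {n} → Relation n → Relation n
closure R = foldFin (λ k T v w → T v w ∨ (T v k ∧ T k w)) (λ v w → R v w ∨ v ≡F w)

-- Ties in rank are broken by the number of the vertex, so that a first element is unique.
byRank : ∀ {n} → Relation n → Relation n
byRank T v w = (count (T v) <ᵇ count (T w)) ∨ (not (count (T w) <ᵇ count (T v)) ∧ v <F w)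

propagate : ∀ {n} → Relation n → Cube n → Cube n
propagate T c e v = any (λ w → c e w ∧ (if e yes T w v no T v w))

consistent : ∀ {n} → Cube n → Bool
consistent c = all λ v → not (c true v ∧ c false v)

-- The flag `q` chooses the weight of a set: two to the power of its size if every split of it
-- counts, and 1 otherwise. Doubling once per element takes the place of a binary multiplication.
scale : ∀ {n} → Bool → (Fin n → Bool) → ℕ → ℕ
scale q C m = foldFin (λ v k → if q ∧ C v yes k + k no k) m

-- `I` and `O` are the vertices settled as inside and outside. The component of an undetermined `v`
-- is what `v` reaches outside `I`; leaving it out contributes a factor 1 and taking it in
-- contributes its weight. Afterwards it is filed under `O`, so that its other vertices are skipped.
eliminate : ∀ {n} → Bool → Relation n → (Fin n → Bool) → Fin n → (Fin n → Bool) × ℕ → (Fin n → Bool) × ℕ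
eliminate q T I v (O , m) = if I v ∨ O v yes (O , m) no ((λ w → O w ∨ (T v w ∧ not (I w))) , m + scale q (λ w → T v w ∧ not (I w)) m)

leaf′ : ∀ {n} → Bool → Relation n → Cube n → ℕ
leaf′ q T c = if consistent c yes proj₂ (foldFin (eliminate q T (c true)) (c false , scale q (c true) 1)) no 0

leaf : ∀ {n} → Bool → Relation n → Cube n → ℕ
leaf q T c = leaf′ q T (propagate T c)

-- The first entry is the side on which the extreme element is guessed, the other three name one of
-- the eight classes.
allGuesses : List (Bool × Bool × Bool × Bool)
allGuesses = List.cartesianProduct bools (List.cartesianProduct bools (List.cartesianProduct bools bools))
  where
  bools : List Bool
  bools = true ∷ false ∷ []

module _ {n} (adj : Relation n) (N s t : Fin n → Bool) where

  -- W is homogeneous for the outside, on N and on its complement separately, iff W is closed under forces,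
  -- where s and t are the rows of some element of W in N and of some element of W not in N.
  forces : Relation n
  forces w v = adj v w xor (if N w yes s v no t v)

  inClass : Bool × Bool × Bool → Fin n → Bool
  inClass (i , j , k) v = not (N v xor i) ∧ (not (s v xor j) ∧ not (t v xor k))

  -- Reversed for `d` true: the first element inside is then the one of greatest rank, while the
  -- first element outside is the one of least rank.
  order : Bool → Relation n
  order d v w = if d yes byRank (closure forces) w v no byRank (closure forces) v w

  cubes : List (Bool × Bool × Bool × Bool) → Cube n → List (Cube n)
  cubes gs c = foldr (λ (d , k) → concatMap (guess d (inClass k) (order d))) (c ∷ []) gs

  countClosed : Bool → Cube n → ℕ
  countClosed q c = sumOver (leaf q (closure forces)) (cubes allGuesses c)

-- The counting formula

module _ {n} (adj : Relation n) where

  everything : Fin n → Bool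
  everything _ = true

  other₁ : Fin n → Fin n → Bool
  other₁ w₁ y = not (y ≡F w₁)

  other₂ : Fin n → Fin n → Fin n → Bool
  other₂ w₁ w₂ y = not (y ≡F w₁) ∧ not (y ≡F w₂)

  -- Two elements inside and two outside are enforced by naming the first two on either side. As
  -- these are unique, every admissible W lies in one such cube only.
  cube₄ : Fin n → Fin n → Fin n → Fin n → Cube n
  cube₄ w₁ w₂ u₁ u₂ =
    refine false (other₁ u₁) _<F_ (refine false everything _<F_
      (refine true (other₁ w₁) _<F_ (refine true everything _<F_ whole w₁) w₂) u₁) u₂

  cube₅ : Fin n → Fin n → Fin n → Fin n → Fin n → Cube n
  cube₅ w₁ w₂ u₁ u₂ w₃ = refine true (other₂ w₁ w₂) _<F_ (cube₄ w₁ w₂ u₁ u₂) w₃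

  -- That `u` is the first vertex separating W is not visibly a condition on single vertices. But if
  -- W is homogeneous for the outside on both parts, an outside vertex separates W exactly when it
  -- distinguishes `a` from `b`. So all vertices before `u` that distinguish them are required to
  -- lie in W, and `u` itself to lie outside.
  separate : Fin n → Fin n → Fin n → Cube n → Cube n
  separate u a b c e y = refine true (λ y → not (adj u y)) _<F_ (refine true (adj u) _<F_ c a) b e y
    ∨ (if e yes (y <F u ∧ (adj a y xor adj b y)) no y ≡F u)

  -- With `everything` for `N`, being closed under `forces` means that each outside vertex sees all
  -- of W as it sees `w₁`, that is, that W is a module. Here W has no third element; `modules₃`
  -- treats the others.
  modules₂ : Fin n → Fin n → Fin n → Fin n → ℕ
  modules₂ w₁ w₂ u₁ u₂ = countClosed adj everything (adj w₁) (adj w₁) false (exclude true (other₂ w₁ w₂) (cube₄ w₁ w₂ u₁ u₂))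

  modules₃ : Fin n → Fin n → Fin n → Fin n → Fin n → ℕ
  modules₃ w₁ w₂ u₁ u₂ w₃ = countClosed adj everything (adj w₁) (adj w₁) true (cube₅ w₁ w₂ u₁ u₂ w₃)

  bimodules : Fin n → Fin n → Fin n → Fin n → Fin n → Fin n → Fin n → Fin n → ℕ
  bimodules w₁ w₂ u₁ u₂ w₃ u a b = countClosed adj (adj u) (adj a) (adj b) false (separate u a b (cube₅ w₁ w₂ u₁ u₂ w₃))

  -- The repeated summands account for the labels of the sides: a module with two elements goes
  -- entirely to W₁ or entirely to W₂, and the two parts at a separator can be named in either
  -- order. In `modules₃` the labels are already counted by the weight.
  total : ℕ
  total = sumFin λ w₁ → sumFin λ w₂ → sumFin λ u₁ → sumFin λ u₂ →
    (modules₂ w₁ w₂ u₁ u₂ + modules₂ w₁ w₂ u₁ u₂) + sumFin λ w₃ →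
      modules₃ w₁ w₂ u₁ u₂ w₃ + sumFin λ u → sumFin λ a → sumFin λ b →
        bimodules w₁ w₂ u₁ u₂ w₃ u a b + bimodules w₁ w₂ u₁ u₂ w₃ u a b

-- Programs for the counting formula

lift : ∀ {X : Set} {A : X → Set} {env out : X → Tree} {a : Σ X A → Tree} → Computes env out →
  Computes {Σ X A} (λ z → cons (a z) (env (proj₁ z))) (λ z → out (proj₁ z))
lift f = rest ⟫ reindex proj₁ f

encCube : ∀ {n} → Cube n → Tree
encCube c = cons (encSet (c true)) (encSet (c false))

encSetNat : ∀ {n} → (Fin n → Bool) × ℕ → Tree
encSetNat (O , m) = cons (encSet O) (encNat m)

scaled≤ : ∀ {n} q (C : Fin n → Bool) {m k} l → m ≤ 2 ^ k → foldr (λ v j → if q ∧ C v yes j + j no j) m l ≤ 2 ^ (length l + k)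
scaled≤ q C []      m≤ = m≤
scaled≤ q C {m} {k} (v ∷ l) m≤ with q ∧ C v
... | false = ≤-trans (scaled≤ q C l m≤) (m≤m+n _ _)
... | true  = ≤-trans (+-mono-≤ (scaled≤ q C l m≤) (scaled≤ q C l m≤)) (≤-reflexive (cong (2 ^ (length l + k) +_) (sym (+-identityʳ _))))

scale≤ : ∀ {n} q (C : Fin n → Bool) {m k} → m ≤ 2 ^ k → scale q C m ≤ 2 ^ (n + k)
scale≤ {n} q C {m} {k} m≤ = subst₂ _≤_ (foldr-allFin (λ v j → if q ∧ C v yes j + j no j) m) (cong (λ j → 2 ^ (j + k)) (List.length-tabulate {n = n} id)) (scaled≤ q C (allFin n) m≤)

-- One vertex multiplies the count by at most 1 + 2^n, hence raises the exponent by at most n + 1.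
-- The exponent therefore stays quadratic in n and the numeral polynomial.
eliminated≤ : ∀ {n} q (T : Relation n) I O {m k} l → m ≤ 2 ^ k →
  proj₂ (foldr (eliminate q T I) (O , m) l) ≤ 2 ^ (length l * suc n + k)
eliminated≤ q T I O []      m≤ = m≤
eliminated≤ {n} q T I O {m} {k} (v ∷ l) m≤ with foldr (eliminate q T I) (O , m) l | eliminated≤ q T I O l m≤
... | O′ , m′ | m′≤ with I v ∨ O′ v
...   | true  = ≤-trans m′≤ (^-monoʳ-≤ 2 (+-monoˡ-≤ k (m≤n+m (length l * suc n) (suc n))))
...   | false = ≤-trans (+-mono-≤ (≤-trans m′≤ (^-monoʳ-≤ 2 (m≤n+m j n))) (scale≤ q (λ w → T v w ∧ not (I w)) {k = j} m′≤))
                  (≤-reflexive (trans (cong (2 ^ (n + j) +_) (sym (+-identityʳ _))) (cong (λ i → 2 ^ suc i) (sym (+-assoc n _ k)))))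
  where j = length l * suc n + k

module _ {X : Set} {env : X → Tree} where

  xorE : ∀ {b c : X → Bool} → Computes env (λ x → encBool (b x)) → Computes env (λ x → encBool (c x)) →
    Computes env (λ x → encBool (b x xor c x))
  xorE {b} {c} f g = ≗E (λ x → cong encBool (eq (b x) (c x))) (ifBoolE {enc = λ _ → encBool} f (notE g) g)
    where
    eq : ∀ b c → (if b yes not c no c) ≡ b xor c
    eq false c = refl
    eq true  c = refl

module _ {X : Set} {env : X → Tree} {n : X → ℕ} where

  sideE : ∀ {c : ∀ x → Cube (n x)} e → Computes env (λ x → encCube (c x)) → Computes env (λ x → encSet (c x e))
  sideE true  f = headE f
  sideE false f = tailE f

  cubeE : ∀ {c : ∀ x → Cube (n x)} → (∀ e → Computes env (λ x → encSet (c x e))) → Computes env (λ x → encCube (c x))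
  cubeE f = consE (f true) (f false)

  memberE : ∀ {p : ∀ x → Fin (n x) → Bool} {v : ∀ x → Fin (n x)} →
    Computes env (λ x → encSet (p x)) → Computes env (λ x → encFin (v x)) → Computes env (λ x → encBool (p x (v x)))
  memberE {p} {v} f g = lookupE {n = n} {enc = λ _ → encBool} {p = p} {v = v} f g

  relatedE : ∀ {T : ∀ x → Relation (n x)} {v w : ∀ x → Fin (n x)} → Computes env (λ x → encMatrix (T x)) →
    Computes env (λ x → encFin (v x)) → Computes env (λ x → encFin (w x)) → Computes env (λ x → encBool (T x (v x) (w x)))
  relatedE {T} {v} {w} f g h = memberE {λ x → T x (v x)} {w} (lookupE {n = n} {enc = λ _ → encSet} {p = T} {v = v} f g) h

  rowE : ∀ {T : ∀ x → Relation (n x)} {v : ∀ x → Fin (n x)} → Computes env (λ x → encMatrix (T x)) →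
    Computes env (λ x → encFin (v x)) → Computes env (λ x → encSet (T x (v x)))
  rowE {T} {v} f g = lookupE {n = n} {enc = λ _ → encSet} {p = T} {v = v} f g

module _ {X : Set} {env : X → Tree} {n : X → ℕ} (vs : Computes env (λ x → vertices (n x))) where

  setE : ∀ {p : ∀ x → Fin (n x) → Bool} →
    Computes {Σ X (Fin ∘ n)} (λ (x , v) → cons (encFin v) (env x)) (λ (x , v) → encBool (p x v)) →
    Computes env (λ x → encSet (p x))
  setE {p} f = tableE vs {enc = λ _ → encBool} {p = p} f

  refineE : ∀ d {P : ∀ x → Fin (n x) → Bool} {before : ∀ x → Relation (n x)} {c : ∀ x → Cube (n x)} {w : ∀ x → Fin (n x)} →
    Computes {Σ X (Fin ∘ n)} (λ (x , v) → cons (encFin v) (env x)) (λ (x , v) → encBool (P x v)) →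
    Computes {Σ X (Fin ∘ n)} (λ (x , v) → cons (encFin v) (env x)) (λ (x , v) → encBool (before x v (w x))) →
    Computes env (λ x → encCube (c x)) → Computes env (λ x → encFin (w x)) →
    Computes env (λ x → encCube (refine d (P x) (before x) (c x) (w x)))
  refineE d {P} {before} {c} {w} PE beforeE cE wE = cubeE {c = λ x → refine d (P x) (before x) (c x) (w x)} λ e →
    setE {λ x → refine d (P x) (before x) (c x) (w x) e} (orE (memberE {n = n ∘ proj₁} {λ (x , _) → c x e} {proj₂} (lift (sideE {c = c} e cE)) v0)
      (ifBoolE {enc = λ _ → encBool} (boolE (e xor d)) (orE (andE same (notE PE)) (andE PE beforeE)) same))
    where
    same : Computes {Σ X (Fin ∘ n)} (λ (x , v) → cons (encFin v) (env x)) (λ (x , v) → encBool (v ≡F w x))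
    same = ≡FE {n = n ∘ proj₁} {proj₂} {w ∘ proj₁} v0 (lift wE)

  excludeE : ∀ d {P : ∀ x → Fin (n x) → Bool} {c : ∀ x → Cube (n x)} →
    Computes {Σ X (Fin ∘ n)} (λ (x , v) → cons (encFin v) (env x)) (λ (x , v) → encBool (P x v)) →
    Computes env (λ x → encCube (c x)) → Computes env (λ x → encCube (exclude d (P x) (c x)))
  excludeE d {P} {c} PE cE = cubeE {c = λ x → exclude d (P x) (c x)} λ e →
    setE {λ x → exclude d (P x) (c x) e} (orE (memberE {n = n ∘ proj₁} {λ (x , _) → c x e} {proj₂} (lift (sideE {c = c} e cE)) v0) (andE (boolE (e xor d)) PE))

  matrixE : ∀ {T : ∀ x → Relation (n x)} →
    Computes {Σ (Σ X (Fin ∘ n)) (Fin ∘ n ∘ proj₁)} (λ ((x , v) , w) → cons (encFin w) (cons (encFin v) (env x))) (λ ((x , v) , w) → encBool (T x v w)) →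
    Computes env (λ x → encMatrix (T x))
  matrixE {T} f = tableE vs {enc = λ _ → encSet} {p = T} (tableE {n = n ∘ proj₁} (lift vs) {enc = λ _ → encBool} {p = λ (x , v) → T x v} f)

  closureE : ∀ {R : ∀ x → Relation (n x)} → Computes env (λ x → encMatrix (R x)) → Computes env (λ x → encMatrix (closure (R x)))
  closureE {R} f = foldFinE vs (λ _ → encMatrix) (λ x v w → R x v w ∨ v ≡F w) (λ x k T v w → T v w ∨ (T v k ∧ T k w))
    (matrixE {λ x v w → R x v w ∨ v ≡F w} (orE (relatedE {n = λ ((x , _) , _) → n x} {λ ((x , _) , _) → R x} {λ ((_ , v) , _) → v} {proj₂} (lift (lift f)) (lift v0) v0)
      (≡FE {n = λ ((x , _) , _) → n x} {λ ((_ , v) , _) → v} {proj₂} (lift v0) v0)))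
    stepE
    (con 1 ⊕ verticesPoly vs ⊗ (con 2 ⊕ verticesPoly vs ⊗ con 4))
    λ x _ _ _ → ≤-trans (size-encMatrix _) (s≤s (*-mono-≤ (n≤ vs x) (s≤s (s≤s (*-monoˡ-≤ 4 (n≤ vs x))))))
    where
    Y : Set
    Y = Σ X λ x → Fin (n x) × Relation (n x)
    Z : Set
    Z = Σ (Σ Y λ (x , _) → Fin (n x)) λ ((x , _) , _) → Fin (n x)
    N : Z → ℕ
    N (((x , _) , _) , _) = n x
    T : ∀ z → Relation (N z)
    T (((_ , _ , T) , _) , _) = T
    k v w : ∀ z → Fin (N z)
    k (((_ , k , _) , _) , _) = k
    v ((_ , v) , _) = v
    w (_ , w) = w
    envZ : Z → Tree
    envZ (((x , k , T) , v) , w) = cons (encFin w) (cons (encFin v) (cons (encFin k) (cons (encMatrix T) (env x))))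
    TE : Computes envZ (λ z → encMatrix (T z))
    TE = rest ⟫ rest ⟫ wk v0
    kE : Computes envZ (λ z → encFin (k z))
    kE = rest ⟫ wk v0
    vE : Computes envZ (λ z → encFin (v z))
    vE = wk v0
    wE : Computes envZ (λ z → encFin (w z))
    wE = v0
    stepE : Computes {Y} (λ (x , k , T) → cons (encFin k) (cons (encMatrix T) (env x)))
      (λ (x , k , T) → encMatrix (λ v w → T v w ∨ (T v k ∧ T k w)))
    stepE = tableE {n = n ∘ proj₁} (rest ⟫ rest ⟫ reindex proj₁ vs) {enc = λ _ → encSet} {p = λ (x , k , T) v w → T v w ∨ (T v k ∧ T k w)}
      (tableE {n = n ∘ proj₁ ∘ proj₁} (rest ⟫ rest ⟫ rest ⟫ reindex (proj₁ ∘ proj₁) vs) {enc = λ _ → encBool} {p = λ ((x , k , T) , v) w → T v w ∨ (T v k ∧ T k w)}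
        (orE (relatedE {n = N} {T} {v} {w} TE vE wE) (andE (relatedE {n = N} {T} {v} {k} TE vE kE) (relatedE {n = N} {T} {k} {w} TE kE wE))))

  byRankE : ∀ {T : ∀ x → Relation (n x)} {v w : ∀ x → Fin (n x)} → Computes env (λ x → encMatrix (T x)) →
    Computes env (λ x → encFin (v x)) → Computes env (λ x → encFin (w x)) → Computes env (λ x → encBool (byRank (T x) (v x) (w x)))
  byRankE {T} {v} {w} f g h = orE (<E (rank v g) (rank w h)) (andE (notE (<E (rank w h) (rank v g))) (<FE {n = n} {v} {w} g h))
    where
    rank : ∀ (v : ∀ x → Fin (n x)) → Computes env (λ x → encFin (v x)) → Computes env (λ x → encUnary (count (T x (v x))))
    rank v g = countE vs (relatedE {n = n ∘ proj₁} {T ∘ proj₁} {v ∘ proj₁} {proj₂} (lift f) (lift g) v0)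

  scaleE : ∀ q {C : ∀ x → Fin (n x) → Bool} {m : X → ℕ} →
    Computes {Σ X (Fin ∘ n)} (λ (x , v) → cons (encFin v) (env x)) (λ (x , v) → encBool (C x v)) →
    Computes env (λ x → encNat (m x)) → Computes env (λ x → encNat (scale q (C x) (m x)))
  scaleE q {C} {m} CE mE = foldFinE vs (λ _ → encNat) m (λ x v k → if q ∧ C x v yes k + k no k) mE
    (ifBoolE {enc = λ _ → encNat} (andE (boolE q) (consE v0 (wk rest) ⟫ reindex (λ (x , v , k) → x , v) CE)) (addE (wk v0) (wk v0)) (wk v0))
    (con 1 ⊕ (con 1 ⊕ (verticesPoly vs ⊕ pm)) ⊗ con 4)
    λ x l₁ l₂ eq → ≤-trans
      (size-encNat (length l₂ + ⟦ pm ⟧ (size (env x))) (scaled≤ q (C x) l₂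
        (≤-trans (encNat-size (m x)) (^-monoʳ-≤ 2 (Bounded.size≤ (bounded mE) x)))))
      (s≤s (*-monoˡ-≤ 4 (s≤s (+-monoˡ-≤ _ (suffixLength≤ {encA = λ _ → encFin} vs x l₁ eq)))))
    where
    pm = Bounded.sizePoly (bounded mE)

module _ {X : Set} {env : X → Tree} {n : X → ℕ} (vs : Computes env (λ x → vertices (n x)))
  {T : ∀ x → Relation (n x)} (TE : Computes env (λ x → encMatrix (T x))) where

  propagateE : ∀ {c : ∀ x → Cube (n x)} → Computes env (λ x → encCube (c x)) → Computes env (λ x → encCube (propagate (T x) (c x)))
  propagateE {c} cE = cubeE {c = λ x → propagate (T x) (c x)} λ e → setE vs {λ x → propagate (T x) (c x) e}
    (anyE {n = n ∘ proj₁} (lift vs) {λ (x , v) w → c x e w ∧ (if e yes T x w v no T x v w)}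
      (andE (memberE {n = n ∘ proj₁ ∘ proj₁} {λ ((x , _) , _) → c x e} {proj₂} (lift (lift (sideE {c = c} e cE))) v0)
        (ifBoolE {enc = λ _ → encBool} (boolE e)
          (relatedE {n = n ∘ proj₁ ∘ proj₁} {T ∘ proj₁ ∘ proj₁} {proj₂} {proj₂ ∘ proj₁} (lift (lift TE)) v0 (lift v0))
          (relatedE {n = n ∘ proj₁ ∘ proj₁} {T ∘ proj₁ ∘ proj₁} {proj₂ ∘ proj₁} {proj₂} (lift (lift TE)) (lift v0) v0))))

  leaf′E : ∀ q {c : ∀ x → Cube (n x)} → Computes env (λ x → encCube (c x)) → Computes env (λ x → encNat (leaf′ q (T x) (c x)))
  leaf′E q {c} cE = ifBoolE {enc = λ _ → encNat}
    (allE vs {λ x v → not (c x true v ∧ c x false v)}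
      (notE (andE (memberE {n = n ∘ proj₁} {λ (x , _) → c x true} {proj₂} (lift IE) v0)
                  (memberE {n = n ∘ proj₁} {λ (x , _) → c x false} {proj₂} (lift (sideE {c = c} false cE)) v0))))
    (tailE loop)
    (natE 0)
    where
    IE : Computes env (λ x → encSet (c x true))
    IE = sideE {c = c} true cE
    s₀ : ∀ x → (Fin (n x) → Bool) × ℕ
    s₀ x = c x false , scale q (c x true) 1
    Y : Set
    Y = Σ X λ x → Fin (n x) × (Fin (n x) → Bool) × ℕ
    envY : Y → Tree
    envY (x , v , s) = cons (encFin v) (cons (encSetNat s) (env x))
    N : Y → ℕ
    N (x , _) = n x
    v : ∀ y → Fin (N y)
    v (_ , v , _) = v
    I O C : ∀ y → Fin (N y) → Bool
    I (x , _) = c x true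
    O (_ , _ , O , _) = O
    C y w = T (proj₁ y) (v y) w ∧ not (I y w)
    vE : Computes envY (λ y → encFin (v y))
    vE = v0
    OE : Computes envY (λ y → encSet (O y))
    OE = headE (wk v0)
    mE : Computes envY (λ (_ , _ , _ , m) → encNat m)
    mE = tailE (wk v0)
    outer : ∀ {out : X → Tree} → Computes env out → Computes envY (out ∘ proj₁)
    outer f = rest ⟫ rest ⟫ reindex proj₁ f
    CE : Computes {Σ Y (Fin ∘ N)} (λ (y , w) → cons (encFin w) (envY y)) (λ (y , w) → encBool (C y w))
    CE = andE (relatedE {n = N ∘ proj₁} {T ∘ proj₁ ∘ proj₁} {v ∘ proj₁} {proj₂} (lift (outer TE)) (lift vE) v0)
              (notE (memberE {n = N ∘ proj₁} {I ∘ proj₁} {proj₂} (lift (outer IE)) v0))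
    stepE : Computes envY (λ (x , v , s) → encSetNat (eliminate q (T x) (c x true) v s))
    stepE = ifBoolE {enc = λ _ → encSetNat} (orE (memberE {n = N} {I} {v} (outer IE) vE) (memberE {n = N} {O} {v} OE vE))
      (wk v0)
      (consE (setE {n = N} (outer vs) {λ y w → O y w ∨ C y w} (orE (memberE {n = N ∘ proj₁} {O ∘ proj₁} {proj₂} (lift OE) v0) CE))
             (addE mE (scaleE {n = N} (outer vs) q {C} CE mE)))
    pv : Poly
    pv = verticesPoly vs
    loop : Computes env (λ x → encSetNat (foldFin (eliminate q (T x) (c x true)) (s₀ x)))
    loop = foldFinE vs (λ _ → encSetNat) s₀ (λ x → eliminate q (T x) (c x true))
      (consE (sideE {c = c} false cE) (scaleE vs q {λ x → c x true} (memberE {n = n ∘ proj₁} {λ (x , _) → c x true} {proj₂} (lift IE) v0) (natE 1)))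
      stepE
      (con 1 ⊕ ((con 1 ⊕ pv ⊗ con 4) ⊕ (con 1 ⊕ (con 1 ⊕ (pv ⊗ (con 1 ⊕ pv) ⊕ (pv ⊕ con 0))) ⊗ con 4)))
      λ x l₁ l₂ eq → s≤s (+-mono-≤ (≤-trans (size-encSet _) (s≤s (*-monoˡ-≤ 4 (n≤ vs x))))
        (≤-trans (size-encNat (length l₂ * suc (n x) + (n x + 0)) (eliminated≤ q (T x) (c x true) (c x false) l₂ (scale≤ q (c x true) {1} {0} ≤-refl)))
          (s≤s (*-monoˡ-≤ 4 (s≤s (+-mono-≤ (*-mono-≤ (suffixLength≤ {encA = λ _ → encFin} vs x l₁ eq) (s≤s (n≤ vs x))) (+-monoˡ-≤ 0 (n≤ vs x))))))))

  leafE : ∀ q {c : ∀ x → Cube (n x)} → Computes env (λ x → encCube (c x)) → Computes env (λ x → encNat (leaf q (T x) (c x)))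
  leafE q {c} cE = leaf′E q {λ x → propagate (T x) (c x)} (propagateE {c} cE)

module _ {X : Set} {env : X → Tree} {n : X → ℕ} (vs : Computes env (λ x → vertices (n x))) where

  guessE : ∀ d {P : ∀ x → Fin (n x) → Bool} {before : ∀ x → Relation (n x)} {c : ∀ x → Cube (n x)} →
    Computes {Σ X (Fin ∘ n)} (λ (x , v) → cons (encFin v) (env x)) (λ (x , v) → encBool (P x v)) →
    Computes env (λ x → encMatrix (before x)) → Computes env (λ x → encCube (c x)) →
    Computes env (λ x → encList encCube (guess d (P x) (before x) (c x)))
  guessE d {P} {before} {c} PE beforeE cE = ∷E {encA = λ _ → encCube} (excludeE vs d {P} {c} PE cE)
    (mapE {encA = λ _ → encFin} {encB = λ _ → encCube} (λ x → refine d (P x) (before x) (c x)) vs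
      (refineE {n = n ∘ proj₁} (lift vs) d {P ∘ proj₁} {before ∘ proj₁} {c ∘ proj₁} {proj₂}
        (consE v0 (wk rest) ⟫ reindex (λ ((x , w) , v) → x , v) PE)
        (relatedE {n = n ∘ proj₁ ∘ proj₁} {before ∘ proj₁ ∘ proj₁} {proj₂} {proj₂ ∘ proj₁} (lift (lift beforeE)) v0 (lift v0))
        (lift cE) v0))

module _ {X : Set} {env : X → Tree} {n : X → ℕ} (vs : Computes env (λ x → vertices (n x))) where

  module _ {adj : ∀ x → Relation (n x)} {N s t : ∀ x → Fin (n x) → Bool}
    (adjE : Computes env (λ x → encMatrix (adj x)))
    (NE : Computes env (λ x → encSet (N x))) (sE : Computes env (λ x → encSet (s x))) (tE : Computes env (λ x → encSet (t x))) where

    closureForcesE : Computes env (λ x → encMatrix (closure (forces (adj x) (N x) (s x) (t x))))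
    closureForcesE = closureE vs {λ x → forces (adj x) (N x) (s x) (t x)} (matrixE vs {λ x → forces (adj x) (N x) (s x) (t x)}
      (xorE (relatedE {n = m} {λ ((x , _) , _) → adj x} {v} {w} (lift (lift adjE)) v0 (lift v0))
        (ifBoolE {enc = λ _ → encBool} (memberE {n = m} {λ ((x , _) , _) → N x} {w} (lift (lift NE)) (lift v0))
          (memberE {n = m} {λ ((x , _) , _) → s x} {v} (lift (lift sE)) v0)
          (memberE {n = m} {λ ((x , _) , _) → t x} {v} (lift (lift tE)) v0))))
      where
      m : Σ (Σ X (Fin ∘ n)) (Fin ∘ n ∘ proj₁) → ℕ
      m ((x , _) , _) = n x
      w v : ∀ z → Fin (m z)
      w ((_ , w) , _) = w
      v (_ , v) = v

    inClassE : ∀ k → Computes {Σ X (Fin ∘ n)} (λ (x , v) → cons (encFin v) (env x)) (λ (x , v) → encBool (inClass (adj x) (N x) (s x) (t x) k v))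
    inClassE (i , j , k) = andE (notE (xorE (at N NE) (boolE i))) (andE (notE (xorE (at s sE) (boolE j))) (notE (xorE (at t tE) (boolE k))))
      where
      at : ∀ (p : ∀ x → Fin (n x) → Bool) → Computes env (λ x → encSet (p x)) →
        Computes {Σ X (Fin ∘ n)} (λ (x , v) → cons (encFin v) (env x)) (λ (x , v) → encBool (p x v))
      at p f = memberE {n = n ∘ proj₁} {p ∘ proj₁} {proj₂} (lift f) v0

    orderE : ∀ d → Computes env (λ x → encMatrix (order (adj x) (N x) (s x) (t x) d))
    orderE d = matrixE vs {λ x → order (adj x) (N x) (s x) (t x) d} (ifBoolE {enc = λ _ → encBool} (boolE d)
      (byRankE {n = m} (lift (lift vs)) {T} {w} {v} (lift (lift closureForcesE)) v0 (lift v0))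
      (byRankE {n = m} (lift (lift vs)) {T} {v} {w} (lift (lift closureForcesE)) (lift v0) v0))
      where
      m : Σ (Σ X (Fin ∘ n)) (Fin ∘ n ∘ proj₁) → ℕ
      m ((x , _) , _) = n x
      T : ∀ z → Relation (m z)
      T ((x , _) , _) = closure (forces (adj x) (N x) (s x) (t x))
      v w : ∀ z → Fin (m z)
      v ((_ , v) , _) = v
      w (_ , w) = w

  module _ {adj : ∀ x → Relation (n x)} {N s t : ∀ x → Fin (n x) → Bool} {c : ∀ x → Cube (n x)}
    (adjE : Computes env (λ x → encMatrix (adj x)))
    (NE : Computes env (λ x → encSet (N x))) (sE : Computes env (λ x → encSet (s x))) (tE : Computes env (λ x → encSet (t x)))
    (cE : Computes env (λ x → encCube (c x))) where

    cubesE : ∀ gs → Computes env (λ x → encList encCube (cubes (adj x) (N x) (s x) (t x) gs (c x)))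
    cubesE [] = ∷E {encA = λ _ → encCube} cE ([]E {encA = λ _ → encCube})
    cubesE ((d , k) ∷ gs) = concatMapE {encA = λ _ → encCube} {encB = λ _ → encCube}
      (λ x → guess d (inClass (adj x) (N x) (s x) (t x) k) (order (adj x) (N x) (s x) (t x) d)) (cubesE gs)
      (step d k)
      where
      step : ∀ d k → Computes {Σ X (Cube ∘ n)} (λ (x , c′) → cons (encCube c′) (env x))
        (λ (x , c′) → encList encCube (guess d (inClass (adj x) (N x) (s x) (t x) k) (order (adj x) (N x) (s x) (t x) d) c′))
      step d k = guessE {n = n ∘ proj₁} (lift vs) d {λ (x , _) → inClass (adj x) (N x) (s x) (t x) k} {λ (x , _) → order (adj x) (N x) (s x) (t x) d} {proj₂}
        (consE v0 (rest ⟫ rest) ⟫ reindex (λ ((x , _) , v) → x , v) (inClassE {adj} {N} {s} {t} adjE NE sE tE k))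
        (lift (orderE {adj} {N} {s} {t} adjE NE sE tE d)) v0

    countClosedE : ∀ q → Computes env (λ x → encNat (countClosed (adj x) (N x) (s x) (t x) q (c x)))
    countClosedE q = sumOverE {encA = λ _ → encCube} (λ x → leaf q (closure (forces (adj x) (N x) (s x) (t x)))) (cubesE allGuesses)
      (leafE {n = n ∘ proj₁} (lift vs) {λ (x , _) → closure (forces (adj x) (N x) (s x) (t x))} (lift (closureForcesE {adj} {N} {s} {t} adjE NE sE tE)) q {proj₂} v0)

module _ {X : Set} {env : X → Tree} {n : X → ℕ} (vs : Computes env (λ x → vertices (n x)))
  {adj : ∀ x → Relation (n x)} (adjE : Computes env (λ x → encMatrix (adj x))) where

  private
    Vertex : Set
    Vertex = ∀ x → Fin (n x)

    VertexE : Vertex → Set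
    VertexE v = Computes env (λ x → encFin (v x))

  everythingE : Computes {Σ X (Fin ∘ n)} (λ (x , v) → cons (encFin v) (env x)) (λ (x , v) → encBool (everything (adj x) v))
  everythingE = boolE true

  other₁E : ∀ {w₁ : Vertex} → VertexE w₁ →
    Computes {Σ X (Fin ∘ n)} (λ (x , v) → cons (encFin v) (env x)) (λ (x , v) → encBool (other₁ (adj x) (w₁ x) v))
  other₁E {w₁} f = notE (≡FE {n = n ∘ proj₁} {proj₂} {w₁ ∘ proj₁} v0 (lift f))

  other₂E : ∀ {w₁ w₂ : Vertex} → VertexE w₁ → VertexE w₂ →
    Computes {Σ X (Fin ∘ n)} (λ (x , v) → cons (encFin v) (env x)) (λ (x , v) → encBool (other₂ (adj x) (w₁ x) (w₂ x) v))
  other₂E {w₁} {w₂} f g = andE (other₁E {w₁} f) (other₁E {w₂} g)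

  earlierE : ∀ {w : Vertex} → VertexE w →
    Computes {Σ X (Fin ∘ n)} (λ (x , v) → cons (encFin v) (env x)) (λ (x , v) → encBool (v <F w x))
  earlierE {w} f = <FE {n = n ∘ proj₁} {proj₂} {w ∘ proj₁} v0 (lift f)

  firstE : ∀ d {P : ∀ x → Fin (n x) → Bool} {c : ∀ x → Cube (n x)} {w : Vertex} →
    Computes {Σ X (Fin ∘ n)} (λ (x , v) → cons (encFin v) (env x)) (λ (x , v) → encBool (P x v)) →
    Computes env (λ x → encCube (c x)) → VertexE w → Computes env (λ x → encCube (refine d (P x) _<F_ (c x) (w x)))
  firstE d {P} {c} {w} PE cE wE = refineE vs d {P} {λ _ → _<F_} {c} {w} PE (earlierE {w} wE) cE wE

  everythingSetE : Computes env (λ x → encSet (everything (adj x)))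
  everythingSetE = setE vs {λ x → everything (adj x)} everythingE

  module _ {w₁ w₂ u₁ u₂ : Vertex} (w₁E : VertexE w₁) (w₂E : VertexE w₂) (u₁E : VertexE u₁) (u₂E : VertexE u₂) where

    cube₄E : Computes env (λ x → encCube (cube₄ (adj x) (w₁ x) (w₂ x) (u₁ x) (u₂ x)))
    cube₄E = firstE false {λ x → other₁ (adj x) (u₁ x)} {λ x → refine false (everything (adj x)) _<F_ (a x) (u₁ x)} {u₂} (other₁E {u₁} u₁E)
      (firstE false {λ x → everything (adj x)} {a} {u₁} everythingE
        (firstE true {λ x → other₁ (adj x) (w₁ x)} {b} {w₂} (other₁E {w₁} w₁E)
          (firstE true {λ x → everything (adj x)} {λ _ → whole} {w₁} everythingE (cubeE {n = n} {c = λ _ → whole} λ e → setE vs {λ x → whole e} (boolE false)) w₁E) w₂E) u₁E) u₂E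
      where
      a b : ∀ x → Cube (n x)
      b x = refine true (everything (adj x)) _<F_ whole (w₁ x)
      a x = refine true (other₁ (adj x) (w₁ x)) _<F_ (b x) (w₂ x)

    adj-w₁E : Computes env (λ x → encSet (adj x (w₁ x)))
    adj-w₁E = rowE {n = n} {adj} {w₁} adjE w₁E

    modules₂E : Computes env (λ x → encNat (modules₂ (adj x) (w₁ x) (w₂ x) (u₁ x) (u₂ x)))
    modules₂E = countClosedE vs {adj} {λ x → everything (adj x)} {λ x → adj x (w₁ x)} {λ x → adj x (w₁ x)}
      {λ x → exclude true (other₂ (adj x) (w₁ x) (w₂ x)) (cube₄ (adj x) (w₁ x) (w₂ x) (u₁ x) (u₂ x))} adjE everythingSetE adj-w₁E adj-w₁E
      (excludeE vs true {λ x → other₂ (adj x) (w₁ x) (w₂ x)} {λ x → cube₄ (adj x) (w₁ x) (w₂ x) (u₁ x) (u₂ x)} (other₂E {w₁} {w₂} w₁E w₂E) cube₄E) false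

    module _ {w₃ : Vertex} (w₃E : VertexE w₃) where

      cube₅E : Computes env (λ x → encCube (cube₅ (adj x) (w₁ x) (w₂ x) (u₁ x) (u₂ x) (w₃ x)))
      cube₅E = firstE true {λ x → other₂ (adj x) (w₁ x) (w₂ x)} {λ x → cube₄ (adj x) (w₁ x) (w₂ x) (u₁ x) (u₂ x)} {w₃} (other₂E {w₁} {w₂} w₁E w₂E) cube₄E w₃E

      modules₃E : Computes env (λ x → encNat (modules₃ (adj x) (w₁ x) (w₂ x) (u₁ x) (u₂ x) (w₃ x)))
      modules₃E = countClosedE vs {adj} {λ x → everything (adj x)} {λ x → adj x (w₁ x)} {λ x → adj x (w₁ x)}
        {λ x → cube₅ (adj x) (w₁ x) (w₂ x) (u₁ x) (u₂ x) (w₃ x)} adjE everythingSetE adj-w₁E adj-w₁E cube₅E true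

      module _ {u a b : Vertex} (uE : VertexE u) (aE : VertexE a) (bE : VertexE b) where

        private
          c₅ : ∀ x → Cube (n x)
          c₅ x = cube₅ (adj x) (w₁ x) (w₂ x) (u₁ x) (u₂ x) (w₃ x)

          nE : ∀ {v : Vertex} → VertexE v →
            Computes {Σ X (Fin ∘ n)} (λ (x , y) → cons (encFin y) (env x)) (λ (x , y) → encBool (adj x (v x) y))
          nE {v} f = relatedE {n = n ∘ proj₁} {adj ∘ proj₁} {v ∘ proj₁} {proj₂} (lift adjE) (lift f) v0

          c₇ : ∀ x → Cube (n x)
          c₇ x = refine true (λ y → not (adj x (u x) y)) _<F_ (refine true (adj x (u x)) _<F_ (c₅ x) (a x)) (b x)

          c₇E : Computes env (λ x → encCube (c₇ x))
          c₇E = firstE true {λ x y → not (adj x (u x) y)} {λ x → refine true (adj x (u x)) _<F_ (c₅ x) (a x)} {b} (notE (nE {u} uE))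
            (firstE true {λ x → adj x (u x)} {c₅} {a} (nE {u} uE) cube₅E aE) bE

          separateE : Computes env (λ x → encCube (separate (adj x) (u x) (a x) (b x) (c₅ x)))
          separateE = cubeE {n = n} {c = λ x → separate (adj x) (u x) (a x) (b x) (c₅ x)} λ e →
            setE vs {λ x → separate (adj x) (u x) (a x) (b x) (c₅ x) e}
              (orE (memberE {n = n ∘ proj₁} {λ (x , _) → c₇ x e} {proj₂} (lift (sideE {n = n} {c = c₇} e c₇E)) v0)
                (ifBoolE {enc = λ _ → encBool} (boolE e) (andE (earlierE {u} uE) (xorE (nE {a} aE) (nE {b} bE)))
                  (≡FE {n = n ∘ proj₁} {proj₂} {u ∘ proj₁} v0 (lift uE))))

        bimodulesE : Computes env (λ x → encNat (bimodules (adj x) (w₁ x) (w₂ x) (u₁ x) (u₂ x) (w₃ x) (u x) (a x) (b x)))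
        bimodulesE = countClosedE vs {adj} {λ x → adj x (u x)} {λ x → adj x (a x)} {λ x → adj x (b x)}
          {λ x → separate (adj x) (u x) (a x) (b x) (c₅ x)} adjE
          (rowE {n = n} {adj} {u} adjE uE) (rowE {n = n} {adj} {a} adjE aE) (rowE {n = n} {adj} {b} adjE bE) separateE false

module _ {X : Set} {env : X → Tree} {n : X → ℕ} (vs : Computes env (λ x → vertices (n x)))
  {adj : ∀ x → Relation (n x)} (adjE : Computes env (λ x → encMatrix (adj x))) where

  totalE : Computes env (λ x → encNat (total (adj x)))
  totalE =
    sumFinE {n = n} vs (
    sumFinE {n = n ∘ proj₁} (lift vs) (
    sumFinE {n = n ∘ proj₁ ∘ proj₁} (lift (lift vs)) (
    sumFinE {n = n ∘ proj₁ ∘ proj₁ ∘ proj₁} (lift (lift (lift vs))) (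
    addE (addE two two) (
    sumFinE {n = n ∘ proj₁ ∘ proj₁ ∘ proj₁ ∘ proj₁} (lift (lift (lift (lift vs)))) (
    addE three (
    sumFinE {n = n ∘ proj₁ ∘ proj₁ ∘ proj₁ ∘ proj₁ ∘ proj₁} (lift (lift (lift (lift (lift vs))))) (
    sumFinE {n = n ∘ proj₁ ∘ proj₁ ∘ proj₁ ∘ proj₁ ∘ proj₁ ∘ proj₁} (lift (lift (lift (lift (lift (lift vs)))))) (
    sumFinE {n = n ∘ proj₁ ∘ proj₁ ∘ proj₁ ∘ proj₁ ∘ proj₁ ∘ proj₁ ∘ proj₁} (lift (lift (lift (lift (lift (lift (lift vs))))))) (
    addE pairs pairs))))))))))
    where
    V : (Y : Set) → (Y → ℕ) → Set
    V Y m = Σ Y (Fin ∘ m)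
    X₄ X₅ X₈ : Set
    n₄ : X₄ → ℕ
    n₅ : X₅ → ℕ
    n₈ : X₈ → ℕ
    X₄ = V (V (V (V X n) (n ∘ proj₁)) (n ∘ proj₁ ∘ proj₁)) (n ∘ proj₁ ∘ proj₁ ∘ proj₁)
    n₄ = n ∘ proj₁ ∘ proj₁ ∘ proj₁ ∘ proj₁
    X₅ = V X₄ n₄
    n₅ = n₄ ∘ proj₁
    X₈ = V (V (V X₅ n₅) (n₅ ∘ proj₁)) (n₅ ∘ proj₁ ∘ proj₁)
    n₈ = n₅ ∘ proj₁ ∘ proj₁ ∘ proj₁
    env₄ : X₄ → Tree
    env₄ ((((x , w₁) , w₂) , u₁) , u₂) = cons (encFin u₂) (cons (encFin u₁) (cons (encFin w₂) (cons (encFin w₁) (env x))))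
    env₅ : X₅ → Tree
    env₅ (y , w₃) = cons (encFin w₃) (env₄ y)
    env₈ : X₈ → Tree
    env₈ (((y , u) , a) , b) = cons (encFin b) (cons (encFin a) (cons (encFin u) (env₅ y)))
    at₄ : ∀ {out : X → Tree} → Computes env out → Computes env₄ (out ∘ proj₁ ∘ proj₁ ∘ proj₁ ∘ proj₁)
    at₄ f = lift (lift (lift (lift f)))
    at₅ : ∀ {out : X₄ → Tree} → Computes env₄ out → Computes env₅ (out ∘ proj₁)
    at₅ = lift
    at₈ : ∀ {out : X₅ → Tree} → Computes env₅ out → Computes env₈ (out ∘ proj₁ ∘ proj₁ ∘ proj₁)
    at₈ f = lift (lift (lift f))
    w₁ w₂ u₁ u₂ : ∀ y → Fin (n₄ y)
    w₁ ((((_ , w₁) , _) , _) , _) = w₁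
    w₂ ((((_ , _) , w₂) , _) , _) = w₂
    u₁ ((((_ , _) , _) , u₁) , _) = u₁
    u₂ ((((_ , _) , _) , _) , u₂) = u₂
    w₁E : Computes env₄ (λ y → encFin (w₁ y))
    w₁E = lift (lift (lift v0))
    w₂E : Computes env₄ (λ y → encFin (w₂ y))
    w₂E = lift (lift v0)
    u₁E : Computes env₄ (λ y → encFin (u₁ y))
    u₁E = lift v0
    u₂E : Computes env₄ (λ y → encFin (u₂ y))
    u₂E = v0
    adj₄ : ∀ y → Relation (n₄ y)
    adj₄ = adj ∘ proj₁ ∘ proj₁ ∘ proj₁ ∘ proj₁
    two : Computes env₄ (λ y → encNat (modules₂ (adj₄ y) (w₁ y) (w₂ y) (u₁ y) (u₂ y)))
    two = modules₂E {n = n₄} (at₄ vs) {adj₄} (at₄ adjE) {w₁} {w₂} {u₁} {u₂} w₁E w₂E u₁E u₂E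
    three : Computes env₅ (λ (y , w₃) → encNat (modules₃ (adj₄ y) (w₁ y) (w₂ y) (u₁ y) (u₂ y) w₃))
    three = modules₃E {n = n₅} (at₅ (at₄ vs)) {adj₄ ∘ proj₁} (at₅ (at₄ adjE)) {w₁ ∘ proj₁} {w₂ ∘ proj₁} {u₁ ∘ proj₁} {u₂ ∘ proj₁}
      (at₅ w₁E) (at₅ w₂E) (at₅ u₁E) (at₅ u₂E) {proj₂} v0
    pairs : Computes env₈ (λ ((((y , w₃) , u) , a) , b) → encNat (bimodules (adj₄ y) (w₁ y) (w₂ y) (u₁ y) (u₂ y) w₃ u a b))
    pairs = bimodulesE {n = n₈} (at₈ (at₅ (at₄ vs))) {adj₄ ∘ π} (at₈ (at₅ (at₄ adjE))) {w₁ ∘ π} {w₂ ∘ π} {u₁ ∘ π} {u₂ ∘ π}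
      (at₈ (at₅ w₁E)) (at₈ (at₅ w₂E)) (at₈ (at₅ u₁E)) (at₈ (at₅ u₂E)) {λ ((((_ , w₃) , _) , _) , _) → w₃} (at₈ {λ (_ , w₃) → encFin w₃} v0)
      {λ (((_ , u) , _) , _) → u} {λ ((_ , a) , _) → a} {λ (_ , b) → b} (lift (lift v0)) (lift v0) v0
      where
      π : X₈ → X₄
      π (((( y , _) , _) , _) , _) = y

-- The input is only a matrix; its vertices are counted off along the rows.

range : ℕ → List ℕ
range zero    = []
range (suc k) = 0 ∷ map suc (range k)

opaque
  unfolding encList

  encList-map : ∀ {A B : Set} (enc : B → Tree) (f : A → B) l → encList enc (map f l) ≡ encList (enc ∘ f) l
  encList-map enc f []      = refl
  encList-map enc f (a ∷ l) = cong (cons (enc (f a))) (encList-map enc f l)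

range-vertices : ∀ n → encList encUnary (range n) ≡ vertices n
range-vertices n = trans (cong (encList encUnary) (range-toℕ n)) (encList-map encUnary toℕ (allFin n))
  where
  range-toℕ : ∀ n → range n ≡ map toℕ (allFin n)
  range-toℕ zero    = refl
  range-toℕ (suc n) = cong (0 ∷_) (begin
    map suc (range n)                 ≡⟨ cong (map suc) (range-toℕ n) ⟩
    map suc (map toℕ (allFin n))      ≡⟨ List.map-∘ (allFin n) ⟨
    map (toℕ ∘ suc) (allFin n)        ≡⟨ List.map-∘ (allFin n) ⟩
    map toℕ (map suc (allFin n))      ≡⟨ cong (map toℕ) (List.map-tabulate id suc) ⟩
    map toℕ (List.tabulate suc)            ∎)
    where open ≡-Reasoning

size-vertices : ∀ n → size (vertices n) ≤ 1 + n * (2 + n * 2)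
size-vertices n = size-encTable {n = n} {enc = encFin} {p = id} λ v →
  ≤-trans (size-encUnary (toℕ v)) (s≤s (*-monoˡ-≤ 2 (toℕ≤ v)))
  where
  toℕ≤ : ∀ {n} (v : Fin n) → toℕ v ≤ n
  toℕ≤ zero    = z≤n
  toℕ≤ (suc v) = s≤s (toℕ≤ v)

module _ {X : Set} {env : X → Tree} {n : X → ℕ} {adj : ∀ x → Relation (n x)} (adjE : Computes env (λ x → encMatrix (adj x))) where

  verticesE : Computes env (λ x → vertices (n x))
  verticesE = ≗E (λ x → trans (cong (encList encUnary) (rows (List.tabulate (adj x)))) (trans
        (cong (encList encUnary ∘ range) (List.length-tabulate (adj x))) (range-vertices (n x))))
    (foldrE {encA = λ _ → encSet} {L = λ x → List.tabulate (adj x)} (λ _ → encList encUnary) (λ _ → []) (λ _ _ l → 0 ∷ map suc l)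
      adjE []E (∷E {encA = λ _ → encUnary} zeroE (mapE {encA = λ _ → encUnary} {encB = λ _ → encUnary} (λ _ → suc) (wk v0) (sucE v0)))
      (con 1 ⊕ p ⊗ (con 2 ⊕ p ⊗ con 2))
      λ x l₁ l₂ eq → ≤-trans (≤-reflexive (cong size (trans (cong (encList encUnary) (rows l₂)) (range-vertices (length l₂)))))
        (≤-trans (size-vertices (length l₂)) (s≤s (let l≤ = suffixLength≤ {encA = λ _ → encSet} adjE x l₁ eq in *-mono-≤ l≤ (s≤s (s≤s (*-monoˡ-≤ 2 l≤)))))))
    where
    p = listPoly {encA = λ _ → encSet} adjE
    rows : ∀ {A : Set} (l : List A) → foldr (λ _ l → 0 ∷ map suc l) [] l ≡ range (length l)
    rows []      = refl
    rows (_ ∷ l) = cong (λ m → 0 ∷ map suc m) (rows l)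

-- The encoded graph and the final time bound

opaque
  unfolding encList encBool

  encodeVec-table : ∀ {n} {B : Set} (enc : B → Tree) (p : Fin n → B) → encodeVec enc (Vec.tabulate p) ≡ encTable enc p
  encodeVec-table {zero}  enc p = refl
  encodeVec-table {suc n} enc p = cong (cons (enc (p zero))) (encodeVec-table enc (p ∘ suc))

  encodeVec-matrix : ∀ {m n} (T : Fin m → Fin n → Bool) → encodeVec (encodeVec encodeBool) (Vec.tabulate λ u → Vec.tabulate (T u)) ≡ encTable encSet T
  encodeVec-matrix {zero}  T = refl
  encodeVec-matrix {suc m} T = cong₂ cons (encodeVec-table encodeBool (T zero)) (encodeVec-matrix (T ∘ suc))

computes-polyTime : ∀ {A B : Set} {encA : A → Tree} {encB : B → Tree} {f : A → B} → Computes encA (encB ∘ f) →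
  PolyTimeComputable encA encB f
computes-polyTime {encA = encA} {encB} {f} F = (0 , program) , a , k , λ x →
  let t , ran , t≤ = Timed.run timed-program x in
  encB (f x) Vec.∷ Vec.[] , t , ran , refl , ≤-trans t≤ (≤-trans (bound (size (encA x)))
    (≤-trans (*-monoʳ-≤ c (^-monoˡ-≤ k (+-mono-≤ (1≤size (encA x)) (≤-refl {size (encA x)}))))
    (≤-trans (≤-reflexive (shift (size (encA x)))) (m≤m+n _ a))))
  where
  V : Expr 1
  V = var zero
  program : Cmd 1
  program = (zero ≔ cons V nil) ⨾ code F ⨾ (zero ≔ hd V)
  timed-program : Timed (size ∘ encA) program encA (encB ∘ f)
  timed-program = assign-timed (smaller-bounded λ _ → ≤-refl) (λ _ → refl)
    ⨟ call-timed F id (cons-bounded (smaller-bounded λ _ → ≤-refl) (const-bounded nil))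
    ⨟ assign-timed (cons-bounded (call-bounded F id (smaller-bounded λ _ → ≤-refl)) (const-bounded nil)) (λ _ → refl)
  pb = poly-bound (Timed.timePoly timed-program)
  c = proj₁ pb
  k = proj₁ (proj₂ pb)
  bound = proj₂ (proj₂ pb)
  -- The required bound has the size m itself as base where `poly-bound` has 1 + m. Sizes are
  -- positive, so 1 + m is at most m + m, and the factor 2 is moved into the coefficient.
  a = c * 2 ^ k
  shift : ∀ m → c * (m + m) ^ k ≡ a * m ^ k
  shift m = trans (cong (λ j → c * j ^ k) (cong (m +_) (sym (+-identityʳ m)))) (trans (cong (c *_) (^-distribʳ-* k 2 m)) (sym (*-assoc c (2 ^ k) _)))

total-polyTime : {f : FiniteGraph → ℕ} → (∀ n (G : Graph n) → f (n , G) ≡ total (Graph.adj G)) →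
  PolyTimeComputable encodeGraph encodeℕ f
total-polyTime {f} eq = computes-polyTime {encB = encodeℕ} {f} (≗E (λ (n , G) → trans (encNat-encodeℕ _) (cong encodeℕ (sym (eq n G))))
  (totalE {n = proj₁} (verticesE {n = proj₁} {adjG} adjE) {adjG} adjE))
  where
  adjG : ∀ (x : FiniteGraph) → Relation (proj₁ x)
  adjG (_ , G) = Graph.adj G
  adjE : Computes encodeGraph (λ x → encMatrix (adjG x))
  adjE = ≗E (λ x → encodeVec-matrix (adjG x)) idE

-- Booleans as propositions

∨-elim : ∀ {a b} → a ∨ b ≡ true → a ≡ true ⊎ b ≡ true
∨-elim {true}  _  = inj₁ refl
∨-elim {false} eq = inj₂ eq

∨-introˡ : ∀ {a b} → a ≡ true → a ∨ b ≡ true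
∨-introˡ refl = refl

∨-introʳ : ∀ {a b} → b ≡ true → a ∨ b ≡ true
∨-introʳ {true}  refl = refl
∨-introʳ {false} refl = refl

∧-elim : ∀ {a b} → a ∧ b ≡ true → a ≡ true × b ≡ true
∧-elim {true} eq = refl , eq

∧-intro : ∀ {a b} → a ≡ true → b ≡ true → a ∧ b ≡ true
∧-intro refl refl = refl

not-elim : ∀ {a} → not a ≡ true → a ≡ false
not-elim {false} _ = refl

not-intro : ∀ {a} → a ≡ false → not a ≡ true
not-intro refl = refl

≡true? : ∀ b → Dec (b ≡ true)
≡true? b = b Bool.≟ true

false≢true : ∀ {b} → b ≡ false → b ≢ true
false≢true refl ()

¬true⇒false : ∀ {b} → b ≢ true → b ≡ false
¬true⇒false {false} _ = refl
¬true⇒false {true}  f = ⊥-elim (f refl)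

¬≡⇒≡not : ∀ {a b} → a ≢ b → a ≡ not b
¬≡⇒≡not {false} {false} f = ⊥-elim (f refl)
¬≡⇒≡not {false} {true}  f = refl
¬≡⇒≡not {true}  {false} f = refl
¬≡⇒≡not {true}  {true}  f = ⊥-elim (f refl)

xor-true : ∀ {a b} → a xor b ≡ true → a ≢ b
xor-true {false} {true}  _ ()
xor-true {true}  {false} _ ()

true-xor : ∀ {a b} → a ≢ b → a xor b ≡ true
true-xor {false} {false} f = ⊥-elim (f refl)
true-xor {false} {true}  f = refl
true-xor {true}  {false} f = refl
true-xor {true}  {true}  f = ⊥-elim (f refl)

xor-self : ∀ a → a xor a ≡ false
xor-self false = refl
xor-self true  = refl

xnor-true : ∀ {a b} → not (a xor b) ≡ true → a ≡ b
xnor-true {false} {false} _ = refl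
xnor-true {true}  {true}  _ = refl

any-elim : ∀ {n} (p : Fin n → Bool) → any p ≡ true → ∃ λ v → p v ≡ true
any-elim {suc n} p eq with ∨-elim {p zero} eq
... | inj₁ p0 = zero , p0
... | inj₂ ps = let v , pv = any-elim (p ∘ suc) ps in suc v , pv

any-intro : ∀ {n} (p : Fin n → Bool) v → p v ≡ true → any p ≡ true
any-intro p zero    pv = ∨-introˡ pv
any-intro p (suc v) pv = ∨-introʳ {p zero} (any-intro (p ∘ suc) v pv)

all-elim : ∀ {n} (p : Fin n → Bool) → all p ≡ true → ∀ v → p v ≡ true
all-elim p eq zero    = proj₁ (∧-elim {p zero} eq)
all-elim p eq (suc v) = all-elim (p ∘ suc) (proj₂ (∧-elim {p zero} eq)) v

all-intro : ∀ {n} (p : Fin n → Bool) → (∀ v → p v ≡ true) → all p ≡ true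
all-intro {zero}  p ps = refl
all-intro {suc n} p ps = ∧-intro (ps zero) (all-intro (p ∘ suc) (ps ∘ suc))

<ᵇ-elim : ∀ {i j} → (i <ᵇ j) ≡ true → i < j
<ᵇ-elim {i} {j} eq = <ᵇ⇒< i j (subst Bool.T (sym eq) _)

<ᵇ-intro : ∀ {i j} → i < j → (i <ᵇ j) ≡ true
<ᵇ-intro {zero}  {suc j} _       = refl
<ᵇ-intro {suc i} {suc j} (s≤s p) = <ᵇ-intro p

≡F-elim : ∀ {n} {v w : Fin n} → v ≡F w ≡ true → v ≡ w
≡F-elim {v = v} {w} eq with ∧-elim {not (v <F w)} eq
... | v≮w , w≮v = Fin.toℕ-injective (≤-antisym
  (≮⇒≥ λ w<v → false≢true (not-elim w≮v) (<ᵇ-intro w<v)) (≮⇒≥ λ v<w → false≢true (not-elim v≮w) (<ᵇ-intro v<w)))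

≡F-refl : ∀ {n} (v : Fin n) → v ≡F v ≡ true
≡F-refl v = ∧-intro v≮v v≮v
  where v≮v = not-intro (¬true⇒false λ eq → <-irrefl refl (<ᵇ-elim {toℕ v} eq))

-- Indicators and finite sums

𝟙 : ∀ {P : Set} → Dec P → ℕ
𝟙 (yes _) = 1
𝟙 (no _)  = 0

𝟙-cong : ∀ {P Q : Set} {p : Dec P} {q : Dec Q} → (P → Q) → (Q → P) → 𝟙 p ≡ 𝟙 q
𝟙-cong {p = yes p} {yes q} f g = refl
𝟙-cong {p = yes p} {no ¬q} f g = contradiction (f p) ¬q
𝟙-cong {p = no ¬p} {yes q} f g = contradiction (g q) ¬p
𝟙-cong {p = no ¬p} {no ¬q} f g = refl

𝟙-yes : ∀ {P : Set} (p : Dec P) → P → 𝟙 p ≡ 1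
𝟙-yes (yes _) _ = refl
𝟙-yes (no ¬p) p = contradiction p ¬p

𝟙-no : ∀ {P : Set} (p : Dec P) → ¬ P → 𝟙 p ≡ 0
𝟙-no (yes p) ¬p = contradiction p ¬p
𝟙-no (no _)  _  = refl

𝟙-× : ∀ {P Q : Set} (p : Dec P) (q : Dec Q) → 𝟙 (p ×-dec q) ≡ 𝟙 p * 𝟙 q
𝟙-× (yes _) (yes _) = refl
𝟙-× (yes _) (no _)  = refl
𝟙-× (no _)  _       = refl

𝟙-×-when : ∀ {P Q R : Set} {p : Dec P} {q : Dec Q} {r : Dec R} → (P → Q × R) → (Q → R → P) → 𝟙 p ≡ 𝟙 q * 𝟙 r
𝟙-×-when {p = p} {q} {r} f g = trans (𝟙-cong {q = q ×-dec r} f (λ (a , b) → g a b)) (𝟙-× q r)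

𝟙-*-cong : ∀ {P : Set} (p : Dec P) {m k} → (P → m ≡ k) → 𝟙 p * m ≡ 𝟙 p * k
𝟙-*-cong (yes p) eq = cong (1 *_) (eq p)
𝟙-*-cong (no _)  eq = refl

sumFin-cong : ∀ {n} {f g : Fin n → ℕ} → (∀ v → f v ≡ g v) → sumFin f ≡ sumFin g
sumFin-cong {zero}  eq = refl
sumFin-cong {suc n} eq = cong₂ _+_ (eq zero) (sumFin-cong (eq ∘ suc))

sumFin-0 : ∀ {n} {f : Fin n → ℕ} → (∀ v → f v ≡ 0) → sumFin f ≡ 0
sumFin-0 {zero}  eq = refl
sumFin-0 {suc n} eq = cong₂ _+_ (eq zero) (sumFin-0 (eq ∘ suc))

sumFin-*ˡ : ∀ {n} k (f : Fin n → ℕ) → sumFin (λ v → k * f v) ≡ k * sumFin f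
sumFin-*ˡ {zero}  k f = sym (*-zeroʳ k)
sumFin-*ˡ {suc n} k f = trans (cong (k * f zero +_) (sumFin-*ˡ k (f ∘ suc))) (sym (*-distribˡ-+ k (f zero) _))

sumFin-*ʳ : ∀ {n} k (f : Fin n → ℕ) → sumFin (λ v → f v * k) ≡ sumFin f * k
sumFin-*ʳ k f = trans (sumFin-cong (λ v → *-comm (f v) k)) (trans (sumFin-*ˡ k f) (*-comm k (sumFin f)))

sumFin-single : ∀ {n} {f : Fin n → ℕ} x → (∀ y → y ≢ x → f y ≡ 0) → sumFin f ≡ f x
sumFin-single {f = f} zero z = trans (cong (f zero +_) (sumFin-0 (λ v → z (suc v) λ ()))) (+-identityʳ _)
sumFin-single (suc x) z = trans (cong₂ _+_ (z zero λ ()) (sumFin-single x (λ y y≢x → z (suc y) (y≢x ∘ Fin.suc-injective)))) refl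

sumOver-allFin : ∀ {n} (f : Fin n → ℕ) → sumOver f (allFin n) ≡ sumFin f
sumOver-allFin f = foldr-allFin (λ v s → f v + s) 0

sumOver-map : ∀ {A B : Set} (f : B → ℕ) (h : A → B) l → sumOver f (map h l) ≡ sumOver (f ∘ h) l
sumOver-map f h []      = refl
sumOver-map f h (a ∷ l) = cong (f (h a) +_) (sumOver-map f h l)

sumOver-++ : ∀ {A : Set} (f : A → ℕ) l m → sumOver f (l ++ m) ≡ sumOver f l + sumOver f m
sumOver-++ f []      m = refl
sumOver-++ f (a ∷ l) m = trans (cong (f a +_) (sumOver-++ f l m)) (sym (+-assoc (f a) _ _))

sumOver-concatMap : ∀ {A B : Set} (f : B → ℕ) (h : A → List B) l → sumOver f (concatMap h l) ≡ sumOver (sumOver f ∘ h) l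
sumOver-concatMap f h []      = refl
sumOver-concatMap f h (a ∷ l) = trans (sumOver-++ f (h a) (concatMap h l)) (cong (sumOver f (h a) +_) (sumOver-concatMap f h l))

sumOver-cong : ∀ {A : Set} {f g : A → ℕ} {l} → All (λ a → f a ≡ g a) l → sumOver f l ≡ sumOver g l
sumOver-cong []       = refl
sumOver-cong (e ∷ es) = cong₂ _+_ e (sumOver-cong es)

sumS : ∀ {n} → (Subset n → ℕ) → ℕ
sumS {zero}  f = f []
sumS {suc n} f = sumS (f ∘ (false ∷_)) + sumS (f ∘ (true ∷_))

sumS-cong : ∀ {n} {f g : Subset n → ℕ} → (∀ W → f W ≡ g W) → sumS f ≡ sumS g
sumS-cong {zero}  eq = eq []
sumS-cong {suc n} eq = cong₂ _+_ (sumS-cong λ W → eq (false ∷ W)) (sumS-cong λ W → eq (true ∷ W))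

sumS-0 : ∀ {n} {f : Subset n → ℕ} → (∀ W → f W ≡ 0) → sumS f ≡ 0
sumS-0 {zero}  eq = eq []
sumS-0 {suc n} eq = cong₂ _+_ (sumS-0 λ W → eq (false ∷ W)) (sumS-0 λ W → eq (true ∷ W))

+-interchange : ∀ a b c d → (a + b) + (c + d) ≡ (a + c) + (b + d)
+-interchange = solve 4 (λ a b c d → (a :+ b) :+ (c :+ d) := (a :+ c) :+ (b :+ d)) refl
  where open +-*-Solver using (solve; _:+_; _:=_)

sumS-+ : ∀ {n} (f g : Subset n → ℕ) → sumS (λ W → f W + g W) ≡ sumS f + sumS g
sumS-+ {zero}  f g = refl
sumS-+ {suc n} f g = trans (cong₂ _+_ (sumS-+ (f ∘ (false ∷_)) (g ∘ (false ∷_))) (sumS-+ (f ∘ (true ∷_)) (g ∘ (true ∷_)))) (+-interchange (sumS (f ∘ (false ∷_))) _ _ _)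

sumS-*ˡ : ∀ {n} k (f : Subset n → ℕ) → sumS (λ W → k * f W) ≡ k * sumS f
sumS-*ˡ {zero}  k f = refl
sumS-*ˡ {suc n} k f = trans (cong₂ _+_ (sumS-*ˡ k (f ∘ (false ∷_))) (sumS-*ˡ k (f ∘ (true ∷_)))) (sym (*-distribˡ-+ k (sumS (f ∘ (false ∷_))) _))

sumS-sumFin : ∀ {n m} (f : Fin m → Subset n → ℕ) → sumFin (λ x → sumS (f x)) ≡ sumS (λ W → sumFin (λ x → f x W))
sumS-sumFin {n} {m = zero}  f = sym (sumS-0 {n} {λ _ → 0} λ _ → refl)
sumS-sumFin {m = suc m} f = trans (cong (sumS (f zero) +_) (sumS-sumFin (f ∘ suc))) (sym (sumS-+ (f zero) _))

sumS-sumOver : ∀ {n} {A : Set} (f : A → Subset n → ℕ) l → sumOver (λ a → sumS (f a)) l ≡ sumS (λ W → sumOver (λ a → f a W) l)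
sumS-sumOver {n} f []      = sym (sumS-0 {n} {λ _ → 0} λ _ → refl)
sumS-sumOver f (a ∷ l) = trans (cong (sumS (f a) +_) (sumS-sumOver f l)) (sym (sumS-+ (f a) _))

infixl 6 _△_
_△_ : ∀ {n} → Subset n → Subset n → Subset n
_△_ = Vec.zipWith _xor_

-- Symmetric difference with `C` permutes the subsets: each element of `C` swaps two halves of the
-- sum. It is used with a component and, for complementation, with the full set.
sumS-△ : ∀ {n} (C : Subset n) (f : Subset n → ℕ) → sumS (λ W → f (W △ C)) ≡ sumS f
sumS-△ []          f = refl
sumS-△ (false ∷ C) f = cong₂ _+_ (sumS-△ C (f ∘ (false ∷_))) (sumS-△ C (f ∘ (true ∷_)))
sumS-△ (true ∷ C)  f = trans (cong₂ _+_ (sumS-△ C (f ∘ (true ∷_))) (sumS-△ C (f ∘ (false ∷_)))) (+-comm (sumS (f ∘ (true ∷_))) _)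

lookup-△ : ∀ {n} (W C : Subset n) v → lookup (W △ C) v ≡ lookup W v xor lookup C v
lookup-△ W C v = Vec.lookup-zipWith _xor_ v W C

sumS-single : ∀ {n} {f : Subset n → ℕ} W₀ → (∀ W → W ≢ W₀ → f W ≡ 0) → sumS f ≡ f W₀
sumS-single []           z = refl
sumS-single (false ∷ W₀) z = trans (cong₂ _+_ (sumS-single W₀ (λ W ≢ → z (_ ∷ W) (≢ ∘ Vec.∷-injectiveʳ))) (sumS-0 λ W → z (true ∷ W) λ ())) (+-identityʳ _)
sumS-single (true ∷ W₀)  z = cong₂ _+_ (sumS-0 λ W → z (false ∷ W) λ ()) (sumS-single W₀ (λ W ≢ → z (_ ∷ W) (≢ ∘ Vec.∷-injectiveʳ)))

lookup-ext : ∀ {n} {V W : Subset n} → (∀ v → lookup V v ≡ lookup W v) → V ≡ W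
lookup-ext {V = []}    {[]}    eq = refl
lookup-ext {V = _ ∷ _} {_ ∷ _} eq = cong₂ _∷_ (eq zero) (lookup-ext (eq ∘ suc))

-- Closure of a relation

foldFin-preserves : ∀ {n} {S : Set} (I : S → Set) (f : Fin n → S → S) → (∀ k s → I s → I (f k s)) → ∀ {s} → I s → I (foldFin f s)
foldFin-preserves {zero}  I f pres i = i
foldFin-preserves {suc n} I f pres i = pres zero _ (foldFin-preserves I (f ∘ suc) (pres ∘ suc) i)

foldFin-establishes : ∀ {n} {S : Set} (P : Fin n → S → Set) (f : Fin n → S → S) →
  (∀ k s → P k (f k s)) → (∀ j k s → P k s → P k (f j s)) → ∀ k {s} → P k (foldFin f s)
foldFin-establishes P f est pres zero    = est zero _
foldFin-establishes P f est pres (suc k) =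
  pres zero (suc k) _ (foldFin-establishes (P ∘ suc) (f ∘ suc) (est ∘ suc) (λ j k → pres (suc j) (suc k)) k)

Closed : ∀ {n} → Relation n → Subset n → Set
Closed T W = ∀ w v → T w v ≡ true → lookup W w ≡ true → lookup W v ≡ true

module _ {n} (R : Relation n) where

  private
    step : Fin n → Relation n → Relation n
    step k T v w = T v w ∨ (T v k ∧ T k w)

    Through : Fin n → Relation n → Set
    Through k T = ∀ v w → T v k ≡ true → T k w ≡ true → T v w ≡ true

    through-step : ∀ k T → Through k (step k T)
    through-step k T v w vk kw = ∨-introʳ {T v w} (∧-intro (from vk) (to kw))
      where
      from : ∀ {v} → step k T v k ≡ true → T v k ≡ true
      from {v} eq = [ id , (λ e → proj₁ (∧-elim {T v k} e)) ] (∨-elim {T v k} eq)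
      to : ∀ {w} → step k T k w ≡ true → T k w ≡ true
      to {w} eq = [ id , (λ e → proj₂ (∧-elim {T k k} e)) ] (∨-elim {T k w} eq)

    through-preserved : ∀ j k T → Through k T → Through k (step j T)
    through-preserved j k T thr v w vk kw with ∨-elim {T v k} vk | ∨-elim {T k w} kw
    ... | inj₁ vk | inj₁ kw = ∨-introˡ (thr v w vk kw)
    ... | inj₁ vk | inj₂ kjw = let kj , jw = ∧-elim {T k j} kjw in ∨-introʳ {T v w} (∧-intro (thr v j vk kj) jw)
    ... | inj₂ vjk | inj₁ kw = let vj , jk = ∧-elim {T v j} vjk in ∨-introʳ {T v w} (∧-intro vj (thr j w jk kw))
    ... | inj₂ vjk | inj₂ kjw = ∨-introʳ {T v w} (∧-intro (proj₁ (∧-elim {T v j} vjk)) (proj₂ (∧-elim {T k j} kjw)))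

  -- Paths are avoided: round `k` makes the relation transitive through the middle vertex `k`, and
  -- every later round preserves this.
  closure-trans : ∀ {v k w} → closure R v k ≡ true → closure R k w ≡ true → closure R v w ≡ true
  closure-trans {v} {k} {w} = foldFin-establishes Through step through-step through-preserved k v w

  closure-⊇ : ∀ {v w} → R v w ≡ true → closure R v w ≡ true
  closure-⊇ {v} {w} eq = foldFin-preserves (λ T → T v w ≡ true) step (λ k T → ∨-introˡ) (∨-introˡ eq)

  closure-refl : ∀ v → closure R v v ≡ true
  closure-refl v = foldFin-preserves (λ T → T v v ≡ true) step (λ k T → ∨-introˡ) (∨-introʳ {R v v} (≡F-refl v))

  closed-closure : ∀ {W} → Closed R W → Closed (closure R) W
  closed-closure {W} closed = foldFin-preserves (λ T → Closed T W) step
    (λ k T clo w v eq w∈ → [ (λ wv → clo w v wv w∈) , (λ e → let wk , kv = ∧-elim {T w k} e in clo k v kv (clo w k wk w∈)) ] (∨-elim {T w v} eq))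
    (λ w v eq w∈ → [ (λ wv → closed w v wv w∈) , (λ w≡v → subst (λ x → lookup W x ≡ true) (≡F-elim w≡v) w∈) ] (∨-elim {R w v} eq))

  closure-closed : ∀ {W} → Closed (closure R) W → Closed R W
  closure-closed closed w v eq = closed w v (closure-⊇ eq)

-- Cubes and guesses

InCube : ∀ {n} → Cube n → Subset n → Set
InCube c W = ∀ e v → c e v ≡ true → lookup W v ≡ e

opaque

 inCube? : ∀ {n} (c : Cube n) W → Dec (InCube c W)
 inCube? c W = map′ (λ (t , f) → λ { true → t ; false → f }) (λ p → p true , p false) (side true ×-dec side false)
   where
   side : ∀ e → Dec (∀ v → c e v ≡ true → lookup W v ≡ e)
   side e = Fin.all? λ v → ≡true? (c e v) →-dec (lookup W v Bool.≟ e)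

 closed? : ∀ {n} (T : Relation n) W → Dec (Closed T W)
 closed? T W = Fin.all? λ w → Fin.all? λ v → ≡true? (T w v) →-dec (≡true? (lookup W w) →-dec ≡true? (lookup W v))

record StrictOrder {n} (before : Relation n) : Set where
  field
    irreflexive : ∀ {x} → before x x ≢ true
    transitive  : ∀ {x y z} → before x y ≡ true → before y z ≡ true → before x z ≡ true
    connected   : ∀ x y → x ≡ y ⊎ before x y ≡ true ⊎ before y x ≡ true

module _ {n} {before : Relation n} (order : StrictOrder before) where

  open StrictOrder order

  -- The map `f` is there for the induction, which runs over fewer and fewer vertices while the
  -- order remains that of all of them.
  least : ∀ {m} (f : Fin m → Fin n) {Q : Fin n → Set} (Q? : ∀ x → Dec (Q x)) → (∃ λ i → Q (f i)) →
    ∃ λ i → Q (f i) × (∀ j → Q (f j) → before (f j) (f i) ≢ true)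
  least {suc m} f {Q} Q? (i , Qi) with Fin.any? (λ j → Q? (f (suc j)))
  least f Q? (zero , Q0)  | no ¬tail = zero , Q0 , λ { zero _ → irreflexive ; (suc j) Qj _ → ¬tail (j , Qj) }
  least f Q? (suc i , Qi) | no ¬tail = contradiction (i , Qi) ¬tail
  least f {Q} Q? _        | yes tail with least (f ∘ suc) Q? tail
  ... | i , Qi , min with Q? (f zero) ×-dec ≡true? (before (f zero) (f (suc i)))
  ...   | yes (Q0 , 0<i) = zero , Q0 , λ { zero _ → irreflexive ; (suc j) Qj j<0 → min j Qj (transitive j<0 0<i) }
  ...   | no ¬0          = suc i , Qi , λ { zero Q0 0<i → ¬0 (Q0 , 0<i) ; (suc j) → min j }

  module _ {Q : Fin n → Set} (Q? : ∀ x → Dec (Q x)) where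

    Least : Fin n → Set
    Least x = Q x × (∀ y → before y x ≡ true → ¬ Q y)

    least? : ∀ x → Dec (Least x)
    least? x = Q? x ×-dec Fin.all? λ y → ≡true? (before y x) →-dec ¬? (Q? y)

    -- A least witness is unique when there is one. Through this identity existence conditions
    -- become sums over vertices without overcounting.
    sum-least : sumFin (λ x → 𝟙 (least? x)) ≡ 𝟙 (Fin.any? Q?)
    sum-least with Fin.any? Q?
    ... | no ¬Q = sumFin-0 λ x → 𝟙-no (least? x) λ (Qx , _) → ¬Q (x , Qx)
    ... | yes ∃Q with least id Q? ∃Q
    ...   | x , Qx , min = trans (sumFin-single x λ y y≢x → 𝟙-no (least? y) λ (Qy , miny) →
                             [ y≢x , [ min y Qy , (λ x<y → miny x x<y Qx) ] ] (connected y x))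
                           (𝟙-yes (least? x) (Qx , λ y y<x Qy → min y Qy y<x))

module _ {n} (d : Bool) (P : Fin n → Bool) (c : Cube n) (W : Subset n) where

  Hit : Fin n → Set
  Hit x = P x ≡ true × lookup W x ≡ d

  hit? : ∀ x → Dec (Hit x)
  hit? x = ≡true? (P x) ×-dec (lookup W x Bool.≟ d)

  refine-elim : ∀ {before x} → InCube (refine d P before c x) W →
    InCube c W × Hit x × (∀ y → before y x ≡ true → ¬ Hit y)
  refine-elim {before} {x} W∈ = (λ e y eq → W∈ e y (∨-introˡ eq)) , (Px , Wx) , λ y y<x (Py , Wy) →
      clash Wy (W∈ (not d) y (∨-introʳ {c (not d) y} (away (∨-introʳ {y ≡F x ∧ not (P y)} (∧-intro Py y<x)))))
    where
    clash : ∀ {b} → b ≡ d → b ≡ not d → ⊥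
    clash eq eq′ = Bool.not-¬ refl (trans (sym eq) eq′)
    away : ∀ {y b} → b ≡ true → (if not d xor d yes b no y ≡F x) ≡ true
    away eq rewrite true-xor {not d} {d} (λ e → Bool.not-¬ refl (sym e)) = eq
    Wx : lookup W x ≡ d
    Wx = W∈ d x (∨-introʳ {c d x} (subst (λ b → (if b yes _ no x ≡F x) ≡ true) (sym (xor-self d)) (≡F-refl x)))
    Px : P x ≡ true
    Px with P x in eq
    ... | true  = refl
    ... | false = ⊥-elim (clash Wx (W∈ (not d) x (∨-introʳ {c (not d) x}
                    (away (∨-introˡ (∧-intro (≡F-refl x) (not-intro eq)))))))

  refine-intro : ∀ {before x} → InCube c W → Hit x → (∀ y → before y x ≡ true → ¬ Hit y) →
    InCube (refine d P before c x) W
  refine-intro {before} {x} W∈ (Px , Wx) min e y eq with ∨-elim {c e y} eq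
  ... | inj₁ cey = W∈ e y cey
  ... | inj₂ new with e xor d in exd
  ...   | false = trans (cong (lookup W) (≡F-elim new)) (trans Wx (sym (xnor-true (not-intro exd))))
  ...   | true with ∨-elim {y ≡F x ∧ not (P y)} new
  ...     | inj₁ bad = let y≡x , ¬Py = ∧-elim {y ≡F x} bad in
                       ⊥-elim (false≢true (not-elim ¬Py) (trans (cong P (≡F-elim y≡x)) Px))
  ...     | inj₂ earlier = let Py , y<x = ∧-elim {P y} earlier in
                       trans (¬≡⇒≡not (λ Wy → min y y<x (Py , Wy))) (sym (¬≡⇒≡not (xor-true {e} exd)))

  exclude-elim : InCube (exclude d P c) W → InCube c W × (∀ y → ¬ Hit y)
  exclude-elim W∈ = (λ e y eq → W∈ e y (∨-introˡ eq)) , λ y (Py , Wy) →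
    Bool.not-¬ refl (trans (sym Wy) (W∈ (not d) y (∨-introʳ {c (not d) y}
      (∧-intro (true-xor {not d} {d} (λ e → Bool.not-¬ refl (sym e))) Py))))

  exclude-intro : InCube c W → (∀ y → ¬ Hit y) → InCube (exclude d P c) W
  exclude-intro W∈ none e y eq with ∨-elim {c e y} eq
  ... | inj₁ cey = W∈ e y cey
  ... | inj₂ new = let exd , Py = ∧-elim {e xor d} new in
                   trans (¬≡⇒≡not (λ Wy → none y (Py , Wy))) (sym (¬≡⇒≡not (xor-true {e} exd)))

  sum-refine : ∀ {before} → StrictOrder before →
    sumFin (λ x → 𝟙 (inCube? (refine d P before c x) W)) ≡ 𝟙 (inCube? c W) * 𝟙 (Fin.any? hit?)
  sum-refine {before} order = begin
    sumFin (λ x → 𝟙 (inCube? (refine d P before c x) W))     ≡⟨ sumFin-cong (λ x → 𝟙-×-when {q = inCube? c W} {r = least? order hit? x}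
      (λ W∈ → let c∈ , hit , min = refine-elim {before} W∈ in c∈ , hit , min) (λ c∈ (hit , min) → refine-intro {before} c∈ hit min)) ⟩
    sumFin (λ x → 𝟙 (inCube? c W) * 𝟙 (least? order hit? x)) ≡⟨ sumFin-*ˡ (𝟙 (inCube? c W)) (λ x → 𝟙 (least? order hit? x)) ⟩
    𝟙 (inCube? c W) * sumFin (λ x → 𝟙 (least? order hit? x)) ≡⟨ cong (𝟙 (inCube? c W) *_) (sum-least order hit?) ⟩
    𝟙 (inCube? c W) * 𝟙 (Fin.any? hit?)                      ∎
    where open ≡-Reasoning

  exclude-𝟙 : 𝟙 (inCube? (exclude d P c) W) ≡ 𝟙 (inCube? c W) * 𝟙 (¬? (Fin.any? hit?))
  exclude-𝟙 = 𝟙-×-when {q = inCube? c W} {r = ¬? (Fin.any? hit?)} (λ W∈ → let c∈ , none = exclude-elim W∈ in c∈ , λ (y , hit) → none y hit)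
    (λ c∈ none → exclude-intro c∈ λ y hit → none (y , hit))

  sum-guess : ∀ {before} → StrictOrder before → sumOver (λ c′ → 𝟙 (inCube? c′ W)) (guess d P before c) ≡ 𝟙 (inCube? c W)
  sum-guess {before} order = begin
    𝟙 (inCube? (exclude d P c) W) + sumOver (λ c′ → 𝟙 (inCube? c′ W)) (map (refine d P before c) (allFin n))
      ≡⟨ cong₂ _+_ exclude-𝟙 (trans (sumOver-map (λ c′ → 𝟙 (inCube? c′ W)) (refine d P before c) (allFin n)) (trans (sumOver-allFin (λ x → 𝟙 (inCube? (refine d P before c x) W))) (sum-refine order))) ⟩
    𝟙 (inCube? c W) * 𝟙 (¬? (Fin.any? hit?)) + 𝟙 (inCube? c W) * 𝟙 (Fin.any? hit?)
      ≡⟨ *-distribˡ-+ (𝟙 (inCube? c W)) _ _ ⟨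
    𝟙 (inCube? c W) * (𝟙 (¬? (Fin.any? hit?)) + 𝟙 (Fin.any? hit?))
      ≡⟨ cong (𝟙 (inCube? c W) *_) (excludedMiddle (Fin.any? hit?)) ⟩
    𝟙 (inCube? c W) * 1
      ≡⟨ *-identityʳ _ ⟩
    𝟙 (inCube? c W) ∎
    where
    open ≡-Reasoning
    excludedMiddle : ∀ {P : Set} (p : Dec P) → 𝟙 (¬? p) + 𝟙 p ≡ 1
    excludedMiddle (yes _) = refl
    excludedMiddle (no _)  = refl

-- Counting and scaling

count-mono : ∀ {n} {p q : Fin n → Bool} → (∀ v → p v ≡ true → q v ≡ true) → count p ≤ count q
count-mono {zero}  p⊆q = z≤n
count-mono {suc n} {p} {q} p⊆q with p zero in p0 | q zero in q0
... | false | false = count-mono (p⊆q ∘ suc)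
... | false | true  = ≤-trans (count-mono (p⊆q ∘ suc)) (n≤1+n _)
... | true  | true  = s≤s (count-mono (p⊆q ∘ suc))
... | true  | false = contradiction (p⊆q zero p0) (false≢true q0)

count-strict : ∀ {n} {p q : Fin n → Bool} → (∀ v → p v ≡ true → q v ≡ true) → ∀ v → p v ≡ false → q v ≡ true →
  count p < count q
count-strict {suc n} {p} {q} p⊆q zero pv qv rewrite pv | qv = s≤s (count-mono (p⊆q ∘ suc))
count-strict {suc n} {p} {q} p⊆q (suc v) pv qv with p zero in p0 | q zero in q0
... | false | false = count-strict (p⊆q ∘ suc) v pv qv
... | false | true  = ≤-trans (count-strict (p⊆q ∘ suc) v pv qv) (n≤1+n _)
... | true  | true  = s≤s (count-strict (p⊆q ∘ suc) v pv qv)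
... | true  | false = contradiction (p⊆q zero p0) (false≢true q0)

factor : Bool → ℕ
factor b = if b yes 2 no 1

factor-* : ∀ b k → (if b yes k + k no k) ≡ factor b * k
factor-* false k = sym (+-identityʳ k)
factor-* true  k = cong (k +_) (sym (+-identityʳ k))

module _ (q : Bool) where

  weigh : ∀ {n} → (Fin n → Bool) → ℕ
  weigh C = scale q C 1

  scale-* : ∀ {n} (C : Fin n → Bool) m → scale q C m ≡ weigh C * m
  scale-* {zero}  C m = sym (+-identityʳ m)
  scale-* {suc n} C m = begin
    (if b yes scale q C′ m + scale q C′ m no scale q C′ m) ≡⟨ factor-* b _ ⟩
    factor b * scale q C′ m                              ≡⟨ cong (factor b *_) (scale-* C′ m) ⟩
    factor b * (weigh C′ * m)                            ≡⟨ *-assoc (factor b) _ _ ⟨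
    factor b * weigh C′ * m                              ≡⟨ cong (_* m) (factor-* b (weigh C′)) ⟨
    weigh C * m                                          ∎
    where
    open ≡-Reasoning
    b = q ∧ C zero
    C′ = C ∘ suc

  weigh-cong : ∀ {n} {C D : Fin n → Bool} → (∀ v → C v ≡ D v) → weigh C ≡ weigh D
  weigh-cong {zero}  eq = refl
  weigh-cong {suc n} eq rewrite eq zero | weigh-cong (eq ∘ suc) = refl

  weigh>0 : ∀ {n} (C : Fin n → Bool) → 0 < weigh C
  weigh>0 {zero}  C = s≤s z≤n
  weigh>0 {suc n} C with q ∧ C zero
  ... | false = weigh>0 (C ∘ suc)
  ... | true  = ≤-trans (weigh>0 (C ∘ suc)) (m≤m+n _ _)

  -- For disjoint sets the symmetric difference is the union, and the weight is a product over
  -- elements.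
  weigh-xor : ∀ {n} (W C : Fin n → Bool) → (∀ v → C v ≡ true → W v ≡ false) → weigh (λ v → W v xor C v) ≡ weigh C * weigh W
  weigh-xor {zero}  W C disj = refl
  weigh-xor {suc n} W C disj = begin
    weigh (λ v → W v xor C v)
      ≡⟨ factor-* (q ∧ (W zero xor C zero)) _ ⟩
    factor (q ∧ (W zero xor C zero)) * weigh (λ v → W (suc v) xor C (suc v))
      ≡⟨ cong₂ _*_ (heads q (W zero) (C zero) (disj zero)) (weigh-xor (W ∘ suc) (C ∘ suc) (disj ∘ suc)) ⟩
    (factor (q ∧ C zero) * factor (q ∧ W zero)) * (weigh (C ∘ suc) * weigh (W ∘ suc))
      ≡⟨ solve 4 (λ a b c d → (a :* b) :* (c :* d) := (a :* c) :* (b :* d)) refl (factor (q ∧ C zero)) _ (weigh (C ∘ suc)) _ ⟩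
    (factor (q ∧ C zero) * weigh (C ∘ suc)) * (factor (q ∧ W zero) * weigh (W ∘ suc))
      ≡⟨ cong₂ _*_ (factor-* (q ∧ C zero) _) (factor-* (q ∧ W zero) _) ⟨
    weigh C * weigh W ∎
    where
    open ≡-Reasoning
    open +-*-Solver using (solve; _:*_; _:=_)
    heads : ∀ q w c → (c ≡ true → w ≡ false) → factor (q ∧ (w xor c)) ≡ factor (q ∧ c) * factor (q ∧ w)
    heads false w     c     _ = refl
    heads true  false false _ = refl
    heads true  false true  _ = refl
    heads true  true  false _ = refl
    heads true  true  true  d = contradiction (d refl) λ ()

-- The orders

natural-strict : ∀ {n} → StrictOrder {n} _<F_
natural-strict = record
  { irreflexive = λ {x} x<x → <-irrefl refl (<ᵇ-elim {toℕ x} x<x)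
  ; transitive  = λ {x} {y} {z} x<y y<z → <ᵇ-intro {toℕ x} {toℕ z} (<-trans (<ᵇ-elim {toℕ x} {toℕ y} x<y) (<ᵇ-elim {toℕ y} {toℕ z} y<z))
  ; connected   = λ x y → case-tri x y }
  where
  case-tri : ∀ {n} (x y : Fin n) → x ≡ y ⊎ x <F y ≡ true ⊎ y <F x ≡ true
  case-tri x y with <-cmp (toℕ x) (toℕ y)
  ... | tri< x<y _ _ = inj₂ (inj₁ (<ᵇ-intro x<y))
  ... | tri≈ _ x≡y _ = inj₁ (Fin.toℕ-injective x≡y)
  ... | tri> _ _ y<x = inj₂ (inj₂ (<ᵇ-intro y<x))

module _ {n} (T : Relation n) where

  private
    rank : Fin n → ℕ
    rank v = count (T v)

    Before : Fin n → Fin n → Set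
    Before v w = rank v < rank w ⊎ (rank v ≡ rank w × toℕ v < toℕ w)

    byRank-elim : ∀ {v w} → byRank T v w ≡ true → Before v w
    byRank-elim {v} {w} eq with ∨-elim {rank v <ᵇ rank w} eq
    ... | inj₁ lt = inj₁ (<ᵇ-elim lt)
    ... | inj₂ e with ∧-elim {not (rank w <ᵇ rank v)} e
    ...   | ≮ , v<w with m≤n⇒m<n∨m≡n (≮⇒≥ {rank w} {rank v} λ lt → false≢true (not-elim ≮) (<ᵇ-intro lt))
    ...     | inj₁ lt = inj₁ lt
    ...     | inj₂ eq′ = inj₂ (eq′ , <ᵇ-elim v<w)

    byRank-intro : ∀ {v w} → Before v w → byRank T v w ≡ true
    byRank-intro (inj₁ lt) = ∨-introˡ (<ᵇ-intro lt)
    byRank-intro {v} {w} (inj₂ (eq , v<w)) = ∨-introʳ {rank v <ᵇ rank w}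
      (∧-intro (not-intro (¬true⇒false λ lt → <-irrefl (sym eq) (<ᵇ-elim lt))) (<ᵇ-intro v<w))

  byRank-rank : ∀ {v w} → byRank T v w ≢ true → count (T w) ≤ count (T v)
  byRank-rank ¬v<w = ≮⇒≥ λ lt → ¬v<w (∨-introˡ (<ᵇ-intro lt))

  byRank-strict : StrictOrder (byRank T)
  byRank-strict = record
    { irreflexive = λ {x} eq → irr (byRank-elim {x} {x} eq)
    ; transitive  = λ {x} {y} {z} a b → byRank-intro (tr {x} {y} {z} (byRank-elim a) (byRank-elim b))
    ; connected   = conn }
    where
    irr : ∀ {x} → ¬ Before x x
    irr (inj₁ lt)       = <-irrefl refl lt
    irr (inj₂ (_ , lt)) = <-irrefl refl lt
    tr : ∀ {x y z} → Before x y → Before y z → Before x z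
    tr (inj₁ a)       (inj₁ b)       = inj₁ (<-trans a b)
    tr (inj₁ a)       (inj₂ (b , _)) = inj₁ (<-≤-trans a (≤-reflexive b))
    tr (inj₂ (a , _)) (inj₁ b)       = inj₁ (≤-<-trans (≤-reflexive a) b)
    tr (inj₂ (a , c)) (inj₂ (b , d)) = inj₂ (trans a b , <-trans c d)
    conn : ∀ x y → x ≡ y ⊎ byRank T x y ≡ true ⊎ byRank T y x ≡ true
    conn x y with <-cmp (rank x) (rank y)
    ... | tri< lt _ _ = inj₂ (inj₁ (byRank-intro (inj₁ lt)))
    ... | tri> _ _ gt = inj₂ (inj₂ (byRank-intro (inj₁ gt)))
    ... | tri≈ _ eq _ with <-cmp (toℕ x) (toℕ y)
    ...   | tri< lt _ _  = inj₂ (inj₁ (byRank-intro (inj₂ (eq , lt))))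
    ...   | tri≈ _ x≡y _ = inj₁ (Fin.toℕ-injective x≡y)
    ...   | tri> _ _ gt  = inj₂ (inj₂ (byRank-intro (inj₂ (sym eq , gt))))

flip-strict : ∀ {n} {before : Relation n} → StrictOrder before → StrictOrder (λ x y → before y x)
flip-strict o = record
  { irreflexive = irreflexive
  ; transitive  = λ a b → transitive b a
  ; connected   = λ x y → [ inj₁ , (λ { (inj₁ a) → inj₂ (inj₂ a) ; (inj₂ b) → inj₂ (inj₁ b) }) ] (connected x y) }
  where open StrictOrder o

-- Leaves

module _ {n} (T : Relation n) (q : Bool) where

  Sol : Cube n → Subset n → Set
  Sol c W = InCube c W × Closed T W

  sol? : ∀ c W → Dec (Sol c W)
  sol? c W = inCube? c W ×-dec closed? T W

  solutions : Cube n → ℕ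
  solutions c = sumS λ W → 𝟙 (sol? c W) * weigh q (lookup W)

  solutions-cong : ∀ {c d} → (∀ W → Sol c W → InCube d W) → (∀ W → Sol d W → InCube c W) → solutions c ≡ solutions d
  solutions-cong {c} {d} f g = sumS-cong λ W → cong (_* weigh q (lookup W))
    (𝟙-cong {p = sol? c W} {sol? d W} (λ s → f W s , proj₂ s) (λ s → g W s , proj₂ s))

cubeOf : ∀ {n} → (Fin n → Bool) → (Fin n → Bool) → Cube n
cubeOf I O true  = I
cubeOf I O false = O

module _ {n} (T : Relation n) (T-refl : ∀ v → T v v ≡ true)
  (T-trans : ∀ {u v w} → T u v ≡ true → T v w ≡ true → T u w ≡ true) (q : Bool) where

  module _ (I O : Fin n → Bool)
    (disjoint : ∀ v → I v ≡ true → O v ≡ true → ⊥)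
    (up : ∀ w v → T w v ≡ true → I w ≡ true → I v ≡ true) where

    -- When no vertex is left open, `I` is the only set in the cube, and `up` says that it is
    -- closed.
    determined : (∀ v → I v ∨ O v ≡ true) → solutions T q (cubeOf I O) ≡ weigh q I
    determined full = begin
      solutions T q (cubeOf I O)
        ≡⟨ sumS-single {f = λ W → 𝟙 (sol? T q (cubeOf I O) W) * weigh q (lookup W)} W₀ (λ W W≢ →
             cong (_* weigh q (lookup W)) (𝟙-no (sol? T q (cubeOf I O) W) λ (W∈ , _) → W≢ (lookup-ext (agree W W∈)))) ⟩
      𝟙 (sol? T q (cubeOf I O) W₀) * weigh q (lookup W₀)
        ≡⟨ cong₂ _*_ (𝟙-yes (sol? T q (cubeOf I O) W₀) sol₀) (weigh-cong q (Vec.lookup∘tabulate I)) ⟩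
      1 * weigh q I
        ≡⟨ *-identityˡ _ ⟩
      weigh q I ∎
      where
      open ≡-Reasoning
      W₀ = Vec.tabulate I
      at : ∀ v → lookup W₀ v ≡ I v
      at = Vec.lookup∘tabulate I
      agree : ∀ W → InCube (cubeOf I O) W → ∀ v → lookup W v ≡ lookup W₀ v
      agree W W∈ v with ∨-elim {I v} (full v)
      ... | inj₁ Iv = trans (W∈ true v Iv) (sym (trans (at v) Iv))
      ... | inj₂ Ov = trans (W∈ false v Ov) (sym (trans (at v) (¬true⇒false λ Iv → disjoint v Iv Ov)))
      sol₀ : Sol T q (cubeOf I O) W₀
      sol₀ = (λ { true v Iv → trans (at v) Iv ; false v Ov → trans (at v) (¬true⇒false λ Iv → disjoint v Iv Ov) }) ,
             λ w v wv w∈ → trans (at v) (up w v wv (trans (sym (at w)) w∈))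

    module _ (down : ∀ w v → T w v ≡ true → O v ≡ true → O w ≡ true)
      (symmetric : ∀ v w → I v ∨ O v ≡ false → I w ∨ O w ≡ false → T v w ≡ true → T w v ≡ true)
      (v : Fin n) (v-free : I v ∨ O v ≡ false) where

      private
        C : Fin n → Bool
        C w = T v w ∧ not (I w)

        O′ : Fin n → Bool
        O′ w = O w ∨ C w

        Cs : Subset n
        Cs = Vec.tabulate C

        Cv : C v ≡ true
        Cv = ∧-intro (T-refl v) (not-intro (¬true⇒false λ Iv → false≢true v-free (∨-introˡ Iv)))

        ¬Ov : O v ≢ true
        ¬Ov Ov = false≢true v-free (∨-introʳ {I v} Ov)

        C⇒¬O : ∀ {x} → C x ≡ true → O x ≢ true
        C⇒¬O {x} Cx Ox = ¬Ov (down v x (proj₁ (∧-elim Cx)) Ox)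

        C⇒¬I : ∀ {x} → C x ≡ true → I x ≢ true
        C⇒¬I {x} Cx = false≢true (not-elim (proj₂ (∧-elim {T v x} Cx)))

        free : ∀ {x} → I x ≢ true → O x ≢ true → I x ∨ O x ≡ false
        free {x} ¬I ¬O = ¬true⇒false λ eq → [ ¬I , ¬O ] (∨-elim {I x} eq)

        -- The set C is a component of the undetermined vertices.
        into-C : ∀ {w x} → I w ≢ true → O w ≢ true → T w x ≡ true → C x ≡ true → C w ≡ true
        into-C {w} {x} ¬Iw ¬Ow wx Cx = ∧-intro
          (T-trans (proj₁ (∧-elim {T v x} Cx)) (symmetric w x (free ¬Iw ¬Ow) (free (C⇒¬I Cx) (C⇒¬O Cx)) wx))
          (not-intro (¬true⇒false ¬Iw))

        △C : ∀ W x → lookup (W △ Cs) x ≡ lookup W x xor C x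
        △C W x = trans (lookup-△ W Cs x) (cong (lookup W x xor_) (Vec.lookup∘tabulate C x))

        out-elim : ∀ W → ¬ lookup W v ≡ true → Sol T q (cubeOf I O) W → InCube (cubeOf I O′) W
        out-elim W v∉ (W∈ , closed) true x Ix = W∈ true x Ix
        out-elim W v∉ (W∈ , closed) false x O′x with ∨-elim {O x} O′x
        ... | inj₁ Ox = W∈ false x Ox
        ... | inj₂ Cx = ¬true⇒false λ x∈ → v∉ (closed x v
          (symmetric v x v-free (free (C⇒¬I Cx) (C⇒¬O Cx)) (proj₁ (∧-elim Cx))) x∈)

        out-intro : ∀ W → Sol T q (cubeOf I O′) W → ¬ lookup W v ≡ true × Sol T q (cubeOf I O) W
        out-intro W (W∈ , closed) = false≢true (W∈ false v (∨-introʳ {O v} Cv)) ,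
          (λ { true x Ix → W∈ true x Ix ; false x Ox → W∈ false x (∨-introˡ Ox) }) , closed

        in-elim : ∀ W → lookup (W △ Cs) v ≡ true → Sol T q (cubeOf I O) (W △ Cs) → Sol T q (cubeOf I O′) W
        in-elim W v∈ (V∈ , closed) = cube , closed′
          where
          V = W △ Cs
          C⊆V : ∀ {x} → C x ≡ true → lookup V x ≡ true
          C⊆V {x} Cx = closed v x (proj₁ (∧-elim Cx)) v∈
          onC : ∀ {x} → C x ≡ true → lookup W x ≡ false
          onC {x} Cx with trans (sym (C⊆V Cx)) (△C W x)
          ... | eq rewrite Cx with lookup W x
          ...   | false = refl
          offC : ∀ {x} → C x ≡ false → lookup V x ≡ lookup W x
          offC {x} ¬Cx = trans (△C W x) (trans (cong (lookup W x xor_) ¬Cx) (Bool.xor-identityʳ _))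
          cube : InCube (cubeOf I O′) W
          cube true x Ix = trans (sym (offC (¬true⇒false λ Cx → C⇒¬I Cx Ix))) (V∈ true x Ix)
          cube false x O′x with ∨-elim {O x} O′x
          ... | inj₁ Ox = trans (sym (offC (¬true⇒false λ Cx → C⇒¬O Cx Ox))) (V∈ false x Ox)
          ... | inj₂ Cx = onC Cx
          closed′ : Closed T W
          -- A vertex of `V` that forces into `C` is not in `I`, since `I` is closed upwards and
          -- misses `C`, and not in `O`; so `into-C` puts it into `C`. Removing `C` thus breaks no
          -- forcing from the rest of `V`.
          closed′ w x wx w∈ with ≡true? (C w)
          ... | yes Cw = contradiction w∈ (false≢true (onC Cw))
          ... | no ¬Cw = trans (sym (offC (¬true⇒false λ Cx → ¬Cw (into-C
                 (λ Iw → C⇒¬I Cx (up w x wx Iw)) (λ Ow → false≢true (V∈ false w Ow) w∈V) wx Cx)))) (closed w x wx w∈V)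
            where
            w∈V : lookup V w ≡ true
            w∈V = trans (offC (¬true⇒false ¬Cw)) w∈

        in-intro : ∀ W → Sol T q (cubeOf I O′) W → lookup (W △ Cs) v ≡ true × Sol T q (cubeOf I O) (W △ Cs)
        in-intro W (W∈ , closed) = C⊆V Cv , cube , closed′
          where
          V = W △ Cs
          C⊆V : ∀ {x} → C x ≡ true → lookup V x ≡ true
          C⊆V {x} Cx = trans (△C W x) (cong₂ _xor_ (W∈ false x (∨-introʳ {O x} Cx)) Cx)
          offC : ∀ {x} → C x ≡ false → lookup V x ≡ lookup W x
          offC {x} ¬Cx = trans (△C W x) (trans (cong (lookup W x xor_) ¬Cx) (Bool.xor-identityʳ _))
          W⊆V : ∀ {x} → lookup W x ≡ true → lookup V x ≡ true
          W⊆V {x} x∈ = trans (offC (¬true⇒false λ Cx → false≢true (W∈ false x (∨-introʳ {O x} Cx)) x∈)) x∈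
          cube : InCube (cubeOf I O) V
          cube true x Ix = W⊆V (W∈ true x Ix)
          cube false x Ox = trans (offC (¬true⇒false λ Cx → C⇒¬O Cx Ox)) (W∈ false x (∨-introˡ Ox))
          closed′ : Closed T V
          closed′ w x wx w∈ with ≡true? (C w) | ≡true? (I x)
          ... | no ¬Cw | _      = W⊆V (closed w x wx (trans (sym (offC (¬true⇒false ¬Cw))) w∈))
          ... | yes _  | yes Ix = W⊆V (W∈ true x Ix)
          ... | yes Cw | no ¬Ix = C⊆V (∧-intro (T-trans (proj₁ (∧-elim Cw)) wx) (not-intro (¬true⇒false ¬Ix)))

      -- Solutions that avoid `v` avoid all of `C`, and those that contain `v` contain all of `C`.
      -- Taking the symmetric difference with `C` matches the second kind with the first, at the
      -- cost of the weight of `C`.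
      component : solutions T q (cubeOf I O) ≡ (1 + weigh q C) * solutions T q (cubeOf I O′)
      component = begin
        solutions T q (cubeOf I O)
          ≡⟨ sumS-cong (λ W → split (in? W) (g W)) ⟩
        sumS (λ W → 𝟙 (¬? (in? W)) * g W + 𝟙 (in? W) * g W)
          ≡⟨ sumS-+ (λ W → 𝟙 (¬? (in? W)) * g W) (λ W → 𝟙 (in? W) * g W) ⟩
        sumS (λ W → 𝟙 (¬? (in? W)) * g W) + sumS (λ W → 𝟙 (in? W) * g W)
          ≡⟨ cong (sumS (λ W → 𝟙 (¬? (in? W)) * g W) +_) (sumS-△ Cs (λ W → 𝟙 (in? W) * g W)) ⟨
        sumS (λ W → 𝟙 (¬? (in? W)) * g W) + sumS (λ W → 𝟙 (in? (W △ Cs)) * g (W △ Cs))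
          ≡⟨ cong₂ _+_ (sumS-cong out-part) (trans (sumS-cong in-part) (sumS-*ˡ (weigh q C) g′)) ⟩
        solutions T q (cubeOf I O′) + weigh q C * solutions T q (cubeOf I O′) ∎
        where
        open ≡-Reasoning
        in? : ∀ W → Dec (lookup W v ≡ true)
        in? W = ≡true? (lookup W v)
        g g′ : Subset n → ℕ
        g W = 𝟙 (sol? T q (cubeOf I O) W) * weigh q (lookup W)
        g′ W = 𝟙 (sol? T q (cubeOf I O′) W) * weigh q (lookup W)
        split : ∀ {P : Set} (p : Dec P) k → k ≡ 𝟙 (¬? p) * k + 𝟙 p * k
        split (yes _) k = sym (+-identityʳ k)
        split (no _)  k = sym (trans (+-identityʳ _) (+-identityʳ k))
        out-part : ∀ W → 𝟙 (¬? (in? W)) * g W ≡ g′ W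
        out-part W = trans (sym (*-assoc (𝟙 (¬? (in? W))) _ _)) (cong (_* weigh q (lookup W))
          (sym (𝟙-×-when {p = sol? T q (cubeOf I O′) W} {¬? (in? W)} {sol? T q (cubeOf I O) W}
            (out-intro W) (λ v∉ s → out-elim W v∉ s , proj₂ s))))
        in-part : ∀ W → 𝟙 (in? (W △ Cs)) * g (W △ Cs) ≡ weigh q C * g′ W
        in-part W = begin
          𝟙 (in? (W △ Cs)) * g (W △ Cs)
            ≡⟨ *-assoc (𝟙 (in? (W △ Cs))) _ _ ⟨
          𝟙 (in? (W △ Cs)) * 𝟙 (sol? T q (cubeOf I O) (W △ Cs)) * weigh q (lookup (W △ Cs))
            ≡⟨ cong (_* weigh q (lookup (W △ Cs))) (𝟙-×-when {p = sol? T q (cubeOf I O′) W} {in? (W △ Cs)} {sol? T q (cubeOf I O) (W △ Cs)}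
                 (in-intro W) (in-elim W)) ⟨
          𝟙 (sol? T q (cubeOf I O′) W) * weigh q (lookup (W △ Cs))
            ≡⟨ 𝟙-*-cong (sol? T q (cubeOf I O′) W) (λ (W∈ , _) → trans (weigh-cong q (△C W))
                 (weigh-xor q (lookup W) C λ x Cx → W∈ false x (∨-introʳ {O x} Cx))) ⟩
          𝟙 (sol? T q (cubeOf I O′) W) * (weigh q C * weigh q (lookup W))
            ≡⟨ solve 3 (λ a b c → a :* (b :* c) := b :* (a :* c)) refl (𝟙 (sol? T q (cubeOf I O′) W)) (weigh q C) _ ⟩
          weigh q C * g′ W ∎
          where open +-*-Solver using (solve; _:*_; _:=_)

  module _ (c : Cube n)
    (up : ∀ w v → T w v ≡ true → c true w ≡ true → c true v ≡ true)
    (down : ∀ w v → T w v ≡ true → c false v ≡ true → c false w ≡ true)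
    (symmetric : (∀ v → c true v ≡ true → c false v ≡ true → ⊥) →
      ∀ v w → c true v ∨ c false v ≡ false → c true w ∨ c false w ≡ false → T v w ≡ true → T w v ≡ true) where

    private
      I : Fin n → Bool
      I = c true

    module _ (disjoint : ∀ v → I v ≡ true → c false v ≡ true → ⊥) where

      private
        -- The count starts from the weight of `I`, which every solution contains, so this weight
        -- stands on the right of `balance`. At the end the one remaining solution has the same
        -- weight, and it cancels, being positive.
        record Invariant (s : (Fin n → Bool) × ℕ) : Set where
          field
            grown    : ∀ v → c false v ≡ true → proj₁ s v ≡ true
            disj     : ∀ v → I v ≡ true → proj₁ s v ≡ true → ⊥
            descends : ∀ w v → T w v ≡ true → proj₁ s v ≡ true → proj₁ s w ≡ true
            balance  : proj₂ s * solutions T q (cubeOf I (proj₁ s)) ≡ weigh q I * solutions T q (cubeOf I (c false))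

        still-symmetric : ∀ {O : Fin n → Bool} → (∀ v → c false v ≡ true → O v ≡ true) →
          ∀ v w → I v ∨ O v ≡ false → I w ∨ O w ≡ false → T v w ≡ true → T w v ≡ true
        still-symmetric {O} grown v w fv fw = symmetric disjoint v w (shrink fv) (shrink fw)
          where
          shrink : ∀ {v} → I v ∨ O v ≡ false → I v ∨ c false v ≡ false
          shrink {v} f = ¬true⇒false λ e → false≢true f ([ ∨-introˡ , (λ o → ∨-introʳ {I v} (grown v o)) ] (∨-elim {I v} e))

        step-invariant : ∀ v s → Invariant s → Invariant (eliminate q T I v s)
        step-invariant v s@(O , m) inv with I v ∨ O v in free
        ... | true  = inv
        ... | false = record
          { grown    = λ x e → ∨-introˡ (grown x e)
          ; disj     = λ x Ix e → [ disj x Ix , (λ Cx → false≢true (not-elim (proj₂ (∧-elim {T v x} Cx))) Ix) ] (∨-elim {O x} e)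
          ; descends = λ w x wx e → [ (λ Ox → ∨-introˡ (descends w x wx Ox)) , into w x wx ] (∨-elim {O x} e)
          ; balance  = begin
              (m + scale q C m) * S′       ≡⟨ cong (λ k → (m + k) * S′) (scale-* q C m) ⟩
              (m + weigh q C * m) * S′     ≡⟨ solve 3 (λ m k s → (m :+ k :* m) :* s := m :* ((con 1 :+ k) :* s)) refl m (weigh q C) S′ ⟩
              m * ((1 + weigh q C) * S′)   ≡⟨ cong (m *_) (component I O disj up descends (still-symmetric {O} grown) v free) ⟨
              m * solutions T q (cubeOf I O) ≡⟨ balance ⟩
              weigh q I * solutions T q (cubeOf I (c false)) ∎ }
          where
          open Invariant inv
          open ≡-Reasoning
          open +-*-Solver using (solve; _:*_; _:=_; _:+_; con)
          C : Fin n → Bool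
          C w = T v w ∧ not (I w)
          S′ = solutions T q (cubeOf I (λ w → O w ∨ C w))
          into : ∀ w x → T w x ≡ true → C x ≡ true → O w ∨ C w ≡ true
          into w x wx Cx with ≡true? (O w)
          ... | yes Ow = ∨-introˡ Ow
          ... | no ¬Ow = ∨-introʳ {O w} (∧-intro (T-trans (proj₁ (∧-elim {T v x} Cx)) (still-symmetric {O} grown w x
                    (¬true⇒false λ e → [ ¬Iw , ¬Ow ] (∨-elim {I w} e))
                    (¬true⇒false λ e → [ ¬Ix , (λ Ox → ¬Ow (descends w x wx Ox)) ] (∨-elim {I x} e)) wx))
                  (not-intro (¬true⇒false ¬Iw)))
            where
            ¬Ix : I x ≢ true
            ¬Ix = false≢true (not-elim (proj₂ (∧-elim {T v x} Cx)))
            ¬Iw : I w ≢ true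
            ¬Iw Iw = ¬Ix (up w x wx Iw)

        Settled : Fin n → (Fin n → Bool) × ℕ → Set
        Settled v (O , _) = I v ∨ O v ≡ true

        settled : ∀ v s → Settled v (eliminate q T I v s)
        settled v (O , m) with I v ∨ O v in free
        ... | true  = free
        ... | false = ∨-introʳ {I v} (∨-introʳ {O v} (∧-intro (T-refl v) (not-intro (¬true⇒false λ Iv → false≢true free (∨-introˡ Iv)))))

        stays-settled : ∀ u v s → Settled v s → Settled v (eliminate q T I u s)
        stays-settled u v (O , m) e with I u ∨ O u
        ... | true  = e
        ... | false = [ ∨-introˡ , (λ o → ∨-introʳ {I v} (∨-introˡ o)) ] (∨-elim {I v} e)

      eliminated : proj₂ (foldFin (eliminate q T I) (c false , scale q I 1)) ≡ solutions T q (cubeOf I (c false))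
      eliminated = *-cancelˡ-≡ _ _ (weigh q I) {{>-nonZero (weigh>0 q I)}} (begin
        weigh q I * proj₂ s                                    ≡⟨ *-comm (weigh q I) _ ⟩
        proj₂ s * weigh q I                                    ≡⟨ cong (proj₂ s *_) (determined I (proj₁ s) disj up
          (λ v → foldFin-establishes Settled (eliminate q T I) settled stays-settled v)) ⟨
        proj₂ s * solutions T q (cubeOf I (proj₁ s))           ≡⟨ balance ⟩
        weigh q I * solutions T q (cubeOf I (c false))         ∎)
        where
        open ≡-Reasoning
        s = foldFin (eliminate q T I) (c false , scale q I 1)
        start-invariant : Invariant (c false , scale q I 1)
        start-invariant = record { grown = λ _ → id ; disj = disjoint ; descends = down ; balance = refl }
        final-invariant : Invariant s
        final-invariant = foldFin-preserves Invariant (eliminate q T I) step-invariant start-invariant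
        open Invariant final-invariant

    -- An inconsistent cube contains no set. Symmetry of forcing is derived from the guesses for
    -- consistent cubes only, so that hypothesis is conditional and is invoked after the test.
    leaf′-correct : leaf′ q T c ≡ solutions T q c
    leaf′-correct with consistent c in con
    ... | true  = trans (eliminated λ v Iv Ov → false≢true (not-elim (all-elim _ con v)) (∧-intro Iv Ov))
      (solutions-cong T q (λ W (W∈ , _) → λ { true → W∈ true ; false → W∈ false }) (λ W (W∈ , _) → λ { true → W∈ true ; false → W∈ false }))
    ... | false = sym (sumS-0 λ W → cong (_* weigh q (lookup W)) (𝟙-no (sol? T q c W) λ (W∈ , _) →
      false≢true con (all-intro _ λ v → not-intro (¬true⇒false λ e → let Iv , Ov = ∧-elim {c true v} e in
        false≢true (W∈ false v Ov) (W∈ true v Iv)))))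

  propagate-⊇ : ∀ c e v → c e v ≡ true → propagate T c e v ≡ true
  propagate-⊇ c true  v cv = any-intro _ v (∧-intro cv (T-refl v))
  propagate-⊇ c false v cv = any-intro _ v (∧-intro cv (T-refl v))

  propagate-up : ∀ c w v → T w v ≡ true → propagate T c true w ≡ true → propagate T c true v ≡ true
  propagate-up c w v wv e = let x , cx = any-elim _ e ; a , b = ∧-elim {c true x} cx in
    any-intro _ x (∧-intro a (T-trans b wv))

  propagate-down : ∀ c w v → T w v ≡ true → propagate T c false v ≡ true → propagate T c false w ≡ true
  propagate-down c w v wv e = let x , cx = any-elim _ e ; a , b = ∧-elim {c false x} cx in
    any-intro _ x (∧-intro a (T-trans wv b))

  solutions-propagate : ∀ c → solutions T q (propagate T c) ≡ solutions T q c
  solutions-propagate c = solutions-cong T q (λ W (W∈ , _) e v cv → W∈ e v (propagate-⊇ c e v cv))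
    (λ { W (W∈ , closed) true v e → let x , cx = any-elim _ e ; a , b = ∧-elim {c true x} cx in closed x v b (W∈ true x a)
       ; W (W∈ , closed) false v e → let x , cx = any-elim _ e ; a , b = ∧-elim {c false x} cx in
           ¬true⇒false λ v∈ → false≢true (W∈ false x a) (closed v x b v∈) })

-- Guesses

infix 4 _⊆ᶜ_
_⊆ᶜ_ : ∀ {n} → Cube n → Cube n → Set
c ⊆ᶜ c′ = ∀ e v → c e v ≡ true → c′ e v ≡ true

-- The trace that a guess leaves in a cube, in a form that survives further restrictions
-- (`guessed-⊆`). A candidate `x` outside `P` is put on both sides, which shows up as an
-- inconsistency.
Guessed : ∀ {n} → Bool → (Fin n → Bool) → Relation n → Cube n → Set
Guessed d P before c = (∀ y → P y ≡ true → c (not d) y ≡ true)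
  ⊎ ∃ λ x → c d x ≡ true × (P x ≡ false → c (not d) x ≡ true) × (∀ y → P y ≡ true → before y x ≡ true → c (not d) y ≡ true)

guessed-⊆ : ∀ {n d P before} {c c′ : Cube n} → c ⊆ᶜ c′ → Guessed d P before c → Guessed d P before c′
guessed-⊆ sub (inj₁ a)               = inj₁ λ y Py → sub _ y (a y Py)
guessed-⊆ sub (inj₂ (x , a , b , f)) = inj₂ (x , sub _ x a , sub _ x ∘ b , λ y Py y<x → sub _ y (f y Py y<x))

guess-guessed : ∀ {n} d P before (c : Cube n) → All (λ c′ → c ⊆ᶜ c′ × Guessed d P before c′) (guess d P before c)
guess-guessed d P before c =
  ((λ _ _ → ∨-introˡ) , inj₁ λ y Py → ∨-introʳ {c (not d) y} (∧-intro notd-xor-d Py)) ∷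
  All.map⁺ (All.universal (λ x → (λ _ _ → ∨-introˡ) , inj₂ (x ,
    ∨-introʳ {c d x} (here-d x) ,
    (λ ¬Px → ∨-introʳ {c (not d) x} (away (∨-introˡ (∧-intro (≡F-refl x) (not-intro ¬Px))))) ,
    (λ y Py y<x → ∨-introʳ {c (not d) y} (away (∨-introʳ {y ≡F x ∧ not (P y)} (∧-intro Py y<x)))))) (allFin _))
  where
  notd-xor-d : not d xor d ≡ true
  notd-xor-d = true-xor {not d} {d} λ e → Bool.not-¬ refl (sym e)
  away : ∀ {b b′} → b ≡ true → (if not d xor d yes b no b′) ≡ true
  away eq rewrite notd-xor-d = eq
  here-d : ∀ x {b} → (if d xor d yes b no x ≡F x) ≡ true
  here-d x rewrite xor-self d = ≡F-refl x

module _ {n} (adj : Relation n) (adj-sym : ∀ v w → adj v w ≡ adj w v) (N s t : Fin n → Bool) where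

  private
    F T : Relation n
    F = forces adj N s t
    T = closure F

  order-strict : ∀ d → StrictOrder (order adj N s t d)
  order-strict true  = flip-strict (byRank-strict T)
  order-strict false = byRank-strict T

  AllGuessed : List (Bool × Bool × Bool × Bool) → Cube n → Set
  AllGuessed gs c = All (λ (d , k) → Guessed d (inClass adj N s t k) (order adj N s t d) c) gs

  cubes-guessed : ∀ gs c → All (AllGuessed gs) (cubes adj N s t gs c)
  cubes-guessed [] c = [] ∷ []
  cubes-guessed ((d , k) ∷ gs) c = All.concat⁺ (All.map⁺ (All.map (λ {c′} gd →
    All.map (λ (sub , g) → g ∷ All.map (guessed-⊆ sub) gd) (guess-guessed d (inClass adj N s t k) (order adj N s t d) c′))
    (cubes-guessed gs c)))

  sum-cubes : ∀ gs c W → sumOver (λ c′ → 𝟙 (inCube? c′ W)) (cubes adj N s t gs c) ≡ 𝟙 (inCube? c W)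
  sum-cubes [] c W = +-identityʳ _
  sum-cubes ((d , k) ∷ gs) c W = begin
    sumOver f (concatMap (guess d P before) (cubes adj N s t gs c)) ≡⟨ sumOver-concatMap f (guess d P before) (cubes adj N s t gs c) ⟩
    sumOver (sumOver f ∘ guess d P before) (cubes adj N s t gs c)   ≡⟨ sumOver-cong (All.universal (λ c′ → sum-guess d P c′ W (order-strict d)) (cubes adj N s t gs c)) ⟩
    sumOver f (cubes adj N s t gs c)                                ≡⟨ sum-cubes gs c W ⟩
    𝟙 (inCube? c W)                                                 ∎
    where
    open ≡-Reasoning
    f : Cube n → ℕ
    f c′ = 𝟙 (inCube? c′ W)
    P = inClass adj N s t k
    before = order adj N s t d

  allGuesses-complete : ∀ g → g ∈ˡ allGuesses
  allGuesses-complete (d , i , j , k) = ∈-cartesianProduct⁺ (bool d) (∈-cartesianProduct⁺ (bool i) (∈-cartesianProduct⁺ (bool j) (bool k)))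
    where
    bool : ∀ b → b ∈ˡ (true ∷ false ∷ [])
    bool true  = Any.here refl
    bool false = Any.there (Any.here refl)

  module _ (c : Cube n) (guessed : AllGuessed (allGuesses) c) where

    private
      c′ : Cube n
      c′ = propagate T c

      T-refl = closure-refl F
      T-trans = λ {u} {v} {w} → closure-trans F {u} {v} {w}

      ⊇ : c ⊆ᶜ c′
      ⊇ = propagate-⊇ T T-refl T-trans true c

      up = propagate-up T T-refl T-trans true c
      down = propagate-down T T-refl T-trans true c

    module _ (disjoint : ∀ v → c′ true v ≡ true → c′ false v ≡ true → ⊥) where

      private
        module Free {v} (free : c′ true v ∨ c′ false v ≡ false) where
          ¬in : c′ true v ≢ true
          ¬in e = false≢true free (∨-introˡ e)
          ¬out : c′ false v ≢ true
          ¬out e = false≢true free (∨-introʳ {c′ true v} e)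

        class : Fin n → Bool × Bool × Bool
        class v = N v , s v , t v

        inClass-self : ∀ v → inClass adj N s t (class v) v ≡ true
        inClass-self v = ∧-intro (not-intro (xor-self (N v))) (∧-intro (not-intro (xor-self (s v))) (not-intro (xor-self (t v))))

        inClass-elim : ∀ v x → inClass adj N s t (class v) x ≡ true → N x ≡ N v × s x ≡ s v × t x ≡ t v
        inClass-elim v x e with ∧-elim {not (N x xor N v)} e
        ... | a , bc with ∧-elim {not (s x xor s v)} bc
        ...   | b , c = xnor-true a , xnor-true b , xnor-true c

        -- Whether exactly one of two vertices forces the other depends only on their classes.
        comparable : ∀ {v w} → F v w ≡ true → F w v ≢ true → ∀ x → inClass adj N s t (class v) x ≡ true →
          F x w ≡ true ⊎ F w x ≡ true
        comparable {v} {w} vw ¬wv x xv with ≡true? (F x w) | ≡true? (F w x)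
        ... | yes a | _     = inj₁ a
        ... | no _  | yes b = inj₂ b
        ... | no ¬a | no ¬b = ⊥-elim (differ (trans (sym (same ¬a′)) (trans (adj-sym w x) (same ¬b′))))
          where
          eqs = inClass-elim v x xv
          xw : Bool
          xw = if N v yes s w no t w
          wx : Bool
          wx = if N w yes s v no t v
          differ : xw ≢ wx
          differ e = ¬wv (trans (cong₂ _xor_ (adj-sym v w) (sym e)) vw)
          same : ∀ {a b} → a xor b ≢ true → a ≡ b
          same {a} {b} ¬e = xnor-true (not-intro (¬true⇒false ¬e))
          ¬a′ : adj w x xor xw ≢ true
          ¬a′ e = ¬a (trans (cong (λ b → adj w x xor (if b yes s w no t w)) (proj₁ eqs)) e)
          ¬b′ : adj x w xor wx ≢ true
          ¬b′ e = ¬b (trans (cong₂ (λ a b → adj x w xor (if N w yes a no b)) (proj₁ (proj₂ eqs)) (proj₂ (proj₂ eqs))) e)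

      -- Let `x₀` inside and `x₁` outside be the guesses in the class of `v`. Both are comparable to
      -- `w`, and as `w` is undetermined, `w` forces `x₀` and `x₁` forces `w`, never conversely even
      -- indirectly. So the rank of `x₀` is below that of `w`, which is below that of `x₁`. But `v`
      -- belongs to the class and is undetermined too, so its rank is at most that of `x₀` and at
      -- least that of `x₁`. If a guess says instead that its side has no element of the class, then
      -- `v` is determined.
      direct : ∀ v w → c′ true v ∨ c′ false v ≡ false → c′ true w ∨ c′ false w ≡ false → F v w ≡ true → F w v ≡ true
      direct v w fv fw vw with ≡true? (F w v)
      ... | yes wv = wv
      ... | no ¬wv = ⊥-elim (analyse (All.lookup guessed (allGuesses-complete (true , class v))) (All.lookup guessed (allGuesses-complete (false , class v))))
        where
        open Free {v} fv renaming (¬in to ¬Iv; ¬out to ¬Ov)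
        open Free {w} fw renaming (¬in to ¬Iw; ¬out to ¬Ow)
        P = inClass adj N s t (class v)
        belongs : ∀ {x} e → c e x ≡ true → (P x ≡ false → c (not e) x ≡ true) → P x ≡ true
        belongs {x} e cx miss with P x in eq
        ... | true  = refl
        belongs {x} true  cx miss | false = ⊥-elim (disjoint x (⊇ true x cx) (⊇ false x (miss refl)))
        belongs {x} false cx miss | false = ⊥-elim (disjoint x (⊇ true x (miss refl)) (⊇ false x cx))
        smaller : ∀ {x y} → T x y ≡ true → T y x ≢ true → count (T y) < count (T x)
        smaller {x} {y} xy ¬yx = count-strict (λ z yz → T-trans {x} {y} {z} xy yz) x (¬true⇒false ¬yx) (T-refl x)
        analyse : Guessed true P (order adj N s t true) c → Guessed false P (order adj N s t false) c → ⊥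
        analyse (inj₁ a) _ = ¬Ov (⊇ false v (a v (inClass-self v)))
        analyse _ (inj₁ a) = ¬Iv (⊇ true v (a v (inClass-self v)))
        analyse (inj₂ (x₀ , in₀ , miss₀ , max)) (inj₂ (x₁ , out₁ , miss₁ , min)) =
          <-irrefl refl (<-≤-trans (<-trans (smaller wx₀ ¬x₀w) (smaller x₁w ¬wx₁)) (≤-trans
            (byRank-rank T λ lt → ¬Iv (⊇ true v (min v (inClass-self v) lt)))
            (byRank-rank T λ lt → ¬Ov (⊇ false v (max v (inClass-self v) lt)))))
          where
          ¬x₀w : T x₀ w ≢ true
          ¬x₀w e = ¬Iw (up x₀ w e (⊇ true x₀ in₀))
          wx₀ : T w x₀ ≡ true
          wx₀ = [ (λ e → ⊥-elim (¬x₀w (closure-⊇ F e))) , closure-⊇ F ] (comparable {v} {w} vw ¬wv x₀ (belongs true in₀ miss₀))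
          ¬wx₁ : T w x₁ ≢ true
          ¬wx₁ e = ¬Ow (down w x₁ e (⊇ false x₁ out₁))
          x₁w : T x₁ w ≡ true
          x₁w = [ closure-⊇ F , (λ e → ⊥-elim (¬wx₁ (closure-⊇ F e))) ] (comparable {v} {w} vw ¬wv x₁ (belongs false out₁ miss₁))

      -- The classes control direct forcing only. To pass to the closure, let `S` consist of the
      -- vertices inside together with those that reach `v` and are not outside. By `direct` it is
      -- closed under `F`, hence under `T`; it contains `v`, so it contains `w`, which is
      -- undetermined and must therefore reach `v`.
      symmetric : ∀ v w → c′ true v ∨ c′ false v ≡ false → c′ true w ∨ c′ false w ≡ false → T v w ≡ true → T w v ≡ true
      symmetric v w fv fw vw = [ (λ Iw → ⊥-elim (Free.¬in {w} fw Iw)) , (λ e → proj₂ (∧-elim {not (c′ false w)} e)) ]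
        (∨-elim {c′ true w} (trans (sym (at w)) (closed-closure F {S} S-closed v w vw
          (trans (at v) (∨-introʳ {c′ true v} (∧-intro (not-intro (¬true⇒false (Free.¬out {v} fv))) (T-refl v)))))))
        where
        S : Subset n
        S = Vec.tabulate λ x → c′ true x ∨ (not (c′ false x) ∧ T x v)
        at : ∀ x → lookup S x ≡ c′ true x ∨ (not (c′ false x) ∧ T x v)
        at = Vec.lookup∘tabulate _
        S-closed : Closed F S
        S-closed x y xy x∈ with ≡true? (c′ true y) | ∨-elim {c′ true x} (trans (sym (at x)) x∈)
        ... | yes Iy | _       = trans (at y) (∨-introˡ Iy)
        ... | no ¬Iy | inj₁ Ix = contradiction (up x y (closure-⊇ F xy) Ix) ¬Iy
        ... | no ¬Iy | inj₂ e with ∧-elim {not (c′ false x)} e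
        ...   | ¬Ox , xv = trans (at y) (∨-introʳ {c′ true y} (∧-intro (not-intro (¬true⇒false ¬Oy)) (T-trans {y} {x} {v} (closure-⊇ F
              (direct x y (¬true⇒false λ e → [ (λ Ix → ¬Iy (up x y (closure-⊇ F xy) Ix)) , false≢true (not-elim ¬Ox) ] (∨-elim {c′ true x} e))
                          (¬true⇒false λ e → [ ¬Iy , ¬Oy ] (∨-elim {c′ true y} e)) xy)) xv)))
          where
          ¬Oy : c′ false y ≢ true
          ¬Oy Oy = false≢true (not-elim ¬Ox) (down x y (closure-⊇ F xy) Oy)

    leaf-correct : ∀ q → leaf q T c ≡ solutions T q c
    leaf-correct q = trans (leaf′-correct T T-refl T-trans q c′ up down symmetric) (solutions-propagate T T-refl T-trans q c)

  -- The cubes partition `c` by `sum-cubes`, and on each of them the recorded guesses make `leaf`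
  -- exact.
  solutions-cubes : ∀ q c → countClosed adj N s t q c ≡ solutions T q c
  solutions-cubes q c = begin
    sumOver (leaf q T) (cubes adj N s t gs c)
      ≡⟨ sumOver-cong (All.map (λ {c′} g → leaf-correct c′ g q) (cubes-guessed gs c)) ⟩
    sumOver (solutions T q) (cubes adj N s t gs c)
      ≡⟨ sumS-sumOver (λ c′ W → 𝟙 (sol? T q c′ W) * weigh q (lookup W)) (cubes adj N s t gs c) ⟩
    sumS (λ W → sumOver (λ c′ → 𝟙 (sol? T q c′ W) * weigh q (lookup W)) (cubes adj N s t gs c))
      ≡⟨ sumS-cong (λ W → trans (sumOver-cong (All.universal (λ c′ → cong (_* weigh q (lookup W)) (𝟙-× (inCube? c′ W) (closed? T W))) (cubes adj N s t gs c)))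
           (trans (factor-out W (cubes adj N s t gs c)) (cong (λ k → k * 𝟙 (closed? T W) * weigh q (lookup W)) (sum-cubes gs c W)))) ⟩
    sumS (λ W → 𝟙 (inCube? c W) * 𝟙 (closed? T W) * weigh q (lookup W))
      ≡⟨ sumS-cong (λ W → cong (_* weigh q (lookup W)) (𝟙-× (inCube? c W) (closed? T W))) ⟨
    solutions T q c ∎
    where
    open ≡-Reasoning
    gs = allGuesses
    factor-out : ∀ W l → sumOver (λ c′ → 𝟙 (inCube? c′ W) * 𝟙 (closed? T W) * weigh q (lookup W)) l
      ≡ sumOver (λ c′ → 𝟙 (inCube? c′ W)) l * 𝟙 (closed? T W) * weigh q (lookup W)
    factor-out W []      = refl
    factor-out W (c′ ∷ l) = trans (cong (𝟙 (inCube? c′ W) * 𝟙 (closed? T W) * weigh q (lookup W) +_) (factor-out W l))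
      (solve 4 (λ a b x w → a :* x :* w :+ b :* x :* w := (a :+ b) :* x :* w) refl (𝟙 (inCube? c′ W)) _ (𝟙 (closed? T W)) (weigh q (lookup W)))
      where open +-*-Solver using (solve; _:*_; _:=_; _:+_)

  countClosed-correct : ∀ q c → countClosed adj N s t q c ≡ solutions F q c
  countClosed-correct q c = trans (solutions-cubes q c) (sumS-cong λ W → cong (_* weigh q (lookup W))
    (𝟙-cong {p = sol? T q c W} {sol? F q c W} (λ (a , b) → a , closure-closed F {W} b) (λ (a , b) → a , closed-closure F {W} b)))

infix 4 _≟ₛ_
_≟ₛ_ : ∀ {n} (V W : Subset n) → Dec (V ≡ W)
_≟ₛ_ = Vec.≡-dec Bool._≟_

-- Reduction to sums over subsets

length-filter : ∀ {A : Set} {P : A → Set} (P? : ∀ a → Dec (P a)) l → length (filter P? l) ≡ sumOver (λ a → 𝟙 (P? a)) l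
length-filter P? [] = refl
length-filter P? (a ∷ l) with P? a
... | yes _ = cong suc (length-filter P? l)
... | no _  = length-filter P? l

sumOver-cartesianProduct : ∀ {A B : Set} (f : A × B → ℕ) xs ys →
  sumOver f (cartesianProduct xs ys) ≡ sumOver (λ x → sumOver (λ y → f (x , y)) ys) xs
sumOver-cartesianProduct f []       ys = refl
sumOver-cartesianProduct f (x ∷ xs) ys = trans (sumOver-++ f (map (x ,_) ys) _)
  (cong₂ _+_ (sumOver-map f (x ,_) ys) (sumOver-cartesianProduct f xs ys))

sumOver-subsets : ∀ n (f : Subset n → ℕ) → sumOver f (subsets n) ≡ sumS f
sumOver-subsets zero    f = +-identityʳ _
sumOver-subsets (suc n) f = trans (sumOver-++ f (map (false ∷_) (subsets n)) _) (cong₂ _+_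
  (trans (sumOver-map f (false ∷_) (subsets n)) (sumOver-subsets n (f ∘ (false ∷_))))
  (trans (sumOver-map f (true ∷_) (subsets n)) (sumOver-subsets n (f ∘ (true ∷_)))))

-- Sets with at least two or three elements

module _ {n : ℕ} (Q : Fin n → Set) where

  Two : Set
  Two = ∃ λ x → ∃ λ y → x ≢ y × Q x × Q y

  Three : Set
  Three = ∃ λ x → ∃ λ y → ∃ λ z → x ≢ y × x ≢ z × y ≢ z × Q x × Q y × Q z

  module _ (Q? : ∀ x → Dec (Q x)) where

    opaque
     two? : Dec Two
     two? = Fin.any? λ x → Fin.any? λ y → ¬? (x Fin.≟ y) ×-dec (Q? x ×-dec Q? y)

    opaque
     three? : Dec Three
     three? = Fin.any? λ x → Fin.any? λ y → Fin.any? λ z →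
       ¬? (x Fin.≟ y) ×-dec (¬? (x Fin.≟ z) ×-dec (¬? (y Fin.≟ z) ×-dec (Q? x ×-dec (Q? y ×-dec Q? z))))

  another : ∀ {a} → Two → ∃ λ x → x ≢ a × Q x
  another {a} (x , y , x≢y , Qx , Qy) with x Fin.≟ a
  ... | no x≢a   = x , x≢a , Qx
  ... | yes refl = y , x≢y ∘ sym , Qy

  third : ∀ {a b} → Three → ∃ λ x → x ≢ a × x ≢ b × Q x
  third {a} {b} (x , y , z , x≢y , x≢z , y≢z , Qx , Qy , Qz) with x Fin.≟ a | x Fin.≟ b
  ... | no x≢a | no x≢b = x , x≢a , x≢b , Qx
  ... | yes refl | _ with y Fin.≟ b
  ...   | no y≢b   = y , x≢y ∘ sym , y≢b , Qy
  ...   | yes refl = z , x≢z ∘ sym , y≢z ∘ sym , Qz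
  third {a} {b} (x , y , z , x≢y , x≢z , y≢z , Qx , Qy , Qz) | no _ | yes refl with y Fin.≟ a
  ...   | no y≢a   = y , y≢a , x≢y ∘ sym , Qy
  ...   | yes refl = z , y≢z ∘ sym , x≢z ∘ sym , Qz

∈-false : ∀ {n} (W : Subset n) → ∣ W ∣ ≡ 0 → ∀ x → lookup W x ≢ true
∈-false (false ∷ W) e (suc x) = ∈-false W e x

∣∣-positive : ∀ {n} (W : Subset n) {x} → lookup W x ≡ true → 1 ≤ ∣ W ∣
∣∣-positive W {x} x∈ = n≢0⇒n>0 λ e → ∈-false W e x x∈

∣∣-element : ∀ {n} (W : Subset n) → 1 ≤ ∣ W ∣ → ∃ λ x → lookup W x ≡ true
∣∣-element (true ∷ W)  _ = zero , refl
∣∣-element (false ∷ W) p = let x , x∈ = ∣∣-element W p in suc x , x∈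

two-elim : ∀ {n} (W : Subset n) → 2 ≤ ∣ W ∣ → Two (λ x → lookup W x ≡ true)
two-elim (true ∷ W)  (s≤s p) = let x , x∈ = ∣∣-element W p in zero , suc x , (λ ()) , refl , x∈
two-elim (false ∷ W) p = let x , y , x≢y , x∈ , y∈ = two-elim W p in suc x , suc y , x≢y ∘ Fin.suc-injective , x∈ , y∈

two-intro : ∀ {n} (W : Subset n) → Two (λ x → lookup W x ≡ true) → 2 ≤ ∣ W ∣
two-intro W (zero , zero , x≢y , _) = contradiction refl x≢y
two-intro (true ∷ W)  (zero , suc y , _ , _ , y∈) = s≤s (∣∣-positive W y∈)
two-intro (true ∷ W)  (suc x , zero , _ , x∈ , _) = s≤s (∣∣-positive W x∈)
two-intro (true ∷ W)  (suc x , suc y , _ , x∈ , _) = s≤s (∣∣-positive W x∈)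
two-intro (false ∷ W) (suc x , suc y , x≢y , x∈ , y∈) = two-intro W (x , y , (λ { refl → x≢y refl }) , x∈ , y∈)

weigh-false : ∀ {n} (C : Fin n → Bool) → weigh false C ≡ 1
weigh-false {zero}  C = refl
weigh-false {suc n} C = weigh-false (C ∘ suc)

_⊆ₛ_ : ∀ {n} → Subset n → Subset n → Set
V ⊆ₛ W = ∀ v → lookup V v ≡ true → lookup W v ≡ true

opaque
 ⊆ₛ? : ∀ {n} (V W : Subset n) → Dec (V ⊆ₛ W)
 ⊆ₛ? V W = Fin.all? λ v → ≡true? (lookup V v) →-dec ≡true? (lookup W v)

sum-⊆ : ∀ {n} (W : Subset n) → sumS (λ V → 𝟙 (⊆ₛ? V W)) ≡ weigh true (lookup W)
sum-⊆ [] = 𝟙-yes (⊆ₛ? [] []) λ ()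
sum-⊆ (w ∷ W) = trans (cong₂ _+_ (trans (sumS-cong outer) (sum-⊆ W)) (second w)) (combine w)
  where
  outer : ∀ V → 𝟙 (⊆ₛ? (false ∷ V) (w ∷ W)) ≡ 𝟙 (⊆ₛ? V W)
  outer V = 𝟙-cong {p = ⊆ₛ? (false ∷ V) (w ∷ W)} (λ sub → sub ∘ suc) λ { sub (suc v) → sub v }
  rest′ : Bool → ℕ
  rest′ w = if w yes weigh true (lookup W) no 0
  second : ∀ w → sumS (λ V → 𝟙 (⊆ₛ? (true ∷ V) (w ∷ W))) ≡ rest′ w
  second true  = trans (sumS-cong λ V → 𝟙-cong {p = ⊆ₛ? (true ∷ V) (true ∷ W)} {⊆ₛ? V W} (λ sub → sub ∘ suc) λ { sub zero → λ _ → refl ; sub (suc v) → sub v }) (sum-⊆ W)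
  second false = sumS-0 λ V → 𝟙-no (⊆ₛ? (true ∷ V) (false ∷ W)) λ sub → false≢true refl (sub zero refl)
  combine : ∀ w → weigh true (lookup W) + rest′ w ≡ (if w yes weigh true (lookup W) + weigh true (lookup W) no weigh true (lookup W))
  combine true  = refl
  combine false = +-identityʳ _

complement : ∀ {n} → Subset n → Subset n
complement W = W △ Vec.replicate _ true

lookup-complement : ∀ {n} (W : Subset n) v → lookup (complement W) v ≡ not (lookup W v)
lookup-complement W v = trans (lookup-△ W _ v) (trans (cong (lookup W v xor_) (Vec.lookup-replicate v true)) (xor-true-not (lookup W v)))
  where
  xor-true-not : ∀ b → b xor true ≡ not b
  xor-true-not false = refl
  xor-true-not true  = refl

-- Splits of a fixed set

module _ {n : ℕ} (G : Graph n) where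

  open Graph G using (adj) renaming (sym to adj-sym)

  -- A form of `AllOrNone` without disjunction, for which inheritance by subsets is immediate.
  Hom : Fin n → (Fin n → Bool) → Set
  Hom v p = ∀ w w′ → p w ≡ true → p w′ ≡ true → adj v w ≡ adj v w′

  opaque
   hom? : ∀ v p → Dec (Hom v p)
   hom? v p = Fin.all? λ w → Fin.all? λ w′ → ≡true? (p w) →-dec (≡true? (p w′) →-dec (adj v w Bool.≟ adj v w′))

  ¬hom : ∀ {v p} → ¬ Hom v p → ∀ β → ∃ λ w → p w ≡ true × adj v w ≡ β
  ¬hom {v} {p} ¬h β with Fin.any? (λ w → ≡true? (p w) ×-dec (adj v w Bool.≟ β))
  ... | yes found = found
  ... | no none′ = ⊥-elim (¬h λ w w′ pw pw′ → trans (¬≡⇒≡not λ e → none′ (w , pw , e)) (sym (¬≡⇒≡not λ e → none′ (w′ , pw′ , e))))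

  module _ (W : Subset n) where

    Inside Outside : Fin n → Set
    Inside x  = lookup W x ≡ true
    Outside x = lookup W x ≡ false

    inside? : ∀ x → Dec (Inside x)
    inside? x = lookup W x Bool.≟ true

    outside? : ∀ x → Dec (Outside x)
    outside? x = lookup W x Bool.≟ false

    -- `V` is the first side of the split; as it lies in W, `W △ V` is the rest of W, the second
    -- side.
    Valid : Subset n → Set
    Valid V = V ⊆ₛ W × Two Outside × (Two (λ x → lookup V x ≡ true) ⊎ Two (λ x → lookup (W △ V) x ≡ true))
      × (∀ v → Outside v → Hom v (lookup V) × Hom v (lookup (W △ V)))

    opaque
     valid? : ∀ V → Dec (Valid V)
     valid? V = ⊆ₛ? V W ×-dec (two? _ outside? ×-dec
       ((two? _ (λ x → ≡true? (lookup V x)) ⊎-dec two? _ (λ x → ≡true? (lookup (W △ V) x))) ×-dec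
       Fin.all? λ v → outside? v →-dec (hom? v (lookup V) ×-dec hom? v (lookup (W △ V)))))

    △-inside : ∀ {V} → V ⊆ₛ W → ∀ {x} → lookup (W △ V) x ≡ true → Inside x × lookup V x ≡ false
    △-inside {V} V⊆W {x} e with lookup W x in Wx | lookup V x in Vx | trans (sym (lookup-△ W V x)) e
    ... | true  | false | _ = refl , refl
    ... | false | true  | _ = contradiction (V⊆W x Vx) (false≢true Wx)

    △-intro : ∀ {V x} → Inside x → lookup V x ≡ false → lookup (W △ V) x ≡ true
    △-intro {V} {x} Wx Vx = trans (lookup-△ W V x) (cong₂ _xor_ Wx Vx)

    Module : Set
    Module = ∀ v → Outside v → Hom v (lookup W)

    opaque
     module? : Dec Module
     module? = Fin.all? λ v → outside? v →-dec hom? v (lookup W)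

    part : Fin n → Bool → Fin n → Bool
    part u β w = lookup W w ∧ not (adj u w xor β)

    part-elim : ∀ {u β w} → part u β w ≡ true → Inside w × adj u w ≡ β
    part-elim {u} {β} {w} e = let a , b = ∧-elim {lookup W w} e in a , xnor-true b

    part-intro : ∀ {u β w} → Inside w → adj u w ≡ β → part u β w ≡ true
    part-intro {β = β} Ww refl = ∧-intro Ww (not-intro (xor-self β))

    Bimodule : Fin n → Set
    Bimodule u = ∀ v → Outside v → Hom v (part u true) × Hom v (part u false)

    opaque
     bimodule? : ∀ u → Dec (Bimodule u)
     bimodule? u = Fin.all? λ v → outside? v →-dec (hom? v (part u true) ×-dec hom? v (part u false))

    Separates : Fin n → Set
    Separates u = Outside u × ¬ Hom u (lookup W)

    opaque
     separates? : ∀ u → Dec (Separates u)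
     separates? u = outside? u ×-dec ¬? (hom? u (lookup W))

    firstSeparator? : ∀ u → Dec (Least natural-strict separates? u)
    firstSeparator? = least? natural-strict separates?

    -- At most one term is nonzero, that of the first separator; for a module there is none.
    forced : ℕ
    forced = sumFin λ u → 𝟙 (firstSeparator? u) * 𝟙 (bimodule? u)

    -- If W is a module, every split of it is valid, provided one side has two elements; otherwise the
    -- first vertex separating W determines the split up to the order of its two sides.
    splits : ℕ
    splits = 𝟙 (two? _ inside?) * (𝟙 (two? _ outside?) *
      ((𝟙 module? * 𝟙 (¬? (three? _ inside?)) + 𝟙 module? * 𝟙 (¬? (three? _ inside?)))
       + 𝟙 (three? _ inside?) * (𝟙 module? * weigh true (lookup W) + (forced + forced))))

    Part : Fin n → Bool → Subset n
    Part u β = Vec.tabulate (part u β)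

    Part-at : ∀ u β x → lookup (Part u β) x ≡ part u β x
    Part-at u β = Vec.lookup∘tabulate (part u β)

    hom-⊆ : ∀ {v p q} → (∀ x → p x ≡ true → q x ≡ true) → Hom v q → Hom v p
    hom-⊆ sub h w w′ pw pw′ = h w w′ (sub w pw) (sub w′ pw′)

    two-⊆ : ∀ {P Q : Fin n → Set} → (∀ {x} → P x → Q x) → Two P → Two Q
    two-⊆ f (x , y , x≢y , Px , Py) = x , y , x≢y , f Px , f Py

    pigeonhole : ∀ (V : Subset n) → V ⊆ₛ W → Three Inside → Two (λ x → lookup V x ≡ true) ⊎ Two (λ x → lookup (W △ V) x ≡ true)
    pigeonhole V V⊆W (x , y , z , x≢y , x≢z , y≢z , Wx , Wy , Wz) with lookup V x in Vx | lookup V y in Vy | lookup V z in Vz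
    ... | true  | true  | _     = inj₁ (x , y , x≢y , Vx , Vy)
    ... | true  | false | true  = inj₁ (x , z , x≢z , Vx , Vz)
    ... | false | true  | true  = inj₁ (y , z , y≢z , Vy , Vz)
    ... | false | false | _     = inj₂ (x , y , x≢y , △-intro {V} Wx Vx , △-intro {V} Wy Vy)
    ... | true  | false | false = inj₂ (y , z , y≢z , △-intro {V} Wy Vy , △-intro {V} Wz Vz)
    ... | false | true  | false = inj₂ (x , z , x≢z , △-intro {V} Wx Vx , △-intro {V} Wz Vz)

    valid-two : ∀ {V} → Valid V → Two Inside
    valid-two {V} (V⊆W , _ , inj₁ two , _) = two-⊆ (λ {x} → V⊆W x) two
    valid-two {V} (V⊆W , _ , inj₂ two , _) = two-⊆ (λ {x} e → proj₁ (△-inside V⊆W e)) two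

    sum-≡ : ∀ (V₀ : Subset n) → sumS (λ V → 𝟙 (V ≟ₛ V₀)) ≡ 1
    sum-≡ V₀ = trans (sumS-single V₀ λ V V≢ → 𝟙-no (V ≟ₛ V₀) V≢) (𝟙-yes (V₀ ≟ₛ V₀) refl)

    sum-either : ∀ {V₀ V₁ : Subset n} → V₀ ≢ V₁ → sumS (λ V → 𝟙 (V ≟ₛ V₀ ⊎-dec V ≟ₛ V₁)) ≡ 2
    sum-either {V₀} {V₁} ≢ = trans (sumS-cong λ V → disjoint-+ (V ≟ₛ V₀) (V ≟ₛ V₁) λ e e′ → ≢ (trans (sym e) e′))
      (trans (sumS-+ (λ V → 𝟙 (V ≟ₛ V₀)) (λ V → 𝟙 (V ≟ₛ V₁))) (cong₂ _+_ (sum-≡ V₀) (sum-≡ V₁)))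
      where
      disjoint-+ : ∀ {P Q : Set} (p : Dec P) (q : Dec Q) → (P → Q → ⊥) → 𝟙 (p ⊎-dec q) ≡ 𝟙 p + 𝟙 q
      disjoint-+ (yes p) (yes q) d = ⊥-elim (d p q)
      disjoint-+ (yes p) (no _)  d = refl
      disjoint-+ (no _)  (yes q) d = refl
      disjoint-+ (no _)  (no _)  d = refl

    module _ (two-out : Two Outside) (mod : Module) where

      sum-valid-large : Three Inside → sumS (λ V → 𝟙 (valid? V)) ≡ weigh true (lookup W)
      sum-valid-large three = trans (sumS-cong λ V → 𝟙-cong {p = valid? V} {⊆ₛ? V W} proj₁ λ V⊆W →
        V⊆W , two-out , pigeonhole V V⊆W three , λ v out → hom-⊆ V⊆W (mod v out) , hom-⊆ (λ x e → proj₁ (△-inside V⊆W e)) (mod v out)) (sum-⊆ W)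

      -- If W has two elements, a side with two elements is all of W and the other side is empty.
      sum-valid-small : Two Inside → ¬ Three Inside → sumS (λ V → 𝟙 (valid? V)) ≡ 2
      sum-valid-small two ¬three = trans (sumS-cong λ V → 𝟙-cong {p = valid? V}
          {V ≟ₛ W ⊎-dec V ≟ₛ ∅} to from)
        (sum-either λ W≡∅ → let x , _ , _ , Wx , _ = two in false≢true (trans (cong (λ S → lookup S x) W≡∅) (Vec.lookup-replicate x false)) Wx)
        where
        ∅ : Subset n
        ∅ = Vec.replicate n false
        full : ∀ {P : Fin n → Set} → (∀ {x} → P x → Inside x) → Two P → ∀ z → Inside z → ¬ ¬ P z
        full {P} sub (x , y , x≢y , Px , Py) z Wz ¬Pz =
          ¬three (x , y , z , x≢y , (λ { refl → ¬Pz Px }) , (λ { refl → ¬Pz Py }) , sub Px , sub Py , Wz)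
        to : ∀ {V} → Valid V → V ≡ W ⊎ V ≡ ∅
        to {V} (V⊆W , _ , inj₁ two′ , _) = inj₁ (lookup-ext λ x → same x)
          where
          same : ∀ x → lookup V x ≡ lookup W x
          same x with lookup V x in Vx | lookup W x in Wx
          ... | true  | true  = refl
          ... | false | false = refl
          ... | true  | false = contradiction (V⊆W x Vx) (false≢true Wx)
          ... | false | true  = ⊥-elim (full (λ {x} → V⊆W x) two′ x Wx (false≢true Vx))
        to {V} (V⊆W , _ , inj₂ two′ , _) = inj₂ (lookup-ext λ x → trans (¬true⇒false λ Vx →
          full (λ e → proj₁ (△-inside V⊆W e)) two′ x (V⊆W x Vx) λ e → false≢true (proj₂ (△-inside V⊆W e)) Vx) (sym (Vec.lookup-replicate x false)))
        from : ∀ {V} → V ≡ W ⊎ V ≡ ∅ → Valid V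
        from (inj₁ refl) = (λ _ → id) , two-out , inj₁ two , λ v out → mod v out , hom-⊆ (λ x e → proj₁ (△-inside {W} (λ _ → id) e)) (mod v out)
        from (inj₂ refl) = ∅⊆ , two-out , inj₂ (two-⊆ (λ {x} Wx → △-intro {∅} Wx (Vec.lookup-replicate x false)) two) ,
          λ v out → hom-⊆ ∅⊆ (mod v out) , hom-⊆ (λ x e → proj₁ (△-inside ∅⊆ e)) (mod v out)
          where
          ∅⊆ : ∅ ⊆ₛ W
          ∅⊆ v e = contradiction e (false≢true (Vec.lookup-replicate v false))

    module _ (two-out : Two Outside) {u : Fin n} (sep : Separates u) where

      private
        P₁ P₀ : Subset n
        P₁ = Part u true
        P₀ = Part u false

      Part-⊆ : ∀ β → Part u β ⊆ₛ W
      Part-⊆ β x e = proj₁ (part-elim (trans (sym (Part-at u β x)) e))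

      -- Adjacency to `u` is constant on each side but not on W, so it takes different values on the
      -- two sides, and these are the parts at `u`. One side has two elements and the other is
      -- nonempty, which gives three in W.
      valid-bimodule : ∀ {V} → Valid V → (V ≡ P₁ ⊎ V ≡ P₀) × (Three Inside × Bimodule u)
      valid-bimodule {V} (V⊆W , _ , two , homs) = which , three , bimodule
        where
        homV : Hom u (lookup V)
        homV = proj₁ (homs u (proj₁ sep))
        homV′ : Hom u (lookup (W △ V))
        homV′ = proj₂ (homs u (proj₁ sep))
        -- V is not all of W, nor empty, as u does not separate V or its complement in W.
        inV : ∃ λ x → lookup V x ≡ true
        inV with Fin.any? (λ x → ≡true? (lookup V x))
        ... | yes found = found
        ... | no none′ = ⊥-elim (proj₂ sep (hom-⊆ (λ x Wx → △-intro {V} Wx (¬true⇒false λ Vx → none′ (x , Vx))) homV′))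
        inV′ : ∃ λ x → Inside x × lookup V x ≡ false
        inV′ with Fin.any? (λ x → inside? x ×-dec (lookup V x Bool.≟ false))
        ... | yes found = found
        ... | no none′ = ⊥-elim (proj₂ sep (hom-⊆ (λ x Wx → [ id , (λ e → ⊥-elim (none′ (x , Wx , e))) ] (either (lookup V x))) homV))
          where
          either : ∀ b → b ≡ true ⊎ b ≡ false
          either true  = inj₁ refl
          either false = inj₂ refl
        β : Bool
        β = adj u (proj₁ inV)
        onV : ∀ x → lookup V x ≡ true → adj u x ≡ β
        onV x Vx = homV x (proj₁ inV) Vx (proj₂ inV)
        off : Bool
        off = adj u (proj₁ inV′)
        offV : ∀ x → Inside x → lookup V x ≡ false → adj u x ≡ off
        offV x Wx Vx = homV′ x (proj₁ inV′) (△-intro {V} Wx Vx) (△-intro {V} (proj₁ (proj₂ inV′)) (proj₂ (proj₂ inV′)))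
        off≢β : off ≢ β
        off≢β e = proj₂ sep λ w w′ Ww Ww′ → trans (all-β w Ww) (sym (all-β w′ Ww′))
          where
          all-β : ∀ w → Inside w → adj u w ≡ β
          all-β w Ww with lookup V w in Vw
          ... | true  = onV w Vw
          ... | false = trans (offV w Ww Vw) e
        V≡ : V ≡ Part u β
        V≡ = lookup-ext λ x → trans (same x) (sym (Part-at u β x))
          where
          same : ∀ x → lookup V x ≡ part u β x
          same x with lookup V x in Vx
          ... | true  = sym (part-intro (V⊆W x Vx) (onV x Vx))
          ... | false = sym (¬true⇒false λ e → let Wx , ux = part-elim e in off≢β (trans (sym (offV x Wx Vx)) ux))
        which : V ≡ P₁ ⊎ V ≡ P₀
        which with β in eq
        ... | true  = inj₁ (trans V≡ (cong (Part u) eq))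
        ... | false = inj₂ (trans V≡ (cong (Part u) eq))
        three : Three Inside
        three = from-two two
         where
         from-two : Two (λ x → lookup V x ≡ true) ⊎ Two (λ x → lookup (W △ V) x ≡ true) → Three Inside
         from-two (inj₁ (x , y , x≢y , Vx , Vy)) = let z , Wz , ¬Vz = inV′ in
          x , y , z , x≢y , (λ { refl → false≢true ¬Vz Vx }) , (λ { refl → false≢true ¬Vz Vy }) , V⊆W x Vx , V⊆W y Vy , Wz
         from-two (inj₂ (x , y , x≢y , ex , ey)) = let z , Vz = inV ; Wx , ¬Vx = △-inside V⊆W ex ; Wy , ¬Vy = △-inside V⊆W ey in
          x , y , z , x≢y , (λ { refl → false≢true ¬Vx Vz }) , (λ { refl → false≢true ¬Vy Vz }) , Wx , Wy , V⊆W z Vz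
        bimodule : Bimodule u
        bimodule v out = hom-part true , hom-part false
          where
          hom-part : ∀ γ → Hom v (part u γ)
          hom-part γ with γ Bool.≟ β
          ... | yes γ≡β = hom-⊆ (λ x e → let Wx , ux = part-elim e in
                            trans (cong (λ S → lookup S x) V≡) (trans (Part-at u β x) (part-intro Wx (trans ux γ≡β)))) (proj₁ (homs v out))
          ... | no γ≢β = hom-⊆ (λ x e → let Wx , ux = part-elim e in
                            △-intro {V} Wx (¬true⇒false λ Vx → γ≢β (trans (sym ux) (onV x Vx)))) (proj₂ (homs v out))

      bimodule-valid : Three Inside → Bimodule u → ∀ β → Valid (Part u β)
      bimodule-valid three bi β = Part-⊆ β , two-out , pigeonhole (Part u β) (Part-⊆ β) three , λ v out →
        hom-⊆ (λ x e → trans (sym (Part-at u β x)) e) (hom-part v out β) ,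
        hom-⊆ (λ x e → let Wx , ¬P = △-inside (Part-⊆ β) e in
          part-intro Wx (¬≡⇒≡not λ ux → false≢true (trans (sym (Part-at u β x)) ¬P) (part-intro Wx ux))) (hom-part v out (not β))
        where
        hom-part : ∀ v → Outside v → ∀ γ → Hom v (part u γ)
        hom-part v out true  = proj₁ (bi v out)
        hom-part v out false = proj₂ (bi v out)

      sum-valid-separated : sumS (λ V → 𝟙 (valid? V)) ≡ 𝟙 (three? _ inside?) * (𝟙 (bimodule? u) + 𝟙 (bimodule? u))
      sum-valid-separated = begin
        sumS (λ V → 𝟙 (valid? V))
          ≡⟨ sumS-cong (λ V → trans (𝟙-×-when {p = valid? V} {V ≟ₛ P₁ ⊎-dec V ≟ₛ P₀} {three? _ inside? ×-dec bimodule? u}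
               valid-bimodule (λ { (inj₁ refl) (three , bi) → bimodule-valid three bi true ; (inj₂ refl) (three , bi) → bimodule-valid three bi false }))
               (*-comm _ k)) ⟩
        sumS (λ V → k * 𝟙 (V ≟ₛ P₁ ⊎-dec V ≟ₛ P₀))
          ≡⟨ sumS-*ˡ k (λ V → 𝟙 (V ≟ₛ P₁ ⊎-dec V ≟ₛ P₀)) ⟩
        k * sumS (λ V → 𝟙 (V ≟ₛ P₁ ⊎-dec V ≟ₛ P₀))
          ≡⟨ cong₂ _*_ (𝟙-× (three? _ inside?) (bimodule? u)) (sum-either P₁≢P₀) ⟩
        𝟙 (three? _ inside?) * 𝟙 (bimodule? u) * 2
          ≡⟨ solve 2 (λ a b → a :* b :* con 2 := a :* (b :+ b)) refl (𝟙 (three? _ inside?)) (𝟙 (bimodule? u)) ⟩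
        𝟙 (three? _ inside?) * (𝟙 (bimodule? u) + 𝟙 (bimodule? u)) ∎
        where
        open ≡-Reasoning
        open +-*-Solver using (solve; _:*_; _:=_; _:+_; con)
        k = 𝟙 (three? _ inside? ×-dec bimodule? u)
        P₁≢P₀ : P₁ ≢ P₀
        P₁≢P₀ e = let w , Ww , uw = ¬hom (proj₂ sep) true
                      w∈P₀ = trans (sym (Part-at u false w)) (trans (cong (λ S → lookup S w) (sym e)) (trans (Part-at u true w) (part-intro Ww uw)))
                  in contradiction (trans (sym (proj₂ (part-elim w∈P₀))) uw) λ ()

    forced-module : Module → forced ≡ 0
    forced-module mod = sumFin-0 λ u → cong (_* 𝟙 (bimodule? u)) (𝟙-no (firstSeparator? u) λ ((out , ¬h) , _) → ¬h (mod u out))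

    forced-separated : ∀ {u} → Least natural-strict separates? u → forced ≡ 𝟙 (bimodule? u)
    forced-separated {u} least@(sep , min) = trans (sumFin-single {f = λ u → 𝟙 (firstSeparator? u) * 𝟙 (bimodule? u)} u λ y y≢u →
        cong (_* 𝟙 (bimodule? y)) (𝟙-no (firstSeparator? y) λ (sep′ , min′) →
          [ y≢u , [ (λ y<u → min y y<u sep′) , (λ u<y → min′ u u<y sep) ] ] (StrictOrder.connected natural-strict y u)))
      (trans (cong (_* 𝟙 (bimodule? u)) (𝟙-yes (firstSeparator? u) least)) (+-identityʳ _))

    sum-valid : sumS (λ V → 𝟙 (valid? V)) ≡ splits
    sum-valid with two? _ inside? | two? _ outside?
    ... | no ¬two | _ = sumS-0 λ V → 𝟙-no (valid? V) (¬two ∘ valid-two)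
    ... | yes _ | no ¬two = sumS-0 λ V → 𝟙-no (valid? V) (¬two ∘ proj₁ ∘ proj₂)
    ... | yes two-in | yes two-out with module?
    ...   | yes mod = by-size (three? _ inside?)
      where
      by-size : ∀ three → sumS (λ V → 𝟙 (valid? V)) ≡
        1 * (1 * ((1 * 𝟙 (¬? three) + 1 * 𝟙 (¬? three)) + 𝟙 three * (1 * weigh true (lookup W) + (forced + forced))))
      by-size (yes three) = trans (sum-valid-large two-out mod three) (trans (trans (sym (+-identityʳ (weigh true (lookup W)))) (cong (λ f → weigh true (lookup W) + (f + f)) (sym (forced-module mod))))
        (solve 2 (λ a f → a :+ (f :+ f) := con 1 :* (con 1 :* (con 0 :+ con 1 :* (con 1 :* a :+ (f :+ f))))) refl (weigh true (lookup W)) forced))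
        where open +-*-Solver using (solve; _:*_; _:=_; _:+_; con)
      by-size (no ¬three) = sum-valid-small two-out mod two-in ¬three
    ...   | no ¬mod = trans (sum-valid-separated two-out (proj₁ (proj₂ first))) (trans (cong (λ f → 𝟙 (three? _ inside?) * (f + f)) (sym (forced-separated (proj₂ first))))
        (solve 2 (λ t f → t :* (f :+ f) := con 1 :* (con 1 :* (con 0 :+ t :* (con 0 :+ (f :+ f))))) refl (𝟙 (three? _ inside?)) forced))
      where
      open +-*-Solver using (solve; _:*_; _:=_; _:+_; con)
      separator : ∃ Separates
      separator with Fin.any? separates?
      ... | yes found = found
      ... | no none′ = ⊥-elim (¬mod λ v out → decided v out (hom? v (lookup W)))
        where
        decided : ∀ v → Outside v → Dec (Hom v (lookup W)) → Hom v (lookup W)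
        decided v out (yes h) = h
        decided v out (no ¬h) = ⊥-elim (none′ (v , out , ¬h))
      first : ∃ (Least natural-strict separates?)
      first = let u , sep , min = least natural-strict id separates? separator in u , sep , λ y y<u sepy → min y sepy y<u

sumFin-+ : ∀ {n} (f g : Fin n → ℕ) → sumFin (λ v → f v + g v) ≡ sumFin f + sumFin g
sumFin-+ {zero}  f g = refl
sumFin-+ {suc n} f g = trans (cong (f zero + g zero +_) (sumFin-+ (f ∘ suc) (g ∘ suc))) (+-interchange (f zero) (g zero) _ _)

module _ {n : ℕ} (G : Graph n) where

  open Graph G using (adj) renaming (sym to adj-sym)

  -- Homogeneous pairs as splits

  private
    T⇒true : ∀ {b} → Bool.T b → b ≡ true
    T⇒true {true} _ = refl

    true⇒T : ∀ {b} → b ≡ true → Bool.T b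
    true⇒T refl = tt

    ¬T⇒false : ∀ {b} → ¬ Bool.T b → b ≡ false
    ¬T⇒false {true}  f = ⊥-elim (f tt)
    ¬T⇒false {false} f = refl

  allOrNone-hom : ∀ {v X} → AllOrNone G v X → Hom G v (lookup X)
  allOrNone-hom {X = X} (inj₁ a) w w′ e e′ =
    trans (T⇒true (a w (Vec.lookup⇒[]= w X e))) (sym (T⇒true (a w′ (Vec.lookup⇒[]= w′ X e′))))
  allOrNone-hom {X = X} (inj₂ a) w w′ e e′ =
    trans (¬T⇒false (a w (Vec.lookup⇒[]= w X e))) (sym (¬T⇒false (a w′ (Vec.lookup⇒[]= w′ X e′))))

  hom-allOrNone : ∀ {v X} → Hom G v (lookup X) → AllOrNone G v X
  hom-allOrNone {v} {X} h with Fin.any? (λ w → ≡true? (lookup X w) ×-dec ≡true? (adj v w))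
  ... | yes (w , Xw , vw) = inj₁ λ w′ w′∈ → true⇒T (trans (h w′ w (Vec.[]=⇒lookup w′∈) Xw) vw)
  ... | no none′          = inj₂ λ w′ w′∈ vw′ → none′ (w′ , Vec.[]=⇒lookup w′∈ , T⇒true vw′)

  outside-lookup : ∀ (W : Subset n) {v} → lookup W v ≡ false → lookup (complement W) v ≡ true
  outside-lookup W {v} e = trans (lookup-complement W v) (not-intro e)

  lookup-outside : ∀ (W : Subset n) {v} → lookup (complement W) v ≡ true → lookup W v ≡ false
  lookup-outside W {v} e = not-elim (trans (sym (lookup-complement W v)) e)

  pair-valid : ∀ W V V′ → IsHomogeneousPair G (complement W) V V′ → V′ ≡ W △ V × Valid G W V
  pair-valid W V V′ hp = V′≡ , V⊆W , two-⊆ G W (lookup-outside W) (two-elim (complement W) 2≤∣U∣) ,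
    subst (λ S → Two (λ x → lookup V x ≡ true) ⊎ Two (λ x → lookup S x ≡ true)) V′≡ (Sum.map (two-elim V) (two-elim V′) 2≤∣W₁∣⊎2≤∣W₂∣) ,
    λ v out → let v∈ = Vec.lookup⇒[]= v (complement W) (outside-lookup W out) in
      allOrNone-hom (homogeneous₁ v v∈) , subst (λ S → Hom G v (lookup S)) V′≡ (allOrNone-hom (homogeneous₂ v v∈))
    where
    open IsHomogeneousPair hp
    -- The partition conditions at a single vertex; every missing row contradicts one of them.
    table : ∀ w a b → not w ∧ a ≡ false → not w ∧ b ≡ false → a ∧ b ≡ false → not w ∨ (a ∨ b) ≡ true →
      b ≡ w xor a × (a ≡ true → w ≡ true)
    table true  true  false _ _ _ _ = refl , λ _ → refl
    table true  false true  _ _ _ _ = refl , λ _ → refl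
    table false false false _ _ _ _ = refl , λ ()
    at : ∀ {f : Bool → Bool → Bool} {A B C : Subset n} → Vec.zipWith f A B ≡ C → ∀ v → f (lookup A v) (lookup B v) ≡ lookup C v
    at {f} {A} {B} eq v = trans (sym (Vec.lookup-zipWith f v A B)) (cong (λ S → lookup S v) eq)
    empty : ∀ {A B : Subset n} → Subset._∩_ A B ≡ Subset.⊥ → ∀ v → lookup A v ∧ lookup B v ≡ false
    empty {A} {B} eq v = trans (at {_∧_} {A} {B} eq v) (Vec.lookup-replicate v false)
    cases : ∀ v → lookup V′ v ≡ lookup W v xor lookup V v × (lookup V v ≡ true → lookup W v ≡ true)
    cases v = table (lookup W v) (lookup V v) (lookup V′ v)
      (trans (cong (_∧ lookup V v) (sym (lookup-complement W v))) (empty {complement W} {V} U∩W₁≡⊥ v))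
      (trans (cong (_∧ lookup V′ v) (sym (lookup-complement W v))) (empty {complement W} {V′} U∩W₂≡⊥ v))
      (empty {V} {V′} W₁∩W₂≡⊥ v)
      (trans (cong₂ _∨_ (sym (lookup-complement W v)) (sym (Vec.lookup-zipWith _∨_ v V V′)))
        (trans (at {_∨_} {complement W} {Subset._∪_ V V′} U∪W₁∪W₂≡⊤ v) (Vec.lookup-replicate v true)))
    V′≡ : V′ ≡ W △ V
    V′≡ = lookup-ext λ v → trans (proj₁ (cases v)) (sym (lookup-△ W V v))
    V⊆W : V ⊆ₛ W
    V⊆W v = proj₂ (cases v)

  valid-pair : ∀ W V → Valid G W V → IsHomogeneousPair G (complement W) V (W △ V)
  valid-pair W V (V⊆W , two-out , twos , homs) = record
    { U∩W₁≡⊥      = pointwise _∧_ (complement W) V false λ v → trans (cong (_∧ lookup V v) (lookup-complement W v)) (t₁ _ _ (V⊆W v))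
    ; U∩W₂≡⊥      = pointwise _∧_ (complement W) (W △ V) false λ v → trans (cong₂ _∧_ (lookup-complement W v) (lookup-△ W V v)) (t₂ _ _ (V⊆W v))
    ; W₁∩W₂≡⊥     = pointwise _∧_ V (W △ V) false λ v → trans (cong (lookup V v ∧_) (lookup-△ W V v)) (t₃ _ _ (V⊆W v))
    ; U∪W₁∪W₂≡⊤   = pointwise _∨_ (complement W) (Subset._∪_ V (W △ V)) true λ v →
        trans (cong₂ _∨_ (lookup-complement W v) (trans (Vec.lookup-zipWith _∨_ v V (W △ V)) (cong (lookup V v ∨_) (lookup-△ W V v)))) (t₄ _ _ (V⊆W v))
    ; 2≤∣U∣        = two-intro (complement W) (two-⊆ G W (outside-lookup W) two-out)
    ; 2≤∣W₁∣⊎2≤∣W₂∣ = Sum.map (two-intro V) (two-intro (W △ V)) twos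
    ; homogeneous₁ = λ v v∈ → hom-allOrNone (proj₁ (homs v (lookup-outside W (Vec.[]=⇒lookup v∈))))
    ; homogeneous₂ = λ v v∈ → hom-allOrNone (proj₂ (homs v (lookup-outside W (Vec.[]=⇒lookup v∈)))) }
    where
    pointwise : ∀ (f : Bool → Bool → Bool) (A B : Subset n) c → (∀ v → f (lookup A v) (lookup B v) ≡ c) → Vec.zipWith f A B ≡ Vec.replicate n c
    pointwise f A B c eq = lookup-ext λ v → trans (Vec.lookup-zipWith f v A B) (trans (eq v) (sym (Vec.lookup-replicate v c)))
    t₁ : ∀ w a → (a ≡ true → w ≡ true) → not w ∧ a ≡ false
    t₁ true  a     _ = refl
    t₁ false false _ = refl
    t₁ false true  f = contradiction (f refl) λ ()
    t₂ : ∀ w a → (a ≡ true → w ≡ true) → not w ∧ (w xor a) ≡ false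
    t₂ true  a _ = refl
    t₂ false false _ = refl
    t₂ false true  f = contradiction (f refl) λ ()
    t₃ : ∀ w a → (a ≡ true → w ≡ true) → a ∧ (w xor a) ≡ false
    t₃ w     false _ = refl
    t₃ true  true  _ = refl
    t₃ false true  f = contradiction (f refl) λ ()
    t₄ : ∀ w a → (a ≡ true → w ≡ true) → not w ∨ (a ∨ (w xor a)) ≡ true
    t₄ false a     _ = refl
    t₄ true  true  _ = refl
    t₄ true  false _ = refl

  pairs-splits : numHomogeneousPairs (n , G) ≡ sumS (splits G)
  pairs-splits = begin
    length (homogeneousPairs G)
      ≡⟨ length-filter (λ (U , W₁ , W₂) → isHomogeneousPair? G U W₁ W₂) (cartesianProduct S (cartesianProduct S S)) ⟩
    sumOver (λ (U , p) → ind U p) (cartesianProduct S (cartesianProduct S S))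
      ≡⟨ sumOver-cartesianProduct (λ (U , p) → ind U p) S (cartesianProduct S S) ⟩
    sumOver (λ U → sumOver (ind U) (cartesianProduct S S)) S
      ≡⟨ sumOver-subsets n (λ U → sumOver (ind U) (cartesianProduct S S)) ⟩
    sumS (λ U → sumOver (ind U) (cartesianProduct S S))
      ≡⟨ sumS-cong (λ U → trans (sumOver-cartesianProduct (ind U) S S)
           (trans (sumOver-subsets n (λ W₁ → sumOver (λ W₂ → ind U (W₁ , W₂)) S)) (sumS-cong λ W₁ → sumOver-subsets n (λ W₂ → ind U (W₁ , W₂))))) ⟩
    sumS (λ U → sumS λ W₁ → sumS λ W₂ → 𝟙 (isHomogeneousPair? G U W₁ W₂))
      -- Substitute the complement of W for U.
      ≡⟨ sumS-△ (Vec.replicate n true) (λ U → sumS λ W₁ → sumS λ W₂ → 𝟙 (isHomogeneousPair? G U W₁ W₂)) ⟨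
    sumS (λ W → sumS λ V → sumS λ V′ → 𝟙 (isHomogeneousPair? G (complement W) V V′))
      ≡⟨ sumS-cong (λ W → trans (sumS-cong (second W)) (sum-valid G W)) ⟩
    sumS (splits G) ∎
    where
    open ≡-Reasoning
    S = subsets n
    ind : Subset n → Subset n × Subset n → ℕ
    ind U (W₁ , W₂) = 𝟙 (isHomogeneousPair? G U W₁ W₂)
    second : ∀ W V → sumS (λ V′ → 𝟙 (isHomogeneousPair? G (complement W) V V′)) ≡ 𝟙 (valid? G W V)
    second W V = trans
      (sumS-single (W △ V) λ V′ V′≢ → 𝟙-no (isHomogeneousPair? G (complement W) V V′) λ hp → V′≢ (proj₁ (pair-valid W V V′ hp)))
      (𝟙-cong {p = isHomogeneousPair? G (complement W) V (W △ V)} {valid? G W V} (λ hp → proj₂ (pair-valid W V (W △ V) hp)) (valid-pair W V))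

  -- The terms of the algorithm

  module _ (W : Subset n) where

    private
      In Out : Fin n → Set
      In = Inside G W
      Out = Outside G W

    decide : ∀ x → In x ⊎ Out x
    decide x with lookup W x
    ... | true  = inj₁ refl
    ... | false = inj₂ refl

    not-both : ∀ {x} → Out x → In x → ⊥
    not-both out inn = false≢true out inn

    unforced : ∀ {a b} → a xor b ≢ true → a ≡ b
    unforced ¬e = xnor-true (not-intro (¬true⇒false ¬e))

    module _ {w₁ : Fin n} (w₁∈ : In w₁) where

      closed-module : Closed (forces adj (everything adj) (adj w₁) (adj w₁)) W → Module G W
      closed-module closed v out w w′ w∈ w′∈ = trans (like w w∈) (sym (like w′ w′∈))
        where
        like : ∀ w → In w → adj v w ≡ adj w₁ v
        like w w∈ = unforced λ e → not-both out (closed w v e w∈)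

      module-closed : Module G W → Closed (forces adj (everything adj) (adj w₁) (adj w₁)) W
      module-closed mod w v e w∈ with decide v
      ... | inj₁ v∈  = v∈
      ... | inj₂ out = contradiction (trans (mod v out w w₁ w∈ w₁∈) (adj-sym v w₁)) (xor-true e)

    module _ {u a b : Fin n} (a∈ : In a) (ua : adj u a ≡ true) (b∈ : In b) (ub : adj u b ≡ false) where

      private
        F : Relation n
        F = forces adj (adj u) (adj a) (adj b)

      closed-bimodule : Closed F W → Bimodule G W u
      closed-bimodule closed v out =
        (λ w w′ p p′ → trans (like-a w p) (sym (like-a w′ p′))) , (λ w w′ p p′ → trans (like-b w p) (sym (like-b w′ p′)))
        where
        like : ∀ w → In w → adj v w ≡ (if adj u w yes adj a v no adj b v)
        like w w∈ = unforced λ e → not-both out (closed w v e w∈)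
        like-a : ∀ w → part G W u true w ≡ true → adj v w ≡ adj a v
        like-a w p = let w∈ , uw = part-elim G W p in trans (like w w∈) (cong (λ c → if c yes adj a v no adj b v) uw)
        like-b : ∀ w → part G W u false w ≡ true → adj v w ≡ adj b v
        like-b w p = let w∈ , uw = part-elim G W p in trans (like w w∈) (cong (λ c → if c yes adj a v no adj b v) uw)

      bimodule-like : Bimodule G W u → ∀ v → Out v → ∀ w → In w → adj v w ≡ (if adj u w yes adj v a no adj v b)
      bimodule-like bi v out w w∈ with adj u w in uw
      ... | true  = proj₁ (bi v out) w a (part-intro G W w∈ uw) (part-intro G W a∈ ua)
      ... | false = proj₂ (bi v out) w b (part-intro G W w∈ uw) (part-intro G W b∈ ub)

      bimodule-closed : Bimodule G W u → Closed F W
      bimodule-closed bi w v e w∈ with decide v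
      ... | inj₁ v∈  = v∈
      ... | inj₂ out = contradiction (trans (bimodule-like bi v out w w∈)
              (cong₂ (λ c d → if adj u w yes c no d) (adj-sym v a) (adj-sym v b))) (xor-true e)

      -- An outside vertex has one value on the part of `a` and one on the part of `b`; if these
      -- agree it does not separate W. This justifies how `separate` expresses that `u` comes first.
      bimodule-hom : Bimodule G W u → ∀ v → Out v → adj a v ≡ adj b v → Hom G v (lookup W)
      bimodule-hom bi v out eq w w′ w∈ w′∈ = trans (like w w∈) (sym (like w′ w′∈))
        where
        ab : adj v a ≡ adj v b
        ab = trans (adj-sym v a) (trans eq (adj-sym b v))
        same : ∀ c → (if c yes adj v a no adj v b) ≡ adj v a
        same true  = refl
        same false = sym ab
        like : ∀ w → In w → adj v w ≡ adj v a
        like w w∈ = trans (bimodule-like bi v out w w∈) (same (adj u w))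

    -- One layer of the nested sum: the sum over the first witness collapses to the existence of a
    -- witness, which may then be restated knowing that W lies in `c`.
    sum-step : ∀ d P c {K K′} {f : Fin n → ℕ} → (∀ x → f x ≡ 𝟙 (inCube? (refine d P _<F_ c x) W) * K) →
      (InCube c W → 𝟙 (Fin.any? (hit? d P c W)) * K ≡ K′) → sumFin f ≡ 𝟙 (inCube? c W) * K′
    sum-step d P c {K} {K′} {f} eq goal = begin
      sumFin f                                                        ≡⟨ sumFin-cong eq ⟩
      sumFin (λ x → 𝟙 (inCube? (refine d P _<F_ c x) W) * K)          ≡⟨ sumFin-*ʳ K (λ x → 𝟙 (inCube? (refine d P _<F_ c x) W)) ⟩
      sumFin (λ x → 𝟙 (inCube? (refine d P _<F_ c x) W)) * K          ≡⟨ cong (_* K) (sum-refine d P c W natural-strict) ⟩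
      𝟙 (inCube? c W) * 𝟙 (Fin.any? (hit? d P c W)) * K               ≡⟨ *-assoc (𝟙 (inCube? c W)) _ K ⟩
      𝟙 (inCube? c W) * (𝟙 (Fin.any? (hit? d P c W)) * K)             ≡⟨ 𝟙-*-cong (inCube? c W) goal ⟩
      𝟙 (inCube? c W) * K′                                            ∎
      where open ≡-Reasoning

    other-elim : ∀ {x y : Fin n} → not (x ≡F y) ≡ true → x ≢ y
    other-elim {x} e refl = false≢true (not-elim e) (≡F-refl x)

    other-intro : ∀ {x y : Fin n} → x ≢ y → not (x ≡F y) ≡ true
    other-intro x≢y = not-intro (¬true⇒false (x≢y ∘ ≡F-elim))

    module _ (c : Cube n) (u : Fin n) where

      private
        atA : ∀ a → Dec (Least natural-strict (hit? true (adj u) c W) a)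
        atA = least? natural-strict (hit? true (adj u) c W)
        atB : ∀ b → Dec (Least natural-strict (hit? true (λ y → not (adj u y)) c W) b)
        atB = least? natural-strict (hit? true (λ y → not (adj u y)) c W)
        someA = Fin.any? (hit? true (adj u) c W)
        someB = Fin.any? (hit? true (λ y → not (adj u y)) c W)

        -- The conditions on `u` that do not mention `a` and `b`; they come out of the sums over
        -- these two.
        Rest : Set
        Rest = Out u × (∀ y → y <F u ≡ true → ¬ Separates G W y) × Bimodule G W u

        rest? : Dec Rest
        rest? = outside? G W u ×-dec ((Fin.all? λ y → ≡true? (y <F u) →-dec ¬? (separates? G W y)) ×-dec bimodule? G W u)

      module _ (a b : Fin n) where

        private
          F = forces adj (adj u) (adj a) (adj b)
          c₆ = refine true (adj u) _<F_ c a
          c₇ = refine true (λ y → not (adj u y)) _<F_ c₆ b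

        separate-elim : Sol F false (separate adj u a b c) W →
          InCube c W × (Rest × (Least natural-strict (hit? true (adj u) c W) a × Least natural-strict (hit? true (λ y → not (adj u y)) c W) b))
        separate-elim (W∈ , closed) =
          let in₆ , (¬ub , b∈) , minB = refine-elim true (λ y → not (adj u y)) c₆ W {_<F_} {b} in₇
              in₅ , (ua , a∈) , minA = refine-elim true (adj u) c W {_<F_} {a} in₆
              bi = closed-bimodule a∈ ua b∈ (not-elim ¬ub) closed
          in in₅ , (u∉ , (λ y y<u (out , ¬h) → ¬h (bimodule-hom a∈ ua b∈ (not-elim ¬ub) bi y out (unforced λ e → not-both out (kept y y<u e)))) , bi) ,
             ((ua , a∈) , minA) , ((¬ub , b∈) , minB)
          where
          in₇ : InCube c₇ W
          in₇ e y eq = W∈ e y (∨-introˡ eq)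
          u∉ : Out u
          u∉ = W∈ false u (∨-introʳ {c₇ false u} (≡F-refl u))
          kept : ∀ y → y <F u ≡ true → adj a y xor adj b y ≡ true → In y
          kept y y<u e = W∈ true y (∨-introʳ {c₇ true y} (∧-intro y<u e))

        separate-intro : InCube c W →
          (Rest × (Least natural-strict (hit? true (adj u) c W) a × Least natural-strict (hit? true (λ y → not (adj u y)) c W) b)) →
          Sol F false (separate adj u a b c) W
        separate-intro in₅ ((u∉ , first , bi) , ((ua , a∈) , minA) , ((¬ub , b∈) , minB)) =
          cube , bimodule-closed a∈ ua b∈ (not-elim ¬ub) bi
          where
          in₇ : InCube c₇ W
          in₇ = refine-intro true (λ y → not (adj u y)) c₆ W {_<F_} {b} (refine-intro true (adj u) c W {_<F_} {a} in₅ (ua , a∈) minA) (¬ub , b∈) minB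
          hom-of : ∀ y → y <F u ≡ true → Out y → Dec (Hom G y (lookup W)) → Hom G y (lookup W)
          hom-of y y<u out (yes h) = h
          hom-of y y<u out (no ¬h) = ⊥-elim (first y y<u (out , ¬h))
          cube : InCube (separate adj u a b c) W
          cube true y e with ∨-elim {c₇ true y} e
          ... | inj₁ e₇ = in₇ true y e₇
          ... | inj₂ e₈ with decide y | ∧-elim {y <F u} e₈
          ...   | inj₁ y∈  | _ = y∈
          ...   | inj₂ out | y<u , ab = contradiction (trans (adj-sym a y) (trans (hom-of y y<u out (hom? G y (lookup W)) a b a∈ b∈) (adj-sym y b))) (xor-true ab)
          cube false y e with ∨-elim {c₇ false y} e
          ... | inj₁ e₇ = in₇ false y e₇
          ... | inj₂ y≡u = trans (cong (lookup W) (≡F-elim y≡u)) u∉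

      -- Having both a neighbour and a non-neighbour in W is what it means for `u` not to be
      -- constant on W.
      rest-separator : 𝟙 rest? * (𝟙 someA * 𝟙 someB) ≡ 𝟙 (firstSeparator? G W u) * 𝟙 (bimodule? G W u)
      rest-separator = trans (cong (𝟙 rest? *_) (sym (𝟙-× someA someB))) (trans (sym (𝟙-× rest? (someA ×-dec someB)))
        (𝟙-×-when {p = rest? ×-dec (someA ×-dec someB)} {firstSeparator? G W u} {bimodule? G W u}
          (λ ((u∉ , first , bi) , (a , ua , a∈) , (b , ¬ub , b∈)) →
            ((u∉ , λ h → false≢true (not-elim ¬ub) (trans (h b a b∈ a∈) ua)) , first) , bi)
          (λ ((u∉ , ¬h) , first) bi → let a , a∈ , ua = ¬hom G ¬h true ; b , b∈ , ub = ¬hom G ¬h false in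
            (u∉ , first , bi) , (a , ua , a∈) , (b , not-intro ub , b∈))))

      sum-separate : sumFin (λ a → sumFin λ b → 𝟙 (sol? (forces adj (adj u) (adj a) (adj b)) false (separate adj u a b c) W) * weigh false (lookup W))
        ≡ 𝟙 (inCube? c W) * (𝟙 (firstSeparator? G W u) * 𝟙 (bimodule? G W u))
      sum-separate = begin
        sumFin (λ a → sumFin λ b → 𝟙 (sol? (forces adj (adj u) (adj a) (adj b)) false (separate adj u a b c) W) * weigh false (lookup W))
          ≡⟨ sumFin-cong (λ a → sumFin-cong λ b → term a b) ⟩
        sumFin (λ a → sumFin λ b → k * 𝟙 (atA a) * 𝟙 (atB b))
          ≡⟨ sumFin-cong (λ a → trans (sumFin-*ˡ (k * 𝟙 (atA a)) (λ b → 𝟙 (atB b)))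
               (trans (cong (k * 𝟙 (atA a) *_) (sum-least natural-strict (hit? true (λ y → not (adj u y)) c W))) (swap k (𝟙 (atA a)) (𝟙 someB)))) ⟩
        sumFin (λ a → k * 𝟙 someB * 𝟙 (atA a))
          ≡⟨ sumFin-*ˡ (k * 𝟙 someB) (λ a → 𝟙 (atA a)) ⟩
        k * 𝟙 someB * sumFin (λ a → 𝟙 (atA a))
          ≡⟨ cong (k * 𝟙 someB *_) (sum-least natural-strict (hit? true (adj u) c W)) ⟩
        k * 𝟙 someB * 𝟙 someA
          ≡⟨ solve 4 (λ i r s t → i :* r :* s :* t := i :* (r :* (t :* s))) refl (𝟙 (inCube? c W)) (𝟙 rest?) (𝟙 someB) (𝟙 someA) ⟩
        𝟙 (inCube? c W) * (𝟙 rest? * (𝟙 someA * 𝟙 someB))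
          ≡⟨ cong (𝟙 (inCube? c W) *_) rest-separator ⟩
        𝟙 (inCube? c W) * (𝟙 (firstSeparator? G W u) * 𝟙 (bimodule? G W u)) ∎
        where
        open ≡-Reasoning
        open +-*-Solver using (solve; _:*_; _:=_; _:+_; con)
        k : ℕ
        k = 𝟙 (inCube? c W) * 𝟙 rest?
        swap : ∀ k x y → k * x * y ≡ k * y * x
        swap = solve 3 (λ k x y → k :* x :* y := k :* y :* x) refl
        term : ∀ a b → 𝟙 (sol? (forces adj (adj u) (adj a) (adj b)) false (separate adj u a b c) W) * weigh false (lookup W) ≡ k * 𝟙 (atA a) * 𝟙 (atB b)
        term a b = begin
          𝟙 s * weigh false (lookup W)  ≡⟨ cong (𝟙 s *_) (weigh-false (lookup W)) ⟩
          𝟙 s * 1                       ≡⟨ *-identityʳ (𝟙 s) ⟩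
          𝟙 s                           ≡⟨ 𝟙-×-when {p = s} {inCube? c W} {rest? ×-dec (atA a ×-dec atB b)} (separate-elim a b) (separate-intro a b) ⟩
          𝟙 (inCube? c W) * 𝟙 (rest? ×-dec (atA a ×-dec atB b)) ≡⟨ cong (𝟙 (inCube? c W) *_) (trans (𝟙-× rest? (atA a ×-dec atB b)) (cong (𝟙 rest? *_) (𝟙-× (atA a) (atB b)))) ⟩
          𝟙 (inCube? c W) * (𝟙 rest? * (𝟙 (atA a) * 𝟙 (atB b))) ≡⟨ solve 4 (λ i r s t → i :* (r :* (s :* t)) := i :* r :* s :* t) refl (𝟙 (inCube? c W)) (𝟙 rest?) (𝟙 (atA a)) (𝟙 (atB b)) ⟩
          k * 𝟙 (atA a) * 𝟙 (atB b)     ∎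
          where s = sol? (forces adj (adj u) (adj a) (adj b)) false (separate adj u a b c) W

    two-term : Fin n → Fin n → Fin n → Fin n → ℕ
    two-term w₁ w₂ u₁ u₂ = 𝟙 (sol? (forces adj (everything adj) (adj w₁) (adj w₁)) false (exclude true (other₂ adj w₁ w₂) (cube₄ adj w₁ w₂ u₁ u₂)) W) * weigh false (lookup W)

    three-term : Fin n → Fin n → Fin n → Fin n → Fin n → ℕ
    three-term w₁ w₂ u₁ u₂ w₃ = 𝟙 (sol? (forces adj (everything adj) (adj w₁) (adj w₁)) true (cube₅ adj w₁ w₂ u₁ u₂ w₃) W) * weigh true (lookup W)

    pair-term : Fin n → Fin n → Fin n → Fin n → Fin n → Fin n → Fin n → Fin n → ℕ
    pair-term w₁ w₂ u₁ u₂ w₃ u a b = 𝟙 (sol? (forces adj (adj u) (adj a) (adj b)) false (separate adj u a b (cube₅ adj w₁ w₂ u₁ u₂ w₃)) W) * weigh false (lookup W)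

    -- The share of W in `total`, once the sum over sets is moved to the outside.
    contribution : ℕ
    contribution = sumFin λ w₁ → sumFin λ w₂ → sumFin λ u₁ → sumFin λ u₂ →
      (two-term w₁ w₂ u₁ u₂ + two-term w₁ w₂ u₁ u₂) + sumFin λ w₃ →
        three-term w₁ w₂ u₁ u₂ w₃ + sumFin λ u → sumFin λ a → sumFin λ b →
          pair-term w₁ w₂ u₁ u₂ w₃ u a b + pair-term w₁ w₂ u₁ u₂ w₃ u a b

    private
      M nT T₃ K₃ K₄ : ℕ
      M = 𝟙 (module? G W)
      nT = 𝟙 (¬? (three? _ (inside? G W)))
      T₃ = 𝟙 (three? _ (inside? G W))
      K₃ = M * weigh true (lookup W) + (forced G W + forced G W)
      K₄ = (M * nT + M * nT) + T₃ * K₃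

    module _ (w₁ w₂ u₁ u₂ : Fin n) where

      private
        c₁ c₂ c₃ c₄ : Cube n
        c₁ = refine true (everything adj) _<F_ whole w₁
        c₂ = refine true (other₁ adj w₁) _<F_ c₁ w₂
        c₃ = refine false (everything adj) _<F_ c₂ u₁
        c₄ = cube₄ adj w₁ w₂ u₁ u₂

      c₁-elim : InCube c₁ W → In w₁
      c₁-elim W∈ = proj₂ (proj₁ (proj₂ (refine-elim true (everything adj) whole W {_<F_} {w₁} W∈)))

      c₃-elim : InCube c₃ W → Out u₁
      c₃-elim W∈ = proj₂ (proj₁ (proj₂ (refine-elim false (everything adj) c₂ W {_<F_} {u₁} W∈)))

      c₄-elim : InCube c₄ W → In w₁ × In w₂ × w₁ ≢ w₂
      c₄-elim W∈ =
        let in₃ , _ = refine-elim false (other₁ adj u₁) c₃ W {_<F_} {u₂} W∈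
            in₂ , _ = refine-elim false (everything adj) c₂ W {_<F_} {u₁} in₃
            in₁ , (other , w₂∈) , _ = refine-elim true (other₁ adj w₁) c₁ W {_<F_} {w₂} in₂
        in c₁-elim in₁ , w₂∈ , other-elim other ∘ sym

      hit-three : InCube c₄ W → ∀ {x} → Hit true (other₂ adj w₁ w₂) c₄ W x → Three In
      hit-three W∈ {x} (Px , x∈) = let w₁∈ , w₂∈ , w₁≢w₂ = c₄-elim W∈ ; x≢w₁ , x≢w₂ = ∧-elim {not (x ≡F w₁)} Px in
        w₁ , w₂ , x , w₁≢w₂ , other-elim x≢w₁ ∘ sym , other-elim x≢w₂ ∘ sym , w₁∈ , w₂∈ , x∈

      three-hit : Three In → ∃ (Hit true (other₂ adj w₁ w₂) c₄ W)
      three-hit three = let x , x≢w₁ , x≢w₂ , x∈ = third In {w₁} {w₂} three in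
        x , ∧-intro (other-intro x≢w₁) (other-intro x≢w₂) , x∈

      two-term-eq : two-term w₁ w₂ u₁ u₂ ≡ 𝟙 (inCube? c₄ W) * (M * nT)
      two-term-eq = trans (cong (𝟙 s *_) (weigh-false (lookup W))) (trans (*-identityʳ (𝟙 s)) (trans
        (𝟙-×-when {p = s} {inCube? c₄ W} {module? G W ×-dec ¬? (three? _ (inside? G W))}
          (λ (W∈ , closed) → let in₄ , ¬hit = exclude-elim true (other₂ adj w₁ w₂) c₄ W W∈ in
            in₄ , closed-module (proj₁ (c₄-elim in₄)) closed , λ three → let x , hit = three-hit three in ¬hit x hit)
          (λ in₄ (mod , ¬three) → exclude-intro true (other₂ adj w₁ w₂) c₄ W in₄ (λ y hit → ¬three (hit-three in₄ hit)) , module-closed (proj₁ (c₄-elim in₄)) mod))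
        (cong (𝟙 (inCube? c₄ W) *_) (𝟙-× (module? G W) (¬? (three? _ (inside? G W)))))))
        where s = sol? (forces adj (everything adj) (adj w₁) (adj w₁)) false (exclude true (other₂ adj w₁ w₂) c₄) W

      module _ (w₃ : Fin n) where

        private
          c₅ : Cube n
          c₅ = cube₅ adj w₁ w₂ u₁ u₂ w₃

        three-term-eq : three-term w₁ w₂ u₁ u₂ w₃ ≡ 𝟙 (inCube? c₅ W) * (M * weigh true (lookup W))
        three-term-eq = trans (cong (_* weigh true (lookup W)) (𝟙-×-when {p = s} {inCube? c₅ W} {module? G W}
            (λ (W∈ , closed) → W∈ , closed-module (w₁∈ W∈) closed) (λ W∈ mod → W∈ , module-closed (w₁∈ W∈) mod)))
          (*-assoc (𝟙 (inCube? c₅ W)) M _)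
          where
          s = sol? (forces adj (everything adj) (adj w₁) (adj w₁)) true c₅ W
          w₁∈ : InCube c₅ W → In w₁
          w₁∈ W∈ = proj₁ (c₄-elim (proj₁ (refine-elim true (other₂ adj w₁ w₂) c₄ W {_<F_} {w₃} W∈)))

        pair-terms-eq : sumFin (λ u → sumFin λ a → sumFin λ b → pair-term w₁ w₂ u₁ u₂ w₃ u a b + pair-term w₁ w₂ u₁ u₂ w₃ u a b)
          ≡ 𝟙 (inCube? c₅ W) * (forced G W + forced G W)
        pair-terms-eq = begin
          sumFin (λ u → sumFin λ a → sumFin λ b → p u a b + p u a b)
            ≡⟨ sumFin-cong (λ u → trans (sumFin-cong λ a → sumFin-+ (p u a) (p u a)) (sumFin-+ (λ a → sumFin (p u a)) (λ a → sumFin (p u a)))) ⟩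
          sumFin (λ u → sumFin (λ a → sumFin (p u a)) + sumFin (λ a → sumFin (p u a)))
            ≡⟨ sumFin-cong (λ u → trans (cong (λ j → j + j) (sum-separate c₅ u)) (sym (*-distribˡ-+ (𝟙 (inCube? c₅ W)) (f u) (f u)))) ⟩
          sumFin (λ u → 𝟙 (inCube? c₅ W) * (f u + f u))
            ≡⟨ sumFin-*ˡ (𝟙 (inCube? c₅ W)) (λ u → f u + f u) ⟩
          𝟙 (inCube? c₅ W) * sumFin (λ u → f u + f u)
            ≡⟨ cong (𝟙 (inCube? c₅ W) *_) (sumFin-+ f f) ⟩
          𝟙 (inCube? c₅ W) * (forced G W + forced G W) ∎
          where
          open ≡-Reasoning
          p : Fin n → Fin n → Fin n → ℕ
          p = pair-term w₁ w₂ u₁ u₂ w₃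
          f : Fin n → ℕ
          f u = 𝟙 (firstSeparator? G W u) * 𝟙 (bimodule? G W u)

      inner-eq : (two-term w₁ w₂ u₁ u₂ + two-term w₁ w₂ u₁ u₂) + sumFin (λ w₃ →
          three-term w₁ w₂ u₁ u₂ w₃ + sumFin λ u → sumFin λ a → sumFin λ b →
            pair-term w₁ w₂ u₁ u₂ w₃ u a b + pair-term w₁ w₂ u₁ u₂ w₃ u a b)
        ≡ 𝟙 (inCube? c₄ W) * K₄
      inner-eq = trans (cong₂ _+_ (cong (λ j → j + j) two-term-eq)
          (sum-step true (other₂ adj w₁ w₂) c₄
            (λ w₃ → trans (cong₂ _+_ (three-term-eq w₃) (pair-terms-eq w₃)) (sym (*-distribˡ-+ (𝟙 (inCube? (cube₅ adj w₁ w₂ u₁ u₂ w₃) W)) (M * weigh true (lookup W)) _)))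
            (λ W∈ → cong (_* K₃) (𝟙-cong {p = Fin.any? (hit? true (other₂ adj w₁ w₂) c₄ W)} {three? _ (inside? G W)} (λ (x , hit) → hit-three W∈ hit) three-hit))))
        (solve 3 (λ i m t → (i :* m :+ i :* m) :+ i :* t := i :* ((m :+ m) :+ t)) refl (𝟙 (inCube? c₄ W)) (M * nT) (T₃ * K₃))
        where open +-*-Solver using (solve; _:*_; _:=_; _:+_)

    private
      -- Removes the existence of a first element next to the stronger existence of two.
      absorb : ∀ {P Q : Set} (p : Dec P) (q : Dec Q) k → (Q → P) → 𝟙 p * (𝟙 q * k) ≡ 𝟙 q * k
      absorb (yes _) q       k f = +-identityʳ _
      absorb (no ¬p) (yes q) k f = contradiction (f q) ¬p
      absorb (no ¬p) (no _)  k f = refl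

      any-other : ∀ {d} {c : Cube n} {x} → lookup W x ≡ d → ∀ (q? : Dec (Two λ y → lookup W y ≡ d)) → 𝟙 (Fin.any? (hit? d (other₁ adj x) c W)) ≡ 𝟙 q?
      any-other {d} {c} {x} Wx q? = 𝟙-cong {p = Fin.any? (hit? d (other₁ adj x) c W)} {q?}
        (λ (y , other , Wy) → x , y , other-elim other ∘ sym , Wx , Wy)
        (λ two → let y , y≢x , Wy = another (λ y → lookup W y ≡ d) {x} two in y , other-intro y≢x , Wy)

    contribution-splits : contribution ≡ splits G W
    contribution-splits = trans
      (sum-step true (everything adj) whole (λ w₁ →
        sum-step true (other₁ adj w₁) (refine true (everything adj) _<F_ whole w₁) (λ w₂ →
          sum-step false (everything adj) (refine true (other₁ adj w₁) _<F_ (refine true (everything adj) _<F_ whole w₁) w₂) (λ u₁ →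
            sum-step false (other₁ adj u₁) (refine false (everything adj) _<F_ (refine true (other₁ adj w₁) _<F_ (refine true (everything adj) _<F_ whole w₁) w₂) u₁)
              (λ u₂ → inner-eq w₁ w₂ u₁ u₂)
              (λ W∈ → cong (_* K₄) (any-other {c = refine false (everything adj) _<F_ (refine true (other₁ adj w₁) _<F_ (refine true (everything adj) _<F_ whole w₁) w₂) u₁} (c₃-elim w₁ w₂ u₁ u₁ W∈) (two? _ (outside? G W)))))
            (λ _ → absorb (Fin.any? (hit? false (everything adj) whole W)) (two? _ (outside? G W)) K₄ (λ (x , _ , _ , out , _) → x , refl , out)))
          -- The repeated `w₁` fills the places of the vertices that are not yet chosen at this
          -- depth of the sum.
          (λ W∈ → cong (_* (𝟙 (two? _ (outside? G W)) * K₄)) (any-other {c = refine true (everything adj) _<F_ whole w₁} (c₁-elim w₁ w₁ w₁ w₁ W∈) (two? _ (inside? G W)))))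
        (λ _ → absorb (Fin.any? (hit? true (everything adj) whole W)) (two? _ (inside? G W)) _ (λ (x , _ , _ , inn , _) → x , refl , inn)))
      (trans (cong (_* splits G W) (𝟙-yes (inCube? whole W) λ _ _ ())) (*-identityˡ _))

  -- The algorithm

  private
    sumS-sum : ∀ {m} {x : Fin m → ℕ} {f : Fin m → Subset n → ℕ} → (∀ v → x v ≡ sumS (f v)) → sumFin x ≡ sumS (λ W → sumFin λ v → f v W)
    sumS-sum {f = f} eq = trans (sumFin-cong eq) (sumS-sumFin f)

    sumS-plus : ∀ {x y : ℕ} {f g : Subset n → ℕ} → x ≡ sumS f → y ≡ sumS g → x + y ≡ sumS (λ W → f W + g W)
    sumS-plus {f = f} {g} p q = trans (cong₂ _+_ p q) (sym (sumS-+ f g))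

  total-contributions : total adj ≡ sumS contribution
  total-contributions =
    sumS-sum λ w₁ → sumS-sum λ w₂ → sumS-sum λ u₁ → sumS-sum λ u₂ →
    sumS-plus (sumS-plus (two w₁ w₂ u₁ u₂) (two w₁ w₂ u₁ u₂)) (sumS-sum λ w₃ →
    sumS-plus (countClosed-correct adj adj-sym (everything adj) (adj w₁) (adj w₁) true (cube₅ adj w₁ w₂ u₁ u₂ w₃)) (sumS-sum λ u → sumS-sum λ a → sumS-sum λ b →
    sumS-plus (pair w₁ w₂ u₁ u₂ w₃ u a b) (pair w₁ w₂ u₁ u₂ w₃ u a b)))
    where
    two : ∀ w₁ w₂ u₁ u₂ → modules₂ adj w₁ w₂ u₁ u₂ ≡ sumS (λ W → two-term W w₁ w₂ u₁ u₂)
    two w₁ w₂ u₁ u₂ = countClosed-correct adj adj-sym (everything adj) (adj w₁) (adj w₁) false (exclude true (other₂ adj w₁ w₂) (cube₄ adj w₁ w₂ u₁ u₂))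
    pair : ∀ w₁ w₂ u₁ u₂ w₃ u a b → bimodules adj w₁ w₂ u₁ u₂ w₃ u a b ≡ sumS (λ W → pair-term W w₁ w₂ u₁ u₂ w₃ u a b)
    pair w₁ w₂ u₁ u₂ w₃ u a b = countClosed-correct adj adj-sym (adj u) (adj a) (adj b) false (separate adj u a b (cube₅ adj w₁ w₂ u₁ u₂ w₃))

  pairs-total : numHomogeneousPairs (n , G) ≡ total adj
  pairs-total = trans pairs-splits (sym (trans total-contributions (sumS-cong contribution-splits)))

corollary30 : PolyTimeComputable encodeGraph encodeℕ numHomogeneousPairs
corollary30 = total-polyTime λ n G → pairs-total G
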